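{- Let $k$ be a positive integer and $\epsilon>0$, and let $p_1<p_2<\cdots$ be the sequence of prime numbers. Then for all sufficiently large integers $h$ (depending on $k$ and $\epsilon$) there exist a positive integer $n$ and a set $\mathscr{J}\subseteq\{n+1,\dots,\lfloor(1+\epsilon)n\rfloor\}$ such that $$h=\sum_{i=1}^{n}\lfloor p_i^{1/k}\rfloor+\sum_{j\in\mathscr{J}}\lfloor p_j^{1/k}\rfloor .$$ -}

module Defs where

open import Data.Nat using (ℕ; zero; suc; _+_; _*_; _∸_; _^_; _≤_; _<_; _≤ᵇ_)
open import Data.Bool using (Bool; true; false; if_then_else_)
open import Data.Nat.Primality using (Prime)
open import Data.Integer as ℤ using (ℤ)
open import Data.Rational as ℚ using (ℚ)
open import Data.Product using (_×_; ∃-syntax)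
open import Relation.Binary.PropositionalEquality using (_≡_)

sumFrom : ℕ → ℕ → (ℕ → ℕ) → ℕ
sumFrom a zero    f = 0
sumFrom a (suc m) f = f a + sumFrom (suc a) m f

sumRange : ℕ → ℕ → (ℕ → ℕ) → ℕ
sumRange a b f = sumFrom a (suc b ∸ a) f

rootUpTo : ℕ → ℕ → ℕ → ℕ
rootUpTo k m zero    = 0
rootUpTo k m (suc b) = if (suc b ^ k) ≤ᵇ m then suc b else rootUpTo k m b

-- ⌊ m ^ (1/k) ⌋ for k ≥ 1 (the largest r with r ^ k ≤ m; note r ≤ m).
iroot : ℕ → ℕ → ℕ
iroot k m = rootUpTo k m m

-- P enumerates the primes in increasing order, 1-indexed: P 1 = p₁ = 2,
-- P 2 = 3, ...  (the value P 0 is irrelevant and unconstrained).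
record IsPrimeEnumeration (P : ℕ → ℕ) : Set where
  field
    prime    : ∀ i → 1 ≤ i → Prime (P i)
    strict   : ∀ i → 1 ≤ i → P i < P (suc i)
    complete : ∀ q → Prime q → ∃[ i ] (1 ≤ i × P i ≡ q)

floorScale : ℚ → ℕ → ℕ
floorScale ε n = ℤ.∣ ℚ.floor ((ℚ.1ℚ ℚ.+ ε) ℚ.* (ℤ.+ n ℚ./ 1)) ∣

{-# OPTIONS --safe #-}

-- Put aᵢ = ⌊pᵢ^(1/k)⌋.  Among the a_j with n < j ≤ (1+ε)n the pigeonhole principle gives many
-- disjoint pairs with one and the same small difference δ, hence a long arithmetic progression of
-- step δ among the subset sums; pairs whose difference is a multiple of δ lengthen it, and elements
-- prime to the divisors of δ then bring the step down to 1.  The subset sums therefore contain all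
-- integers of an interval so long that its translates by a₁ + … + aₙ overlap for consecutive n.
-- The arithmetic input is that, for every prime q, many a_j in the window are not divisible by q.
-- This is trivial for k = 1.  For k ≥ 2 the phases p^(1/k)/q of the primes are shown to be
-- equidistributed on average over rotations of the circle: Legendre's sieve removes the prime
-- factors up to a power of log p, and the larger prime factors are removed in short blocks, each
-- costing a bilinear sum.  After Cauchy-Schwarz, averaging over the rotation leaves a single phase
-- (p^(1/k) - p'^(1/k)) m^(1/k), which varies slowly in m and is handled by Abel summation.
-- That the n-th prime is O(n log n) follows from 2^(N-1) ≤ lcm(1, …, N) ≤ N^π(N).
module Submission where

open import Defs
open import Data.Nat hiding (_≟_; _≤?_; _<?_)
open import Data.Nat.Properties
open import Data.Nat.DivMod
open import Data.Nat.Divisibility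
open import Data.Nat.Primality hiding (prime)
open import Data.Nat.Induction using (<-rec)
open import Data.Nat.GCD using (gcd; gcd[m,n]∣m; gcd[m,n]∣n; module Bézout; gcd-GCD)
open import Data.Nat.Tactic.RingSolver using (solve-∀)
open import Data.Integer using (ℤ; +_; 0ℤ; 1ℤ)
import Data.Integer as ℤ
import Data.Integer.Properties as ℤP
open import Data.Integer.Tactic.RingSolver using () renaming (solve-∀ to solve-∀ᶻ)
import Data.Integer.DivMod as ℤD
open import Data.Rational using (ℚ; Positive; mkℚ)
import Data.Rational as ℚ
import Data.Rational.Properties as ℚP
import Data.Rational.Unnormalised as ℚᵘ
import Data.Rational.Unnormalised.Properties as ℚᵘP
open import Data.Bool using (Bool; true; false; if_then_else_; _∧_; not; T)
open import Data.Product using (_×_; _,_; proj₁; proj₂; Σ-syntax; ∃-syntax)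
open import Data.Sum using (_⊎_; inj₁; inj₂)
open import Data.Empty using (⊥; ⊥-elim)
open import Data.List using (List; []; _∷_; _++_; length)
open import Data.List.Properties using (length-++; ++-assoc; ++-identityʳ)
open import Data.List.Relation.Unary.All as All using (All; []; _∷_)
import Data.List.Relation.Unary.All.Properties as AllP
open import Data.List.Relation.Binary.Permutation.Propositional using (_↭_; prep; swap; ↭-refl; ↭-sym; ↭-trans)
import Data.List.Relation.Binary.Permutation.Propositional as Perm
import Data.List.Relation.Binary.Permutation.Propositional.Properties as PermP
open import Function using (_∘_; _$_; id)
open import Relation.Nullary using (¬_; yes; no; Dec; does)
open import Relation.Nullary.Decidable using (dec-true; dec-false)
open import Relation.Binary.PropositionalEquality hiding (J)
open import Algebra.Structures using (IsCommutativeSemiring)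

-- Divisibility is the obstacle: if all a_j of the window were multiples of a prime q, the step
-- could not drop to 1. A proportion of order 1/q of non-multiples is enough. No asymptotics for
-- primes are needed: the window has about n/D terms and p_n = O(n log n), so saving a fixed power
-- of the logarithm over the trivial bound suffices. Averaging over rotations is harmless, because a
-- multiple of q keeps its phase in one arc: w of the M = 2qw rotations give the wave the value -1
-- at all multiples of q simultaneously, so too few non-multiples would make many rotated prime sums
-- large. No real numbers occur: p^(1/k) is read off ⌊N p^(1/k)⌋, and the test function on the
-- circle is an integer step function of mean zero instead of an exponential. Its autocorrelation is
-- Lipschitz, so phases matter only up to a bounded error. All parameters are powers of one Λ = 2^ℓ
-- with Λ ≤ log₂ X < 2Λ. The sieve asks X to exceed Λ^(O(log Λ)), which is smaller than any fixed
-- power of X.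

-- Finite sums over a commutative semiring

module Summation {A : Set} {_⊕_ _⊗_ : A → A → A} {0# 1# : A}
  (isCSR : IsCommutativeSemiring _≡_ _⊕_ _⊗_ 0# 1#) where

  private module R = IsCommutativeSemiring isCSR

  sum : ℕ → (ℕ → A) → A
  sum zero    f = 0#
  sum (suc n) f = sum n f ⊕ f n

  sum-cong : ∀ n {f g} → (∀ i → i < n → f i ≡ g i) → sum n f ≡ sum n g
  sum-cong zero    eq = refl
  sum-cong (suc n) eq = cong₂ _⊕_ (sum-cong n (λ i i<n → eq i (m<n⇒m<1+n i<n))) (eq n ≤-refl)

  sum-0 : ∀ n {f} → (∀ i → i < n → f i ≡ 0#) → sum n f ≡ 0#
  sum-0 zero    eq = refl
  sum-0 (suc n) eq = trans (cong₂ _⊕_ (sum-0 n (λ i i<n → eq i (m<n⇒m<1+n i<n))) (eq n ≤-refl)) (R.+-identityˡ 0#)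

  medial : ∀ a b c d → (a ⊕ b) ⊕ (c ⊕ d) ≡ (a ⊕ c) ⊕ (b ⊕ d)
  medial a b c d = trans (R.+-assoc a b (c ⊕ d)) (trans (cong (a ⊕_)
    (trans (sym (R.+-assoc b c d)) (trans (cong (_⊕ d) (R.+-comm b c)) (R.+-assoc c b d)))) (sym (R.+-assoc a c (b ⊕ d))))

  sum-⊕ : ∀ n {f g} → sum n (λ i → f i ⊕ g i) ≡ sum n f ⊕ sum n g
  sum-⊕ zero    = sym (R.+-identityˡ 0#)
  sum-⊕ (suc n) {f} {g} = trans (cong (_⊕ (f n ⊕ g n)) (sum-⊕ n)) (medial (sum n f) (sum n g) (f n) (g n))

  sum-⊗ˡ : ∀ n c {f} → sum n (λ i → c ⊗ f i) ≡ c ⊗ sum n f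
  sum-⊗ˡ zero    c = sym (R.zeroʳ c)
  sum-⊗ˡ (suc n) c {f} = trans (cong (_⊕ (c ⊗ f n)) (sum-⊗ˡ n c)) (sym (R.distribˡ c (sum n f) (f n)))

  sum-⊗ʳ : ∀ n c {f} → sum n (λ i → f i ⊗ c) ≡ sum n f ⊗ c
  sum-⊗ʳ n c {f} = trans (sum-cong n (λ i _ → R.*-comm (f i) c)) (trans (sum-⊗ˡ n c) (R.*-comm c (sum n f)))

  sum-swap : ∀ m n {f : ℕ → ℕ → A} → sum m (λ i → sum n (f i)) ≡ sum n (λ j → sum m (λ i → f i j))
  sum-swap zero    n = sym (sum-0 n (λ _ _ → refl))
  sum-swap (suc m) n {f} = trans (cong (_⊕ sum n (f m)) (sum-swap m n)) (sym (sum-⊕ n))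

  sum-+ : ∀ m n {f} → sum (m + n) f ≡ sum m f ⊕ sum n (λ i → f (m + i))
  sum-+ m zero    {f} rewrite +-identityʳ m = sym (R.+-identityʳ (sum m f))
  sum-+ m (suc n) {f} rewrite +-suc m n =
    trans (cong (_⊕ f (m + n)) (sum-+ m n)) (R.+-assoc _ _ _)

open Summation +-*-isCommutativeSemiring public
  renaming (sum to ∑; sum-cong to ∑-cong; sum-0 to ∑-0; sum-⊕ to ∑-+; sum-⊗ˡ to ∑-*ˡ; sum-⊗ʳ to ∑-*ʳ; sum-swap to ∑-swap; sum-+ to ∑-split)
  using ()
open Summation ℤP.+-*-isCommutativeSemiring public
  renaming (sum to ∑ᶻ; sum-cong to ∑ᶻ-cong; sum-0 to ∑ᶻ-0; sum-⊕ to ∑ᶻ-+; sum-⊗ˡ to ∑ᶻ-*ˡ; sum-⊗ʳ to ∑ᶻ-*ʳ; sum-swap to ∑ᶻ-swap; sum-+ to ∑ᶻ-split)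
  using ()

∑-mono : ∀ n {f g} → (∀ i → i < n → f i ≤ g i) → ∑ n f ≤ ∑ n g
∑-mono zero    le = z≤n
∑-mono (suc n) le = +-mono-≤ (∑-mono n (λ i i<n → le i (m<n⇒m<1+n i<n))) (le n ≤-refl)

∑-const : ∀ n c → ∑ n (λ _ → c) ≡ n * c
∑-const zero    c = refl
∑-const (suc n) c = trans (cong (_+ c) (∑-const n c)) (+-comm (n * c) c)

∑-≤-const : ∀ n {f} c → (∀ i → i < n → f i ≤ c) → ∑ n f ≤ n * c
∑-≤-const n c le = ≤-trans (∑-mono n le) (≤-reflexive (∑-const n c))

∣∑ᶻ∣≤∑∣∣ : ∀ n {f} → ℤ.∣ ∑ᶻ n f ∣ ≤ ∑ n (λ i → ℤ.∣ f i ∣)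
∣∑ᶻ∣≤∑∣∣ zero    = z≤n
∣∑ᶻ∣≤∑∣∣ (suc n) {f} = ≤-trans (ℤP.∣i+j∣≤∣i∣+∣j∣ (∑ᶻ n f) (f n)) (+-monoˡ-≤ ℤ.∣ f n ∣ (∣∑ᶻ∣≤∑∣∣ n))

∣∑ᶻ∣≤ : ∀ n {f} c → (∀ i → i < n → ℤ.∣ f i ∣ ≤ c) → ℤ.∣ ∑ᶻ n f ∣ ≤ n * c
∣∑ᶻ∣≤ n c le = ≤-trans (∣∑ᶻ∣≤∑∣∣ n) (∑-≤-const n c le)

∑ᶻ-const : ∀ n c → ∑ᶻ n (λ _ → c) ≡ + n ℤ.* c
∑ᶻ-const zero    c = refl
∑ᶻ-const (suc n) c = trans (cong (ℤ._+ c) (∑ᶻ-const n c)) (trans (ℤP.+-comm (+ n ℤ.* c) c) (sym (ℤP.suc-* (+ n) c)))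

-- Integer roots

pow-cancel-< : ∀ k {a b} → a ^ k < b ^ k → a < b
pow-cancel-< k {a} {b} lt with a <? b
... | yes a<b = a<b
... | no a≮b  = ⊥-elim (<⇒≱ lt (^-monoˡ-≤ k (≮⇒≥ a≮b)))

root-unique : ∀ k {a b n} → a ^ k ≤ n → n < suc b ^ k → a ≤ b
root-unique k lo hi = ≤-pred (pow-cancel-< k (≤-<-trans lo hi))

rootUpTo-lower : ∀ k m b → 1 ≤ k → rootUpTo k m b ^ k ≤ m
rootUpTo-lower (suc k) m zero    _ = z≤n
rootUpTo-lower k m (suc b) 1≤k with (suc b ^ k) ≤ᵇ m in eq
... | true  = ≤ᵇ⇒≤ _ _ (subst T (sym eq) _)
... | false = rootUpTo-lower k m b 1≤k

rootUpTo-greatest : ∀ k m b r → r ≤ b → r ^ k ≤ m → r ≤ rootUpTo k m b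
rootUpTo-greatest k m zero    r r≤b _ = r≤b
rootUpTo-greatest k m (suc b) r r≤b r^k≤m with (suc b ^ k) ≤ᵇ m in eq
... | true  = r≤b
... | false with m≤n⇒m<n∨m≡n r≤b
...   | inj₁ r<1+b = rootUpTo-greatest k m b r (≤-pred r<1+b) r^k≤m
...   | inj₂ refl  = ⊥-elim (subst T eq (≤⇒≤ᵇ r^k≤m))

n≤n^k : ∀ k n → 1 ≤ k → n ≤ n ^ k
n≤n^k (suc k) zero    _ = z≤n
n≤n^k (suc k) (suc n) _ = m≤m*n (suc n) (suc n ^ k) {{m^n≢0 (suc n) k}}

iroot-lower : ∀ k n → 1 ≤ k → iroot k n ^ k ≤ n
iroot-lower k n = rootUpTo-lower k n n

iroot-greatest : ∀ k n r → 1 ≤ k → r ^ k ≤ n → r ≤ iroot k n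
iroot-greatest k n r 1≤k le = rootUpTo-greatest k n n r (≤-trans (n≤n^k k r 1≤k) le) le

iroot-upper : ∀ k n → 1 ≤ k → n < suc (iroot k n) ^ k
iroot-upper k n 1≤k with n <? suc (iroot k n) ^ k
... | yes lt = lt
... | no ge  = ⊥-elim (1+n≰n (iroot-greatest k n (suc (iroot k n)) 1≤k (≮⇒≥ ge)))

iroot-mono : ∀ k {m n} → 1 ≤ k → m ≤ n → iroot k m ≤ iroot k n
iroot-mono k {m} {n} 1≤k m≤n = iroot-greatest k n _ 1≤k (≤-trans (iroot-lower k m 1≤k) m≤n)

iroot-≤ : ∀ k n → 1 ≤ k → iroot k n ≤ n
iroot-≤ k n 1≤k = ≤-trans (n≤n^k k _ 1≤k) (iroot-lower k n 1≤k)

iroot-1 : ∀ n → iroot 1 n ≡ n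
iroot-1 n = ≤-antisym (iroot-≤ 1 n ≤-refl) (iroot-greatest 1 n n ≤-refl (≤-reflexive (*-identityʳ n)))

iroot-pos : ∀ k n → 1 ≤ k → 1 ≤ n → 1 ≤ iroot k n
iroot-pos k n 1≤k 1≤n = iroot-greatest k n 1 1≤k (≤-trans (≤-reflexive (^-zeroˡ k)) 1≤n)

-- The forward difference of j^k. The recursion has only nonnegative terms, so its monotonicity in
-- j, that is, the convexity of the power, follows by induction without subtraction.
Δ : ℕ → ℕ → ℕ
Δ zero    j = 0
Δ (suc k) j = suc j * Δ k j + j ^ k

Δ-step : ∀ k j → suc j ^ k ≡ j ^ k + Δ k j
Δ-step zero    j = refl
Δ-step (suc k) j = trans (cong (suc j *_) (Δ-step k j)) (lemma j (j ^ k) (Δ k j))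
  where
  lemma : ∀ j a d → suc j * (a + d) ≡ j * a + (suc j * d + a)
  lemma = solve-∀

Δ-mono : ∀ k {i j} → i ≤ j → Δ k i ≤ Δ k j
Δ-mono zero    le = z≤n
Δ-mono (suc k) le = +-mono-≤ (*-mono-≤ (s≤s le) (Δ-mono k le)) (^-monoˡ-≤ k le)

suc*Δ≤ : ∀ k j → suc j * Δ k j ≤ k * suc j ^ k
suc*Δ≤ zero    j = ≤-reflexive (*-zeroʳ j)
suc*Δ≤ (suc k) j = begin
  suc j * (suc j * Δ k j + j ^ k)  ≤⟨ *-monoʳ-≤ (suc j) (+-mono-≤ (suc*Δ≤ k j) (^-monoˡ-≤ k (n≤1+n j))) ⟩
  suc j * (k * suc j ^ k + suc j ^ k)  ≡⟨ lemma (suc j) k (suc j ^ k) ⟩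
  suc k * (suc j * suc j ^ k)  ∎
  where
  open ≤-Reasoning
  lemma : ∀ a k p → a * (k * p + p) ≡ suc k * (a * p)
  lemma = solve-∀

^-distribʳ-* : ∀ k a b → (a * b) ^ k ≡ a ^ k * b ^ k
^-distribʳ-* zero    a b = refl
^-distribʳ-* (suc k) a b = trans (cong (a * b *_) (^-distribʳ-* k a b)) ([m*n]*[o*p]≡[m*o]*[n*p] a b (a ^ k) (b ^ k))

-- The derivative bound k j^(k-1), multiplied by j to avoid the exponent k - 1; the factor 2^k pays
-- for replacing j + 1 by 2j.
*Δ≤ : ∀ k j → 1 ≤ j → j * Δ k j ≤ k * 2 ^ k * j ^ k
*Δ≤ k j 1≤j = begin
  j * Δ k j  ≤⟨ *-monoˡ-≤ (Δ k j) (n≤1+n j) ⟩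
  suc j * Δ k j  ≤⟨ suc*Δ≤ k j ⟩
  k * suc j ^ k  ≤⟨ *-monoʳ-≤ k (^-monoˡ-≤ k (≤-trans (+-monoˡ-≤ j 1≤j) (≤-reflexive (cong (_+_ j) (sym (+-identityʳ j)))))) ⟩
  k * (2 * j) ^ k  ≡⟨ cong (k *_) (^-distribʳ-* k 2 j) ⟩
  k * (2 ^ k * j ^ k)  ≡⟨ sym (*-assoc k (2 ^ k) (j ^ k)) ⟩
  k * 2 ^ k * j ^ k  ∎
  where open ≤-Reasoning

-- Sums over the level sets of ⌊κ m^(1/k)⌋

∣⊖∣ : ∀ a b → ℤ.∣ + a ℤ.- + b ∣ ≡ ∣ a - b ∣
∣⊖∣ a b = trans (cong ℤ.∣_∣ (ℤP.m-n≡m⊖n a b)) (helper a b)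
  where
  helper : ∀ a b → ℤ.∣ a ℤ.⊖ b ∣ ≡ ∣ a - b ∣
  helper a b with ≤-total a b
  ... | inj₁ a≤b = trans (ℤP.∣⊖∣-≤ a≤b) (sym (m≤n⇒∣m-n∣≡n∸m a≤b))
  ... | inj₂ b≤a = trans (ℤP.∣m⊖n∣≡∣n⊖m∣ a b) $ trans (ℤP.∣⊖∣-≤ b≤a) (sym (m≤n⇒∣n-m∣≡n∸m b≤a))

-- The sum over m groups into the level sets ("cells") of E, whose sizes are
-- second-order close, so Abel summation against the bounded partial sums of g
-- leaves only the last cell and the total variation of the cell sizes.
module Cells (k U V : ℕ) (1≤k : 1 ≤ k) {{_ : NonZero V}} (E : ℕ → ℕ)
  (lower : ∀ m → U * E m ^ k ≤ V * m) (upper : ∀ m → V * m < U * suc (E m) ^ k)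
  (g : ℕ → ℤ) (Θ : ℕ) (bounded : ∀ j → ℤ.∣ ∑ᶻ j g ∣ ≤ Θ) where

  -- The ceiling of U j^k / V, which is the first m with `E m` ≥ j.
  edge : ℕ → ℕ
  edge j = (U * j ^ k + pred V) / V

  edge-≥ : ∀ j → U * j ^ k ≤ V * edge j
  edge-≥ j = +-cancelʳ-≤ (pred V) _ _ (begin
    U * j ^ k + pred V  ≡⟨ m≡m%n+[m/n]*n (U * j ^ k + pred V) V ⟩
    (U * j ^ k + pred V) % V + edge j * V  ≡⟨ +-comm _ (edge j * V) ⟩
    edge j * V + (U * j ^ k + pred V) % V  ≤⟨ +-mono-≤ (≤-reflexive (*-comm (edge j) V)) (<⇒≤pred (m%n<n (U * j ^ k + pred V) V)) ⟩
    V * edge j + pred V  ∎)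
    where open ≤-Reasoning

  edge-< : ∀ j → V * edge j < U * j ^ k + V
  edge-< j = begin-strict
    V * edge j  ≡⟨ *-comm V (edge j) ⟩
    edge j * V  ≤⟨ m/n*n≤m (U * j ^ k + pred V) V ⟩
    U * j ^ k + pred V  <⟨ +-monoʳ-< (U * j ^ k) (≤-reflexive (suc-pred V)) ⟩
    U * j ^ k + V  ∎
    where open ≤-Reasoning

  edge-mono : ∀ j → edge j ≤ edge (suc j)
  edge-mono j = /-monoˡ-≤ V (+-monoˡ-≤ (pred V) (*-monoʳ-≤ U (^-monoˡ-≤ k (n≤1+n j))))

  edge-0 : edge 0 ≡ 0
  edge-0 = trans (cong (λ x → (x + pred V) / V) (trans (cong (U *_) (zero^ k 1≤k)) (*-zeroʳ U))) (m<n⇒m/n≡0 (≤-reflexive (suc-pred V)))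
    where
    zero^ : ∀ k → 1 ≤ k → 0 ^ k ≡ 0
    zero^ (suc k) _ = refl

  size : ℕ → ℕ
  size j = edge (suc j) ∸ edge j

  edge-suc : ∀ j → edge (suc j) ≡ edge j + size j
  edge-suc j = sym (m+[n∸m]≡n (edge-mono j))

  E-cell : ∀ j i → i < size j → E (edge j + i) ≡ j
  E-cell j i i<size = ≤-antisym
    (root-unique-U (≤-<-trans (lower m) (+-cancelʳ-< V _ _ (begin-strict
      V * m + V  ≡⟨ trans (+-comm (V * m) V) (sym (*-suc V m)) ⟩
      V * suc m  ≤⟨ *-monoʳ-≤ V (≤-trans (≤-reflexive (sym (+-suc (edge j) i))) (≤-trans (+-monoʳ-≤ (edge j) i<size) (≤-reflexive (sym (edge-suc j))))) ⟩
      V * edge (suc j)  <⟨ edge-< (suc j) ⟩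
      U * suc j ^ k + V  ∎))))
    (root-unique-U (≤-<-trans (≤-trans (edge-≥ j) (*-monoʳ-≤ V (m≤m+n (edge j) i))) (upper m)))
    where
    open ≤-Reasoning
    m = edge j + i
    root-unique-U : ∀ {a b} → U * a ^ k < U * suc b ^ k → a ≤ b
    root-unique-U {a} {b} lt = ≤-pred (pow-cancel-< k (*-cancelˡ-< U _ _ lt))

  cellSum : ℕ → ℤ
  cellSum J = ∑ᶻ J (λ j → + size j ℤ.* g j)

  sum-cells : ∀ J → ∑ᶻ (edge J) (g ∘ E) ≡ cellSum J
  sum-cells zero    = cong (λ n → ∑ᶻ n (g ∘ E)) edge-0
  sum-cells (suc J) = begin
    ∑ᶻ (edge (suc J)) (g ∘ E)  ≡⟨ cong (λ n → ∑ᶻ n (g ∘ E)) (edge-suc J) ⟩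
    ∑ᶻ (edge J + size J) (g ∘ E)  ≡⟨ ∑ᶻ-split (edge J) (size J) ⟩
    ∑ᶻ (edge J) (g ∘ E) ℤ.+ ∑ᶻ (size J) (λ i → g (E (edge J + i)))  ≡⟨ cong₂ ℤ._+_ (sum-cells J)
                                                                                 (trans (∑ᶻ-cong (size J) (λ i i< → cong g (E-cell J i i<))) (∑ᶻ-const (size J) (g J))) ⟩
    cellSum J ℤ.+ + size J ℤ.* g J  ∎
    where open ≡-Reasoning

  variation : ℕ → ℕ
  variation J = ∑ J (λ j → ∣ size j - size (suc j) ∣)

  -- Summation by parts. The boundary term carries the size of the next cell, so passing from J to J
  -- + 1 costs one difference of consecutive sizes times one partial sum of g.
  abel : ∀ J → ℤ.∣ cellSum J ℤ.- + size J ℤ.* ∑ᶻ J g ∣ ≤ Θ * variation J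
  abel zero    = ≤-reflexive (trans (cong ℤ.∣_∣ (cong (λ x → 0ℤ ℤ.- x) (ℤP.*-zeroʳ (+ size 0)))) (sym (*-zeroʳ Θ)))
  abel (suc J) = begin
    ℤ.∣ cellSum (suc J) ℤ.- + size (suc J) ℤ.* ∑ᶻ (suc J) g ∣
      ≡⟨ cong ℤ.∣_∣ (lemma (cellSum J) (+ size J) (g J) (+ size (suc J)) (∑ᶻ J g)) ⟩
    ℤ.∣ (cellSum J ℤ.- + size J ℤ.* ∑ᶻ J g) ℤ.+ ((+ size J) ℤ.- (+ size (suc J))) ℤ.* ∑ᶻ (suc J) g ∣
      ≤⟨ ℤP.∣i+j∣≤∣i∣+∣j∣ (cellSum J ℤ.- + size J ℤ.* ∑ᶻ J g) _ ⟩
    ℤ.∣ cellSum J ℤ.- + size J ℤ.* ∑ᶻ J g ∣ + ℤ.∣ ((+ size J) ℤ.- (+ size (suc J))) ℤ.* ∑ᶻ (suc J) g ∣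
      ≤⟨ +-mono-≤ (abel J) (≤-trans (≤-reflexive (trans (ℤP.abs-* (+ size J ℤ.- + size (suc J)) _) (cong (_* _) (∣⊖∣ (size J) (size (suc J)))))) (*-monoʳ-≤ ∣ size J - size (suc J) ∣ (bounded (suc J)))) ⟩
    Θ * variation J + ∣ size J - size (suc J) ∣ * Θ
      ≡⟨ trans (cong (_+_ (Θ * variation J)) (*-comm _ Θ)) (sym (*-distribˡ-+ Θ (variation J) _)) ⟩
    Θ * variation (suc J) ∎
    where
    open ≤-Reasoning
    lemma : ∀ C s γ s′ G → (C ℤ.+ s ℤ.* γ) ℤ.- s′ ℤ.* (G ℤ.+ γ) ≡ (C ℤ.- s ℤ.* G) ℤ.+ (s ℤ.- s′) ℤ.* (G ℤ.+ γ)
    lemma = solve-∀ᶻ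

  V-size-≤ : ∀ j → V * size j ≤ U * Δ k j + V
  V-size-≤ j = +-cancelˡ-≤ (V * edge j) _ _ (begin
    V * edge j + V * size j  ≡⟨ trans (sym (*-distribˡ-+ V (edge j) (size j))) (cong (V *_) (sym (edge-suc j))) ⟩
    V * edge (suc j)  ≤⟨ <⇒≤ (edge-< (suc j)) ⟩
    U * suc j ^ k + V  ≡⟨ cong (λ x → U * x + V) (Δ-step k j) ⟩
    U * (j ^ k + Δ k j) + V  ≡⟨ lemma U (j ^ k) (Δ k j) V ⟩
    U * j ^ k + (U * Δ k j + V)  ≤⟨ +-monoˡ-≤ _ (edge-≥ j) ⟩
    V * edge j + (U * Δ k j + V)  ∎)
    where
    open ≤-Reasoning
    lemma : ∀ u a d v → u * (a + d) + v ≡ u * a + (u * d + v)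
    lemma = solve-∀

  V-size-≥ : ∀ j → U * Δ k j ≤ V * size j + V
  V-size-≥ j = +-cancelˡ-≤ (U * j ^ k) _ _ (begin
    U * j ^ k + U * Δ k j  ≡⟨ trans (sym (*-distribˡ-+ U _ _)) (cong (U *_) (sym (Δ-step k j))) ⟩
    U * suc j ^ k  ≤⟨ edge-≥ (suc j) ⟩
    V * edge (suc j)  ≡⟨ trans (cong (V *_) (edge-suc j)) (*-distribˡ-+ V _ _) ⟩
    V * edge j + V * size j  ≤⟨ +-monoˡ-≤ _ (<⇒≤ (edge-< j)) ⟩
    U * j ^ k + V + V * size j  ≡⟨ lemma (U * j ^ k) V (V * size j) ⟩
    U * j ^ k + (V * size j + V)  ∎)
    where
    open ≤-Reasoning
    lemma : ∀ u a d → u + a + d ≡ u + (d + a)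
    lemma = solve-∀

  -- Every V · `size j` differs from U · `Δ k j` by at most V. Since `Δ` is monotone its differences
  -- telescope, and 2V per cell pays for the rounding.
  V-variation : ∀ J → V * variation J + U * Δ k 0 ≤ U * Δ k J + 2 * V * J
  V-variation zero    = ≤-reflexive (lemma V (U * Δ k 0))
    where
    lemma : ∀ v x → v * 0 + x ≡ x + 2 * v * 0
    lemma = solve-∀
  V-variation (suc J) = begin
    V * (variation J + d) + U * Δ k 0  ≡⟨ lemma₁ V (variation J) d (U * Δ k 0) ⟩
    V * variation J + U * Δ k 0 + V * d  ≤⟨ +-monoˡ-≤ (V * d) (V-variation J) ⟩
    U * Δ k J + 2 * V * J + V * d  ≡⟨ lemma₂ (U * Δ k J) (2 * V * J) (V * d) ⟩
    (V * d + U * Δ k J) + 2 * V * J  ≤⟨ +-monoˡ-≤ (2 * V * J) step ⟩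
    (U * Δ k (suc J) + 2 * V) + 2 * V * J  ≡⟨ lemma₃ (U * Δ k (suc J)) V J ⟩
    U * Δ k (suc J) + 2 * V * suc J  ∎
    where
    open ≤-Reasoning
    d = ∣ size J - size (suc J) ∣
    lemma₁ : ∀ v a d x → v * (a + d) + x ≡ v * a + x + v * d
    lemma₁ = solve-∀
    lemma₂ : ∀ a b c → a + b + c ≡ (c + a) + b
    lemma₂ = solve-∀
    lemma₃ : ∀ a v j → (a + 2 * v) + 2 * v * j ≡ a + 2 * v * suc j
    lemma₃ = solve-∀
    lemma₄ : ∀ a v → a + v + v ≡ a + 2 * v
    lemma₄ = solve-∀
    step : V * d + U * Δ k J ≤ U * Δ k (suc J) + 2 * V
    step with ≤-total (size J) (size (suc J))
    ... | inj₁ le = begin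
      V * d + U * Δ k J  ≡⟨ cong (λ x → V * x + U * Δ k J) (m≤n⇒∣m-n∣≡n∸m le) ⟩
      V * (size (suc J) ∸ size J) + U * Δ k J  ≤⟨ +-monoʳ-≤ (V * (size (suc J) ∸ size J)) (V-size-≥ J) ⟩
      V * (size (suc J) ∸ size J) + (V * size J + V) ≡⟨ trans (sym (+-assoc _ (V * size J) V)) (cong (_+ V) (trans (sym (*-distribˡ-+ V _ _)) (cong (V *_) (m∸n+n≡m le)))) ⟩
      V * size (suc J) + V  ≤⟨ +-monoˡ-≤ V (V-size-≤ (suc J)) ⟩
      U * Δ k (suc J) + V + V  ≡⟨ lemma₄ (U * Δ k (suc J)) V ⟩
      U * Δ k (suc J) + 2 * V  ∎
    ... | inj₂ ge = +-cancelʳ-≤ (V * size (suc J)) _ _ (begin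
      V * d + U * Δ k J + V * size (suc J)  ≡⟨ cong (λ x → V * x + U * Δ k J + V * size (suc J)) (m≤n⇒∣n-m∣≡n∸m ge) ⟩
      V * (size J ∸ size (suc J)) + U * Δ k J + V * size (suc J)  ≡⟨ lemma₅ (V * (size J ∸ size (suc J))) (U * Δ k J) (V * size (suc J)) ⟩
      (V * (size J ∸ size (suc J)) + V * size (suc J)) + U * Δ k J ≡⟨ cong (_+ U * Δ k J) (trans (sym (*-distribˡ-+ V _ _)) (cong (V *_) (m∸n+n≡m ge))) ⟩
      V * size J + U * Δ k J  ≤⟨ +-monoˡ-≤ (U * Δ k J) (V-size-≤ J) ⟩
      U * Δ k J + V + U * Δ k J  ≤⟨ +-mono-≤ (+-monoˡ-≤ V (*-monoʳ-≤ U (Δ-mono k (n≤1+n J)))) (≤-trans (*-monoʳ-≤ U (Δ-mono k (n≤1+n J))) (V-size-≥ (suc J))) ⟩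
      U * Δ k (suc J) + V + (V * size (suc J) + V)  ≡⟨ lemma₆ (U * Δ k (suc J)) V (V * size (suc J)) ⟩
      U * Δ k (suc J) + 2 * V + V * size (suc J)  ∎)
      where
      lemma₅ : ∀ a b c → a + b + c ≡ (a + c) + b
      lemma₅ = solve-∀
      lemma₆ : ∀ a v c → a + v + (c + v) ≡ a + 2 * v + c
      lemma₆ = solve-∀

  ∣g∣≤ : ∀ j → ℤ.∣ g j ∣ ≤ 2 * Θ
  ∣g∣≤ j = begin
    ℤ.∣ g j ∣  ≡⟨ cong ℤ.∣_∣ (lemma (∑ᶻ j g) (g j)) ⟩
    ℤ.∣ ∑ᶻ (suc j) g ℤ.- ∑ᶻ j g ∣  ≤⟨ ℤP.∣i-j∣≤∣i∣+∣j∣ (∑ᶻ (suc j) g) (∑ᶻ j g) ⟩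
    ℤ.∣ ∑ᶻ (suc j) g ∣ + ℤ.∣ ∑ᶻ j g ∣  ≤⟨ +-mono-≤ (bounded (suc j)) (bounded j) ⟩
    Θ + Θ  ≡⟨ cong (_+_ Θ) (sym (+-identityʳ Θ)) ⟩
    2 * Θ  ∎
    where
    open ≤-Reasoning
    lemma : ∀ G γ → γ ≡ (G ℤ.+ γ) ℤ.- G
    lemma = solve-∀ᶻ

  module _ (Z : ℕ) where
    private
      J = E Z
      rest = Z ∸ edge J

    edge≤Z : edge J ≤ Z
    edge≤Z = ≤-pred (*-cancelˡ-< V _ _ (<-≤-trans (edge-< J)
      (≤-trans (+-monoˡ-≤ V (lower Z)) (≤-reflexive (trans (+-comm (V * Z) V) (sym (*-suc V Z)))))))

    rest≤size : rest ≤ size J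
    rest≤size = ∸-monoˡ-≤ (edge J) (<⇒≤ (*-cancelˡ-< V _ _ (<-≤-trans (upper Z) (edge-≥ (suc J)))))

    sum-decomposition : ∑ᶻ Z (g ∘ E) ≡ (cellSum J ℤ.- + size J ℤ.* ∑ᶻ J g) ℤ.+ (+ size J ℤ.* ∑ᶻ J g ℤ.+ + rest ℤ.* g J)
    sum-decomposition = begin
      ∑ᶻ Z (g ∘ E)  ≡⟨ cong (λ n → ∑ᶻ n (g ∘ E)) (sym (m+[n∸m]≡n edge≤Z)) ⟩
      ∑ᶻ (edge J + rest) (g ∘ E)  ≡⟨ ∑ᶻ-split (edge J) rest ⟩
      ∑ᶻ (edge J) (g ∘ E) ℤ.+ ∑ᶻ rest (λ i → g (E (edge J + i)))
        ≡⟨ cong₂ ℤ._+_ (sum-cells J) (trans (∑ᶻ-cong rest (λ i i< → cong g (E-cell J i (<-≤-trans i< rest≤size)))) (∑ᶻ-const rest (g J))) ⟩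
      cellSum J ℤ.+ + rest ℤ.* g J  ≡⟨ lemma (cellSum J) (+ rest ℤ.* g J) (+ size J ℤ.* ∑ᶻ J g) ⟩
      (cellSum J ℤ.- + size J ℤ.* ∑ᶻ J g) ℤ.+ (+ size J ℤ.* ∑ᶻ J g ℤ.+ + rest ℤ.* g J) ∎
      where
      open ≡-Reasoning
      lemma : ∀ a b c → a ℤ.+ b ≡ (a ℤ.- c) ℤ.+ (c ℤ.+ b)
      lemma = solve-∀ᶻ

    -- Besides the variation, the boundary term of `abel` contributes Θ per unit of the last size,
    -- and the incomplete last cell contributes 2Θ.
    ∣sum∣≤ : ℤ.∣ ∑ᶻ Z (g ∘ E) ∣ ≤ Θ * variation J + 3 * Θ * size J
    ∣sum∣≤ = begin
      ℤ.∣ ∑ᶻ Z (g ∘ E) ∣  ≡⟨ cong ℤ.∣_∣ sum-decomposition ⟩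
      ℤ.∣ (cellSum J ℤ.- + size J ℤ.* ∑ᶻ J g) ℤ.+ (+ size J ℤ.* ∑ᶻ J g ℤ.+ + rest ℤ.* g J) ∣
        ≤⟨ ≤-trans (ℤP.∣i+j∣≤∣i∣+∣j∣ (cellSum J ℤ.- + size J ℤ.* ∑ᶻ J g) _) (+-monoʳ-≤ _ (ℤP.∣i+j∣≤∣i∣+∣j∣ (+ size J ℤ.* ∑ᶻ J g) _)) ⟩
      ℤ.∣ cellSum J ℤ.- + size J ℤ.* ∑ᶻ J g ∣ + (ℤ.∣ + size J ℤ.* ∑ᶻ J g ∣ + ℤ.∣ + rest ℤ.* g J ∣)
        ≤⟨ +-mono-≤ (abel J) (+-mono-≤ (≤-trans (≤-reflexive (ℤP.abs-* (+ size J) _)) (*-monoʳ-≤ (size J) (bounded J)))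
                                       (≤-trans (≤-reflexive (ℤP.abs-* (+ rest) _)) (*-mono-≤ rest≤size (∣g∣≤ J)))) ⟩
      Θ * variation J + (size J * Θ + size J * (2 * Θ))  ≡⟨ lemma (Θ * variation J) (size J) Θ ⟩
      Θ * variation J + 3 * Θ * size J ∎
      where
      open ≤-Reasoning
      lemma : ∀ a s t → a + (s * t + s * (2 * t)) ≡ a + 3 * t * s
      lemma = solve-∀

    V-∣sum∣≤ : V * ℤ.∣ ∑ᶻ Z (g ∘ E) ∣ ≤ Θ * (4 * (U * Δ k J) + 2 * V * J + 3 * V)
    V-∣sum∣≤ = begin
      V * ℤ.∣ ∑ᶻ Z (g ∘ E) ∣  ≤⟨ *-monoʳ-≤ V ∣sum∣≤ ⟩
      V * (Θ * variation J + 3 * Θ * size J)  ≡⟨ lemma₁ V Θ (variation J) (size J) ⟩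
      Θ * (V * variation J + 3 * (V * size J))  ≤⟨ *-monoʳ-≤ Θ (+-mono-≤ (≤-trans (m≤m+n (V * variation J) (U * Δ k 0)) (V-variation J)) (*-monoʳ-≤ 3 (V-size-≤ J))) ⟩
      Θ * (U * Δ k J + 2 * V * J + 3 * (U * Δ k J + V))  ≡⟨ lemma₂ Θ (U * Δ k J) V J ⟩
      Θ * (4 * (U * Δ k J) + 2 * V * J + 3 * V)  ∎
      where
      open ≤-Reasoning
      lemma₁ : ∀ v t a s → v * (t * a + 3 * t * s) ≡ t * (v * a + 3 * (v * s))
      lemma₁ = solve-∀
      lemma₂ : ∀ t u v j → t * (u + 2 * v * j + 3 * (u + v)) ≡ t * (4 * u + 2 * v * j + 3 * v)
      lemma₂ = solve-∀

    -- The factor J⁺ turns the difference `Δ k J⁺` back into the power J⁺^k. Allowing any J⁺ above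
    -- `E Z` lets one J⁺ serve a whole family of phases at once.
    V-J-∣sum∣≤ : ∀ J⁺ → 1 ≤ J⁺ → E Z ≤ J⁺ →
      V * J⁺ * ℤ.∣ ∑ᶻ Z (g ∘ E) ∣ ≤ Θ * (4 * (k * 2 ^ k) * (U * J⁺ ^ k) + 5 * V * (J⁺ * J⁺))
    V-J-∣sum∣≤ J⁺ 1≤J⁺ J≤J⁺ = begin
      V * J⁺ * ℤ.∣ ∑ᶻ Z (g ∘ E) ∣  ≡⟨ lemma₁ V J⁺ _ ⟩
      J⁺ * (V * ℤ.∣ ∑ᶻ Z (g ∘ E) ∣)  ≤⟨ *-monoʳ-≤ J⁺ V-∣sum∣≤ ⟩
      J⁺ * (Θ * (4 * (U * Δ k J) + 2 * V * J + 3 * V))  ≤⟨ *-monoʳ-≤ J⁺ (*-monoʳ-≤ Θ (+-mono-≤ (+-mono-≤ (*-monoʳ-≤ 4 (*-monoʳ-≤ U (Δ-mono k J≤J⁺))) (*-monoʳ-≤ (2 * V) J≤J⁺))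
                                                                        (≤-trans (≤-reflexive (sym (*-identityʳ (3 * V)))) (*-monoʳ-≤ (3 * V) 1≤J⁺)))) ⟩
      J⁺ * (Θ * (4 * (U * Δ k J⁺) + 2 * V * J⁺ + 3 * V * J⁺))  ≡⟨ lemma₂ J⁺ Θ U (Δ k J⁺) V ⟩
      Θ * (4 * U * (J⁺ * Δ k J⁺) + 5 * V * (J⁺ * J⁺))  ≤⟨ *-monoʳ-≤ Θ (+-monoˡ-≤ _ (*-monoʳ-≤ (4 * U) (*Δ≤ k J⁺ 1≤J⁺))) ⟩
      Θ * (4 * U * (k * 2 ^ k * J⁺ ^ k) + 5 * V * (J⁺ * J⁺))  ≡⟨ lemma₃ Θ U (k * 2 ^ k) (J⁺ ^ k) _ ⟩
      Θ * (4 * (k * 2 ^ k) * (U * J⁺ ^ k) + 5 * V * (J⁺ * J⁺))  ∎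
      where
      open ≤-Reasoning
      lemma₁ : ∀ v j s → v * j * s ≡ j * (v * s)
      lemma₁ = solve-∀
      lemma₂ : ∀ j t u d v → j * (t * (4 * (u * d) + 2 * v * j + 3 * v * j)) ≡ t * (4 * u * (j * d) + 5 * v * (j * j))
      lemma₂ = solve-∀
      lemma₃ : ∀ t u c p x → t * (4 * u * (c * p) + x) ≡ t * (4 * c * (u * p) + x)
      lemma₃ = solve-∀

-- Periodic functions and their correlations

+ᶻ-cancelˡ : ∀ a {x y} → a ℤ.+ x ≡ a ℤ.+ y → x ≡ y
+ᶻ-cancelˡ a {x} {y} eq = trans (lemma a x) (trans (cong (ℤ._- a) eq) (sym (lemma a y)))
  where
  lemma : ∀ a x → x ≡ (a ℤ.+ x) ℤ.- a
  lemma = solve-∀ᶻ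

∑ᶻ-head : ∀ n {f} → ∑ᶻ (suc n) f ≡ f 0 ℤ.+ ∑ᶻ n (f ∘ suc)
∑ᶻ-head n {f} = trans (∑ᶻ-split 1 n) (cong (ℤ._+ ∑ᶻ n (f ∘ suc)) (ℤP.+-identityˡ (f 0)))

module Periodic (M : ℕ) {{_ : NonZero M}} (h : ℕ → ℤ) (periodic : ∀ a → h (M + a) ≡ h a) where

  sum-shift : ∀ b → ∑ᶻ M (λ t → h (b + t)) ≡ ∑ᶻ M h
  sum-shift zero    = refl
  sum-shift (suc b) = trans (+ᶻ-cancelˡ (h b) (begin
    h b ℤ.+ ∑ᶻ M (λ t → h (suc b + t))  ≡⟨ cong₂ ℤ._+_ (cong h (sym (+-identityʳ b))) (∑ᶻ-cong M (λ t _ → cong h (sym (+-suc b t)))) ⟩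
    h (b + 0) ℤ.+ ∑ᶻ M (λ t → h (b + suc t))  ≡⟨ sym (∑ᶻ-head M) ⟩
    ∑ᶻ M (λ t → h (b + t)) ℤ.+ h (b + M)  ≡⟨ cong (λ x → ∑ᶻ M (λ t → h (b + t)) ℤ.+ x) (trans (cong h (+-comm b M)) (periodic b)) ⟩
    ∑ᶻ M (λ t → h (b + t)) ℤ.+ h b  ≡⟨ ℤP.+-comm _ (h b) ⟩
    h b ℤ.+ ∑ᶻ M (λ t → h (b + t))  ∎)) (sum-shift b)
    where open ≡-Reasoning

  module _ (balanced : ∑ᶻ M h ≡ 0ℤ) where

    sum-periods : ∀ c r → ∑ᶻ (c * M + r) h ≡ ∑ᶻ r h
    sum-periods zero    r = refl
    sum-periods (suc c) r = begin
      ∑ᶻ (M + c * M + r) h  ≡⟨ cong (λ n → ∑ᶻ n h) (+-assoc M (c * M) r) ⟩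
      ∑ᶻ (M + (c * M + r)) h  ≡⟨ ∑ᶻ-split M (c * M + r) ⟩
      ∑ᶻ M h ℤ.+ ∑ᶻ (c * M + r) (λ i → h (M + i))  ≡⟨ cong₂ ℤ._+_ balanced (∑ᶻ-cong (c * M + r) (λ i _ → periodic i)) ⟩
      0ℤ ℤ.+ ∑ᶻ (c * M + r) h  ≡⟨ trans (ℤP.+-identityˡ _) (sum-periods c r) ⟩
      ∑ᶻ r h  ∎
      where open ≡-Reasoning

    ∣partial-sum∣≤ : ∀ {B} → (∀ a → ℤ.∣ h a ∣ ≤ B) → ∀ j → ℤ.∣ ∑ᶻ j h ∣ ≤ M * B
    ∣partial-sum∣≤ {B} bd j = begin
      ℤ.∣ ∑ᶻ j h ∣  ≡⟨ cong (λ n → ℤ.∣ ∑ᶻ n h ∣) (trans (m≡m%n+[m/n]*n j M) (+-comm (j % M) _)) ⟩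
      ℤ.∣ ∑ᶻ ((j / M) * M + j % M) h ∣  ≡⟨ cong ℤ.∣_∣ (sum-periods (j / M) (j % M)) ⟩
      ℤ.∣ ∑ᶻ (j % M) h ∣  ≤⟨ ∣∑ᶻ∣≤ (j % M) B (λ i _ → bd i) ⟩
      j % M * B  ≤⟨ *-monoˡ-≤ B (<⇒≤ (m%n<n j M)) ⟩
      M * B  ∎
      where open ≤-Reasoning

-- The circle ℤ/M is cut into b arcs of length w; `φ` is b - 1 on the first arc and -1 on the
-- others, hence has mean zero. It takes the place of an additive character.
module Wave (b w : ℕ) {{b≢0 : NonZero b}} {{w≢0 : NonZero w}} where

  M : ℕ
  M = b * w

  instance
    M≢0 : NonZero M
    M≢0 = m*n≢0 b w

  χ : ℕ → ℕ
  χ a = if (a % M) <ᵇ w then 1 else 0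

  φ : ℕ → ℤ
  φ a = + b ℤ.* + χ a ℤ.- 1ℤ

  χ-in : ∀ a → a % M < w → χ a ≡ 1
  χ-in a lt with (a % M) <ᵇ w | <⇒<ᵇ lt
  ... | true | _ = refl

  χ-out : ∀ a → w ≤ a % M → χ a ≡ 0
  χ-out a ge with (a % M) <ᵇ w in eq
  ... | true  = ⊥-elim (<⇒≱ (<ᵇ⇒< (a % M) w (subst T (sym eq) _)) ge)
  ... | false = refl

  φ-out : ∀ a → w ≤ a % M → φ a ≡ ℤ.- 1ℤ
  φ-out a ge = trans (cong (λ x → + b ℤ.* + x ℤ.- 1ℤ) (χ-out a ge)) (cong (ℤ._- 1ℤ) (ℤP.*-zeroʳ (+ b)))

  ∣φ∣≤b : ∀ a → ℤ.∣ φ a ∣ ≤ b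
  ∣φ∣≤b a with (a % M) <ᵇ w
  ... | false = ≤-trans (≤-reflexive (cong (λ x → ℤ.∣ x ℤ.- 1ℤ ∣) (ℤP.*-zeroʳ (+ b)))) (>-nonZero⁻¹ b)
  ... | true  = ≤-trans (≤-reflexive (cong (λ x → ℤ.∣ x ℤ.- 1ℤ ∣) (ℤP.*-identityʳ (+ b)))) (pred≤ b)
    where
    pred≤ : ∀ b {{_ : NonZero b}} → ℤ.∣ + b ℤ.- 1ℤ ∣ ≤ b
    pred≤ (suc b) = n≤1+n b

  φ-periodic : ∀ a → φ (M + a) ≡ φ a
  φ-periodic a = cong (λ r → + b ℤ.* + (if r <ᵇ w then 1 else 0) ℤ.- 1ℤ) (trans (cong (_% M) (+-comm M a)) ([m+n]%n≡m%n a M))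

  sum-χ : ∀ h → ∑ᶻ M (λ i → h i ℤ.* + χ i) ≡ ∑ᶻ w h
  sum-χ h = begin
    ∑ᶻ M (λ i → h i ℤ.* + χ i)  ≡⟨ cong (λ n → ∑ᶻ n (λ i → h i ℤ.* + χ i)) (sym w+rest) ⟩
    ∑ᶻ (w + pred b * w) (λ i → h i ℤ.* + χ i)  ≡⟨ ∑ᶻ-split w (pred b * w) ⟩
    ∑ᶻ w (λ i → h i ℤ.* + χ i) ℤ.+ ∑ᶻ (pred b * w) (λ i → h (w + i) ℤ.* + χ (w + i))
      ≡⟨ cong₂ ℤ._+_
           (∑ᶻ-cong w (λ i i<w → trans (cong (λ x → h i ℤ.* + x) (χ-in i (subst (_< w) (sym (small i<w)) i<w))) (ℤP.*-identityʳ (h i))))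
           (∑ᶻ-0 (pred b * w) (λ i i< → trans (cong (λ x → h (w + i) ℤ.* + x) (χ-out (w + i) (subst (w ≤_) (sym (m<n⇒m%n≡m (<-≤-trans (+-monoʳ-< w i<) (≤-reflexive w+rest)))) (m≤m+n w i)))) (ℤP.*-zeroʳ (h (w + i))))) ⟩
    ∑ᶻ w h ℤ.+ 0ℤ  ≡⟨ ℤP.+-identityʳ _ ⟩
    ∑ᶻ w h  ∎
    where
    open ≡-Reasoning
    w+rest : w + pred b * w ≡ M
    w+rest = cong (_* w) (suc-pred b)
    small : ∀ {i} → i < w → i % M ≡ i
    small i<w = m<n⇒m%n≡m (<-≤-trans i<w (m≤n*m w b))

  φ-balanced : ∑ᶻ M φ ≡ 0ℤ
  φ-balanced = begin
    ∑ᶻ M φ  ≡⟨ ∑ᶻ-+ M ⟩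
    ∑ᶻ M (λ i → + b ℤ.* + χ i) ℤ.+ ∑ᶻ M (λ _ → ℤ.- 1ℤ)  ≡⟨ cong₂ ℤ._+_ (trans (sum-χ (λ _ → + b)) (∑ᶻ-const w (+ b))) (∑ᶻ-const M (ℤ.- 1ℤ)) ⟩
    + w ℤ.* + b ℤ.+ + M ℤ.* ℤ.- 1ℤ  ≡⟨ cong (λ x → + w ℤ.* + b ℤ.+ x ℤ.* ℤ.- 1ℤ) (ℤP.pos-* b w) ⟩
    + w ℤ.* + b ℤ.+ (+ b ℤ.* + w) ℤ.* ℤ.- 1ℤ  ≡⟨ lemma (+ w) (+ b) ⟩
    0ℤ  ∎
    where
    open ≡-Reasoning
    lemma : ∀ x y → x ℤ.* y ℤ.+ (y ℤ.* x) ℤ.* ℤ.- 1ℤ ≡ 0ℤ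
    lemma = solve-∀ᶻ

  φ-balanced-shift : ∀ c → ∑ᶻ M (λ t → φ (c + t)) ≡ 0ℤ
  φ-balanced-shift c = trans (Periodic.sum-shift M φ φ-periodic c) φ-balanced

  -- The autocorrelation of `φ` in closed form: writing one factor as b χ - 1, the -1 meets the mean
  -- zero of the other factor and only a window sum survives.
  Ψ : ℕ → ℤ
  Ψ c = + b ℤ.* ∑ᶻ w (λ s → φ (c + s))

  φ-shift-periodic : ∀ c a → φ (c + (M + a)) ≡ φ (c + a)
  φ-shift-periodic c a = trans (cong φ (trans (sym (+-assoc c M a)) (trans (cong (_+ a) (+-comm c M)) (+-assoc M c a)))) (φ-periodic (c + a))

  -- Summed over all shifts t, the correlation of two translates depends on their difference only.
  correlation : ∀ c a → ∑ᶻ M (λ t → φ (c + a + t) ℤ.* φ (a + t)) ≡ Ψ c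
  correlation c a = begin
    ∑ᶻ M (λ t → φ (c + a + t) ℤ.* φ (a + t))  ≡⟨ ∑ᶻ-cong M (λ t _ → cong (λ x → φ x ℤ.* φ (a + t)) (+-assoc c a t)) ⟩
    ∑ᶻ M (λ t → h (a + t))  ≡⟨ Periodic.sum-shift M h (λ x → cong₂ ℤ._*_ (φ-shift-periodic c x) (φ-periodic x)) a ⟩
    ∑ᶻ M h  ≡⟨ ∑ᶻ-cong M (λ t _ → lemma (φ (c + t)) (+ b) (+ χ t)) ⟩
    ∑ᶻ M (λ t → + b ℤ.* (φ (c + t) ℤ.* + χ t) ℤ.+ ℤ.- 1ℤ ℤ.* φ (c + t))  ≡⟨ ∑ᶻ-+ M ⟩
    ∑ᶻ M (λ t → + b ℤ.* (φ (c + t) ℤ.* + χ t)) ℤ.+ ∑ᶻ M (λ t → ℤ.- 1ℤ ℤ.* φ (c + t))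
      ≡⟨ cong₂ ℤ._+_ (trans (∑ᶻ-*ˡ M (+ b)) (cong (ℤ._*_ (+ b)) (sum-χ (λ t → φ (c + t)))))
                     (trans (∑ᶻ-*ˡ M (ℤ.- 1ℤ)) (cong (ℤ._*_ (ℤ.- 1ℤ)) (φ-balanced-shift c))) ⟩
    Ψ c ℤ.+ 0ℤ  ≡⟨ ℤP.+-identityʳ (Ψ c) ⟩
    Ψ c  ∎
    where
    open ≡-Reasoning
    h : ℕ → ℤ
    h x = φ (c + x) ℤ.* φ x
    lemma : ∀ f y z → f ℤ.* (y ℤ.* z ℤ.- 1ℤ) ≡ y ℤ.* (f ℤ.* z) ℤ.+ ℤ.- 1ℤ ℤ.* f
    lemma = solve-∀ᶻ

  Ψ-periodic : ∀ c → Ψ (M + c) ≡ Ψ c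
  Ψ-periodic c = cong (ℤ._*_ (+ b)) (∑ᶻ-cong w (λ s _ → trans (cong φ (+-assoc M c s)) (φ-periodic (c + s))))

  Ψ-balanced : ∑ᶻ M Ψ ≡ 0ℤ
  Ψ-balanced = begin
    ∑ᶻ M Ψ  ≡⟨ ∑ᶻ-*ˡ M (+ b) ⟩
    + b ℤ.* ∑ᶻ M (λ c → ∑ᶻ w (λ s → φ (c + s)))  ≡⟨ cong (ℤ._*_ (+ b)) (∑ᶻ-swap M w) ⟩
    + b ℤ.* ∑ᶻ w (λ s → ∑ᶻ M (λ c → φ (c + s)))  ≡⟨ cong (ℤ._*_ (+ b)) (∑ᶻ-0 w (λ s _ → trans (∑ᶻ-cong M (λ c _ → cong φ (+-comm c s))) (φ-balanced-shift s))) ⟩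
    + b ℤ.* 0ℤ  ≡⟨ ℤP.*-zeroʳ (+ b) ⟩
    0ℤ  ∎
    where open ≡-Reasoning

  ∣Ψ∣≤ : ∀ c → ℤ.∣ Ψ c ∣ ≤ M * b
  ∣Ψ∣≤ c = begin
    ℤ.∣ Ψ c ∣  ≡⟨ ℤP.abs-* (+ b) _ ⟩
    b * ℤ.∣ ∑ᶻ w (λ s → φ (c + s)) ∣  ≤⟨ *-monoʳ-≤ b (∣∑ᶻ∣≤ w b (λ s _ → ∣φ∣≤b (c + s))) ⟩
    b * (w * b)  ≡⟨ sym (*-assoc b w b) ⟩
    M * b  ∎
    where open ≤-Reasoning

  Ψ-partial-sums : ∀ j → ℤ.∣ ∑ᶻ j Ψ ∣ ≤ M * (M * b)
  Ψ-partial-sums = Periodic.∣partial-sum∣≤ M Ψ Ψ-periodic Ψ-balanced ∣Ψ∣≤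

  φ-partial-sums : ∀ t j → ℤ.∣ ∑ᶻ j (λ a → φ (a + t)) ∣ ≤ M * b
  φ-partial-sums t = Periodic.∣partial-sum∣≤ M (λ a → φ (a + t)) (λ a → trans (cong φ (+-assoc M a t)) (φ-periodic (a + t)))
    (trans (∑ᶻ-cong M (λ a _ → cong φ (+-comm a t))) (φ-balanced-shift t)) (λ a → ∣φ∣≤b (a + t))

  -- Moving a window by one exchanges only its two end values. Hence `Ψ` is Lipschitz although `φ`
  -- jumps, and a bounded error in the phase does little harm.
  Ψ-suc : ∀ c → ℤ.∣ Ψ (suc c) ℤ.- Ψ c ∣ ≤ 2 * (b * b)
  Ψ-suc c = begin
    ℤ.∣ Ψ (suc c) ℤ.- Ψ c ∣  ≡⟨ cong ℤ.∣_∣ telescope ⟩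
    ℤ.∣ + b ℤ.* (φ (c + w) ℤ.- φ (c + 0)) ∣  ≡⟨ ℤP.abs-* (+ b) _ ⟩
    b * ℤ.∣ φ (c + w) ℤ.- φ (c + 0) ∣  ≤⟨ *-monoʳ-≤ b (≤-trans (ℤP.∣i-j∣≤∣i∣+∣j∣ (φ (c + w)) _) (+-mono-≤ (∣φ∣≤b (c + w)) (∣φ∣≤b (c + 0)))) ⟩
    b * (b + b)  ≡⟨ lemma b ⟩
    2 * (b * b)  ∎
    where
    open ≤-Reasoning
    lemma : ∀ b → b * (b + b) ≡ 2 * (b * b)
    lemma = solve-∀
    lemma₂ : ∀ y s f l → y ℤ.* s ℤ.- y ℤ.* (f ℤ.+ s ℤ.- l) ≡ y ℤ.* (l ℤ.- f)
    lemma₂ = solve-∀ᶻ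
    lemma₃ : ∀ a l → a ≡ (a ℤ.+ l) ℤ.- l
    lemma₃ = solve-∀ᶻ
    S = ∑ᶻ w (λ s → φ (suc c + s))
    window : ∑ᶻ w (λ s → φ (c + s)) ≡ φ (c + 0) ℤ.+ S ℤ.- φ (c + w)
    window = trans (lemma₃ _ (φ (c + w))) (cong (ℤ._- φ (c + w))
      (trans (∑ᶻ-head w) (cong (ℤ._+_ (φ (c + 0))) (∑ᶻ-cong w (λ s _ → cong φ (+-suc c s))))))
    telescope : Ψ (suc c) ℤ.- Ψ c ≡ + b ℤ.* (φ (c + w) ℤ.- φ (c + 0))
    telescope = trans (cong (λ x → + b ℤ.* S ℤ.- + b ℤ.* x) window) (lemma₂ (+ b) S (φ (c + 0)) (φ (c + w)))

  Ψ-lipschitz : ∀ d c → ℤ.∣ Ψ (d + c) ℤ.- Ψ c ∣ ≤ d * (2 * (b * b))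
  Ψ-lipschitz zero    c = ≤-reflexive (cong ℤ.∣_∣ (ℤP.+-inverseʳ (Ψ c)))
  Ψ-lipschitz (suc d) c = begin
    ℤ.∣ Ψ (suc d + c) ℤ.- Ψ c ∣  ≡⟨ cong ℤ.∣_∣ (lemma (Ψ (suc d + c)) (Ψ (d + c)) (Ψ c)) ⟩
    ℤ.∣ (Ψ (suc d + c) ℤ.- Ψ (d + c)) ℤ.+ (Ψ (d + c) ℤ.- Ψ c) ∣  ≤⟨ ℤP.∣i+j∣≤∣i∣+∣j∣ (Ψ (suc d + c) ℤ.- Ψ (d + c)) _ ⟩
    ℤ.∣ Ψ (suc d + c) ℤ.- Ψ (d + c) ∣ + ℤ.∣ Ψ (d + c) ℤ.- Ψ c ∣  ≤⟨ +-mono-≤ (Ψ-suc (d + c)) (Ψ-lipschitz d c) ⟩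
    suc d * (2 * (b * b))  ∎
    where
    open ≤-Reasoning
    lemma : ∀ x y z → x ℤ.- z ≡ (x ℤ.- y) ℤ.+ (y ℤ.- z)
    lemma = solve-∀ᶻ

  Ψ-close : ∀ {c d} r → c ≤ d + r → d ≤ c + r → ℤ.∣ Ψ c ℤ.- Ψ d ∣ ≤ r * (2 * (b * b))
  Ψ-close {c} {d} r c≤ d≤ with ≤-total c d
  ... | inj₁ c≤d = ≤-trans (≤-reflexive (trans (ℤP.∣i-j∣≡∣j-i∣ (Ψ c) (Ψ d)) (cong (λ x → ℤ.∣ Ψ x ℤ.- Ψ c ∣) (sym (m∸n+n≡m c≤d)))))
                     (≤-trans (Ψ-lipschitz (d ∸ c) c) (*-monoˡ-≤ (2 * (b * b)) (m≤n+o⇒m∸n≤o d c d≤)))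
  ... | inj₂ d≤c = ≤-trans (≤-reflexive (cong (λ x → ℤ.∣ Ψ x ℤ.- Ψ d ∣) (sym (m∸n+n≡m d≤c))))
                     (≤-trans (Ψ-lipschitz (c ∸ d) d) (*-monoˡ-≤ (2 * (b * b)) (m≤n+o⇒m∸n≤o c d c≤)))

-- The sieve

infixl 5 _when_

_when_ : ℤ → Bool → ℤ
x when c = if c then x else 0ℤ

∣when∣≤ : ∀ x c → ℤ.∣ x when c ∣ ≤ ℤ.∣ x ∣
∣when∣≤ x true  = ≤-refl
∣when∣≤ x false = z≤n

∑ᶻ-- : ∀ n {f g} → ∑ᶻ n (λ i → f i ℤ.- g i) ≡ ∑ᶻ n f ℤ.- ∑ᶻ n g
∑ᶻ-- zero    = refl
∑ᶻ-- (suc n) {f} {g} = trans (cong (ℤ._+ (f n ℤ.- g n)) (∑ᶻ-- n)) (lemma (∑ᶻ n f) (∑ᶻ n g) (f n) (g n))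
  where
  lemma : ∀ a b c d → (a ℤ.- b) ℤ.+ (c ℤ.- d) ≡ (a ℤ.+ c) ℤ.- (b ℤ.+ d)
  lemma = solve-∀ᶻ

∑ᶻ-when : ∀ n c {f} → ∑ᶻ n (λ i → f i when c) ≡ (∑ᶻ n f when c)
∑ᶻ-when n true  = refl
∑ᶻ-when n false = ∑ᶻ-0 n (λ _ _ → refl)

*≤⇒≤/ : ∀ c d n {{_ : NonZero d}} → c * d ≤ n → c ≤ n / d
*≤⇒≤/ c d n le = ≤-trans (≤-reflexive (sym (m*n/n≡m c d))) (/-monoˡ-≤ d le)

<suc/* : ∀ n d {{_ : NonZero d}} → n < suc (n / d) * d
<suc/* n d = begin-strict
  n  ≡⟨ m≡m%n+[m/n]*n n d ⟩
  n % d + n / d * d  <⟨ +-monoˡ-< (n / d * d) (m%n<n n d) ⟩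
  d + n / d * d  ∎
  where open ≤-Reasoning

/-unique : ∀ c d n {{_ : NonZero d}} → c * d ≤ n → n < suc c * d → n / d ≡ c
/-unique c d n lo hi = ≤-antisym (≤-pred (m<n*o⇒m/o<n hi)) (*≤⇒≤/ c d n lo)

∑ᶻ-multiples : ∀ p {{_ : NonZero p}} Y {h : ℕ → ℤ} →
  ∑ᶻ Y (λ i → h (suc i) when does (p ∣? suc i)) ≡ ∑ᶻ (Y / p) (λ i → h (p * suc i))
∑ᶻ-multiples p zero {h} = sym (cong (λ n → ∑ᶻ n (λ i → h (p * suc i))) (0/n≡0 p))
∑ᶻ-multiples p (suc Y) {h} with p ∣? suc Y
... | yes (divides (suc c) eq) = begin
  ∑ᶻ Y _ ℤ.+ h (suc Y)  ≡⟨ cong₂ ℤ._+_ (∑ᶻ-multiples p Y {h}) (cong h (trans eq (*-comm (suc c) p))) ⟩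
  ∑ᶻ (Y / p) (λ i → h (p * suc i)) ℤ.+ h (p * suc c)  ≡⟨ cong (λ n → ∑ᶻ n (λ i → h (p * suc i)) ℤ.+ h (p * suc c)) (/-unique c p Y Y≥ (≤-reflexive eq)) ⟩
  ∑ᶻ (suc c) (λ i → h (p * suc i))  ≡⟨ cong (λ n → ∑ᶻ n (λ i → h (p * suc i))) (sym (trans (cong (_/ p) eq) (m*n/n≡m (suc c) p))) ⟩
  ∑ᶻ (suc Y / p) (λ i → h (p * suc i))  ∎
  where
  open ≡-Reasoning
  Y≥ : c * p ≤ Y
  Y≥ = ≤-pred (≤-trans (+-monoˡ-≤ (c * p) (>-nonZero⁻¹ p)) (≤-reflexive (sym eq)))
... | no p∤ = begin
  ∑ᶻ Y _ ℤ.+ 0ℤ  ≡⟨ trans (ℤP.+-identityʳ _) (∑ᶻ-multiples p Y {h}) ⟩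
  ∑ᶻ (Y / p) (λ i → h (p * suc i))  ≡⟨ cong (λ n → ∑ᶻ n (λ i → h (p * suc i))) (sym (/-unique (Y / p) p (suc Y) (m≤n⇒m≤1+n (m/n*n≤m Y p)) hi)) ⟩
  ∑ᶻ (suc Y / p) (λ i → h (p * suc i))  ∎
  where
  open ≡-Reasoning
  hi : suc Y < suc (Y / p) * p
  hi = ≤∧≢⇒< (<suc/* Y p) (λ eq → p∤ (divides (suc (Y / p)) eq))

prime∣prime⇒≡ : ∀ {p q} → Prime p → Prime q → p ∣ q → p ≡ q
prime∣prime⇒≡ pp pq p∣q with prime⇒irreducible pq p∣q
... | inj₁ refl = ⊥-elim (¬prime[1] pp)
... | inj₂ eq   = eq

isPrime : ℕ → Bool
isPrime n = does (prime? n)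

rough : ℕ → ℕ → Bool
rough zero    n = true
rough (suc z) n = rough z n ∧ not (isPrime (suc z) ∧ does (suc z ∣? n))

does-⇔ : ∀ {A B : Set} (a? : Dec A) (b? : Dec B) → (A → B) → (B → A) → does a? ≡ does b?
does-⇔ a? (yes b) f g = dec-true a? (g b)
does-⇔ a? (no ¬b) f g = dec-false a? (¬b ∘ f)

rough-prime* : ∀ {p} z m → Prime p → z < p → rough z (p * m) ≡ rough z m
rough-prime* zero    m pp z<p = refl
rough-prime* {p} (suc z) m pp z<p = cong₂ (λ c d → c ∧ not d) (rough-prime* z m pp (<-trans ≤-refl z<p)) factor
  where
  factor : (isPrime (suc z) ∧ does (suc z ∣? p * m)) ≡ (isPrime (suc z) ∧ does (suc z ∣? m))
  factor with prime? (suc z)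
  ... | no  _  = refl
  ... | yes pz = does-⇔ (suc z ∣? p * m) (suc z ∣? m) to (∣n⇒∣m*n p)
    where
    to : suc z ∣ p * m → suc z ∣ m
    to d with euclidsLemma p m pz d
    ... | inj₁ z∣p = ⊥-elim (<⇒≢ z<p (prime∣prime⇒≡ pz pp z∣p))
    ... | inj₂ z∣m = z∣m

rough-true : ∀ z n → (∀ p → Prime p → p ≤ z → ¬ p ∣ n) → rough z n ≡ true
rough-true zero    n none = refl
rough-true (suc z) n none rewrite rough-true z n (λ p pp p≤z → none p pp (m≤n⇒m≤1+n p≤z)) with prime? (suc z)
... | no  _  = refl
... | yes pz rewrite dec-false (suc z ∣? n) (none (suc z) pz ≤-refl) = refl

rough-false : ∀ z n p → Prime p → p ≤ z → p ∣ n → rough z n ≡ false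
rough-false zero    n p pp z≤n p∣n = ⊥-elim (¬prime[0] pp)
rough-false (suc z) n p pp p≤z p∣n with m≤n⇒m<n∨m≡n p≤z
... | inj₁ p<z = cong (_∧ not (isPrime (suc z) ∧ does (suc z ∣? n))) (rough-false z n p pp (≤-pred p<z) p∣n)
... | inj₂ refl rewrite dec-true (prime? (suc z)) pp | dec-true (suc z ∣? n) p∣n = ∧-false (rough z n)
  where
  ∧-false : ∀ c → c ∧ false ≡ false
  ∧-false true  = refl
  ∧-false false = refl

module Sieve (f : ℕ → ℤ) (b : ℕ) (∣f∣≤b : ∀ n → ℤ.∣ f n ∣ ≤ b) (X : ℕ) where

  S : (d : ℕ) {{_ : NonZero d}} → ℕ → ℤ
  S d z = ∑ᶻ (X / d) (λ i → f (d * suc i) when rough z (suc i))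

  ∣S∣≤ : ∀ d {{_ : NonZero d}} z → ℤ.∣ S d z ∣ ≤ X / d * b
  ∣S∣≤ d z = ∣∑ᶻ∣≤ (X / d) b (λ i _ → ≤-trans (∣when∣≤ _ (rough z (suc i))) (∣f∣≤b (d * suc i)))

  S-¬prime : ∀ d {{_ : NonZero d}} z → ¬ Prime (suc z) → S d (suc z) ≡ S d z
  S-¬prime d z ¬p rewrite dec-false (prime? (suc z)) ¬p =
    ∑ᶻ-cong (X / d) (λ i _ → cong (f (d * suc i) when_) (∧-true (rough z (suc i))))
    where
    ∧-true : ∀ c → c ∧ true ≡ c
    ∧-true true  = refl
    ∧-true false = refl

  -- Buchstab's identity: the terms lost at the prime p have cofactor p m′, where m′ is only known
  -- to be free of primes below p, since p may divide it again.
  S-prime : ∀ d {{_ : NonZero d}} z → Prime (suc z) → S d (suc z) ≡ S d z ℤ.- S (d * suc z) {{m*n≢0 d (suc z)}} z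
  S-prime d z pz = begin
    S d (suc z)  ≡⟨ ∑ᶻ-cong (X / d) (λ i _ → split i) ⟩
    ∑ᶻ (X / d) (λ i → (h (suc i)) ℤ.- (h (suc i) when does (suc z ∣? suc i)))  ≡⟨ ∑ᶻ-- (X / d) ⟩
    S d z ℤ.- ∑ᶻ (X / d) (λ i → h (suc i) when does (suc z ∣? suc i))  ≡⟨ cong (λ x → S d z ℤ.- x) (∑ᶻ-multiples (suc z) (X / d) {h}) ⟩
    S d z ℤ.- ∑ᶻ (X / d / suc z) (λ i → h (suc z * suc i))  ≡⟨ cong (λ n → S d z ℤ.- ∑ᶻ n (λ i → h (suc z * suc i))) (m/n/o≡m/[n*o] X d (suc z) {{it}} {{it}} {{m*n≢0 d (suc z)}}) ⟩
    S d z ℤ.- ∑ᶻ (_/_ X (d * suc z) {{m*n≢0 d (suc z)}}) (λ i → h (suc z * suc i))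
      ≡⟨ cong (λ x → S d z ℤ.- x) (∑ᶻ-cong (_/_ X (d * suc z) {{m*n≢0 d (suc z)}}) (λ i _ → cong₂ _when_ (cong f (sym (*-assoc d (suc z) (suc i)))) (rough-prime* z (suc i) pz ≤-refl))) ⟩
    S d z ℤ.- S (d * suc z) {{m*n≢0 d (suc z)}} z ∎
    where
    open ≡-Reasoning
    it : ∀ {A : Set} {{_ : A}} → A
    it {{x}} = x
    h : ℕ → ℤ
    h m = f (d * m) when rough z m
    split : ∀ i → (f (d * suc i) when rough (suc z) (suc i)) ≡ h (suc i) ℤ.- (h (suc i) when does (suc z ∣? suc i))
    split i rewrite dec-true (prime? (suc z)) pz with rough z (suc i) | does (suc z ∣? suc i)
    ... | true  | true  = sym (ℤP.+-inverseʳ (f (d * suc i)))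
    ... | true  | false = sym (ℤP.+-identityʳ (f (d * suc i)))
    ... | false | true  = refl
    ... | false | false = refl

  -- Legendre's recursion, cut off after r sieving primes; the weight 2^r
  -- turns the sum of the discarded terms into the product of (p + 2)/p.
  legendre : ∀ {B} → (∀ d {{_ : NonZero d}} → ℤ.∣ S d 0 ∣ ≤ B) → ∀ z r d {{_ : NonZero d}} →
    Σ[ tail ∈ ℕ ] ℤ.∣ S d z ∣ ≤ suc z ^ r * B + tail × 2 ^ r * d * tail * 2 ≤ b * X * (suc z * suc (suc z))
  legendre {B} base zero r d = 0 ,
    ≤-trans (base d) (≤-reflexive (sym (trans (+-identityʳ _) (trans (cong (_* B) (^-zeroˡ r)) (*-identityˡ B))))) ,
    ≤-trans (≤-reflexive (cong (_* 2) (*-zeroʳ (2 ^ r * d)))) z≤n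
  legendre {B} base (suc z) zero d = ℤ.∣ S d (suc z) ∣ , m≤n+m _ (1 * B) , (begin
    1 * d * ℤ.∣ S d (suc z) ∣ * 2  ≡⟨ cong (λ x → x * ℤ.∣ S d (suc z) ∣ * 2) (*-identityˡ d) ⟩
    d * ℤ.∣ S d (suc z) ∣ * 2  ≤⟨ *-mono-≤ (*-monoʳ-≤ d (∣S∣≤ d (suc z))) (≤-trans (s≤s (s≤s z≤n)) (m≤m*n (suc (suc z)) (suc (suc (suc z))))) ⟩
    d * (X / d * b) * (suc (suc z) * suc (suc (suc z))) ≡⟨ cong (_* (suc (suc z) * suc (suc (suc z)))) (lemma d (X / d) b) ⟩
    b * (X / d * d) * (suc (suc z) * suc (suc (suc z))) ≤⟨ *-monoˡ-≤ (suc (suc z) * suc (suc (suc z))) (*-monoʳ-≤ b (m/n*n≤m X d)) ⟩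
    b * X * (suc (suc z) * suc (suc (suc z)))  ∎)
    where
    open ≤-Reasoning
    lemma : ∀ d x b → d * (x * b) ≡ b * (x * d)
    lemma = solve-∀
  legendre {B} base (suc z) (suc r) d = by (prime? (suc z))
    where
    open ≤-Reasoning
    p = suc z
    ih₁ = legendre base z (suc r) d
    ih₂ = legendre base z r (d * p) {{m*n≢0 d p}}
    t₁ = proj₁ ih₁
    t₂ = proj₁ ih₂
    le₁ = proj₁ (proj₂ ih₁)
    le₂ = proj₁ (proj₂ ih₂)
    bd₁ = proj₂ (proj₂ ih₁)
    bd₂ = proj₂ (proj₂ ih₂)
    lemma₁ : ∀ p e B t u → p * e * B + t + (e * B + u) ≡ suc p * e * B + (t + u)
    lemma₁ = solve-∀
    lemma₂ : ∀ p e d t u → p * (2 * e * d * (t + u) * 2) ≡ p * (2 * e * d * t * 2) + 2 * (e * (d * p) * u * 2)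
    lemma₂ = solve-∀
    lemma₃ : ∀ p x → p * (x * (p * suc p)) + 2 * (x * (p * suc p)) ≡ p * (x * (suc p * suc (suc p)))
    lemma₃ = solve-∀
    by : Dec (Prime p) → Σ[ tail ∈ ℕ ] ℤ.∣ S d p ∣ ≤ suc p ^ suc r * B + tail × 2 ^ suc r * d * tail * 2 ≤ b * X * (suc p * suc (suc p))
    by (no ¬p) = t₁ ,
      ≤-trans (≤-reflexive (cong ℤ.∣_∣ (S-¬prime d z ¬p))) (≤-trans le₁ (+-monoˡ-≤ t₁ (*-monoˡ-≤ B (^-monoˡ-≤ (suc r) (n≤1+n p))))) ,
      ≤-trans bd₁ (*-monoʳ-≤ (b * X) (*-mono-≤ (n≤1+n p) (n≤1+n (suc p))))
    by (yes pz) = t₁ + t₂ , (begin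
      ℤ.∣ S d p ∣  ≡⟨ cong ℤ.∣_∣ (S-prime d z pz) ⟩
      ℤ.∣ S d z ℤ.- S (d * p) {{m*n≢0 d p}} z ∣  ≤⟨ ℤP.∣i-j∣≤∣i∣+∣j∣ (S d z) _ ⟩
      ℤ.∣ S d z ∣ + ℤ.∣ S (d * p) {{m*n≢0 d p}} z ∣  ≤⟨ +-mono-≤ le₁ le₂ ⟩
      p ^ suc r * B + t₁ + (p ^ r * B + t₂)  ≡⟨ lemma₁ p (p ^ r) B t₁ t₂ ⟩
      suc p * p ^ r * B + (t₁ + t₂)  ≤⟨ +-monoˡ-≤ (t₁ + t₂) (*-monoˡ-≤ B (*-monoʳ-≤ (suc p) (^-monoˡ-≤ r (n≤1+n p)))) ⟩
      suc p ^ suc r * B + (t₁ + t₂)  ∎) ,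
      -- With T(z) = (z + 1)(z + 2) and p = z + 1 one has (p + 2) T(z) = p T(p), so the factors (p +
      -- 2)/p telescope over all integers p.
      *-cancelˡ-≤ p (begin
      p * (2 ^ suc r * d * (t₁ + t₂) * 2)  ≡⟨ lemma₂ p (2 ^ r) d t₁ t₂ ⟩
      p * (2 ^ suc r * d * t₁ * 2) + 2 * (2 ^ r * (d * p) * t₂ * 2) ≤⟨ +-mono-≤ (*-monoʳ-≤ p bd₁) (*-monoʳ-≤ 2 bd₂) ⟩
      p * (b * X * (p * suc p)) + 2 * (b * X * (p * suc p))  ≡⟨ lemma₃ p (b * X) ⟩
      p * (b * X * (suc p * suc (suc p)))  ∎)

  module Block (R : ℕ) {{R≢0 : NonZero R}} where

    private
      instance
        R*R≢0 : NonZero (R * R)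
        R*R≢0 = m*n≢0 R R

    -- The terms lost are multiples of d p with d and p both at least R, so there are at most X / R²
    -- of them.
    step : ∀ d {{_ : NonZero d}} i → R ≤ d → ℤ.∣ S d (R + suc i) ℤ.- S d (R + i) ∣ ≤ X / (R * R) * b
    step d i R≤d rewrite +-suc R i = by (prime? (suc (R + i)))
      where
      open ≤-Reasoning
      instance
        d*≢0 : NonZero (d * suc (R + i))
        d*≢0 = m*n≢0 d (suc (R + i))
      S′ = S (d * suc (R + i)) (R + i)
      lemma : ∀ a c → (a ℤ.- c) ℤ.- a ≡ ℤ.- c
      lemma = solve-∀ᶻ
      by : Dec (Prime (suc (R + i))) → ℤ.∣ S d (suc (R + i)) ℤ.- S d (R + i) ∣ ≤ X / (R * R) * b
      by (no ¬p) = ≤-trans (≤-reflexive (cong ℤ.∣_∣ (trans (cong (ℤ._- S d (R + i)) (S-¬prime d (R + i) ¬p)) (ℤP.+-inverseʳ (S d (R + i)))))) z≤n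
      by (yes pp) = begin
        ℤ.∣ S d (suc (R + i)) ℤ.- S d (R + i) ∣  ≡⟨ cong (λ x → ℤ.∣ x ℤ.- S d (R + i) ∣) (S-prime d (R + i) pp) ⟩
        ℤ.∣ S d (R + i) ℤ.- S′ ℤ.- S d (R + i) ∣  ≡⟨ cong ℤ.∣_∣ (lemma (S d (R + i)) S′) ⟩
        ℤ.∣ ℤ.- S′ ∣  ≡⟨ ℤP.∣-i∣≡∣i∣ S′ ⟩
        ℤ.∣ S′ ∣  ≤⟨ ∣S∣≤ (d * suc (R + i)) (R + i) ⟩
        X / (d * suc (R + i)) * b  ≤⟨ *-monoˡ-≤ b (/-monoʳ-≤ X (*-mono-≤ R≤d (m≤n⇒m≤1+n (m≤m+n R i)))) ⟩
        X / (R * R) * b  ∎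

    drift : ∀ d {{_ : NonZero d}} → R ≤ d → ∀ i → ℤ.∣ S d (R + i) ℤ.- S d R ∣ ≤ i * (X / (R * R) * b)
    drift d R≤d zero = ≤-reflexive (cong ℤ.∣_∣ (trans (cong (λ n → S d n ℤ.- S d R) (+-identityʳ R)) (ℤP.+-inverseʳ (S d R))))
    drift d R≤d (suc i) = begin
      ℤ.∣ S d (R + suc i) ℤ.- S d R ∣
        ≡⟨ cong ℤ.∣_∣ (lemma (S d (R + suc i)) (S d (R + i)) (S d R)) ⟩
      ℤ.∣ (S d (R + suc i) ℤ.- S d (R + i)) ℤ.+ (S d (R + i) ℤ.- S d R) ∣
        ≤⟨ ≤-trans (ℤP.∣i+j∣≤∣i∣+∣j∣ (S d (R + suc i) ℤ.- S d (R + i)) _) (+-mono-≤ (step d i R≤d) (drift d R≤d i)) ⟩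
      suc i * (X / (R * R) * b) ∎
      where
      open ≤-Reasoning
      lemma : ∀ x y z → x ℤ.- z ≡ (x ℤ.- y) ℤ.+ (y ℤ.- z)
      lemma = solve-∀ᶻ

    p[_] : ℕ → ℕ
    p[ i ] = suc (R + i)

    blockSum : ℕ → ℤ
    blockSum β = ∑ᶻ β (λ i → S p[ i ] R when isPrime p[ i ])

    -- Freezing the level at R makes the sieve condition on m independent of the prime taken out, as
    -- the bilinear form requires. Each prime of the block pays for this with one `drift` of at most
    -- β steps.
    sieve-block : ∀ β i → i ≤ β → ℤ.∣ S 1 (R + i) ℤ.- (S 1 R ℤ.- blockSum i) ∣ ≤ i * (β * (X / (R * R) * b))
    sieve-block β zero _ = ≤-reflexive (cong ℤ.∣_∣ (trans (cong (λ n → S 1 n ℤ.- (S 1 R ℤ.- 0ℤ)) (+-identityʳ R)) (lemma (S 1 R))))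
      where
      lemma : ∀ a → a ℤ.- (a ℤ.- 0ℤ) ≡ 0ℤ
      lemma = solve-∀ᶻ
    sieve-block β (suc i) i<β = ≤-trans (bound (prime? p[ i ])) (+-mono-≤ (≤-trans (drift p[ i ] (m≤n⇒m≤1+n (m≤m+n R i)) i) (*-monoˡ-≤ (X / (R * R) * b) (<⇒≤ i<β))) (sieve-block β i (<⇒≤ i<β)))
      where
      open ≤-Reasoning
      D = S p[ i ] (R + i) ℤ.- S p[ i ] R
      prev = S 1 (R + i) ℤ.- (S 1 R ℤ.- blockSum i)
      lemma₁ : ∀ a c x → a ℤ.- (c ℤ.- (x ℤ.+ 0ℤ)) ≡ a ℤ.- (c ℤ.- x)
      lemma₁ = solve-∀ᶻ
      lemma₂ : ∀ a c x s t → (a ℤ.- s) ℤ.- (c ℤ.- (x ℤ.+ t)) ≡ (ℤ.- (s ℤ.- t)) ℤ.+ (a ℤ.- (c ℤ.- x))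
      lemma₂ = solve-∀ᶻ
      bound : (p? : Dec (Prime p[ i ])) → ℤ.∣ S 1 (R + suc i) ℤ.- (S 1 R ℤ.- (blockSum i ℤ.+ (S p[ i ] R when does p?))) ∣ ≤ ℤ.∣ D ∣ + ℤ.∣ prev ∣
      bound (no ¬p) rewrite +-suc R i = begin
        ℤ.∣ S 1 p[ i ] ℤ.- (S 1 R ℤ.- (blockSum i ℤ.+ 0ℤ)) ∣  ≡⟨ cong (λ x → ℤ.∣ x ℤ.- (S 1 R ℤ.- (blockSum i ℤ.+ 0ℤ)) ∣) (S-¬prime 1 (R + i) ¬p) ⟩
        ℤ.∣ S 1 (R + i) ℤ.- (S 1 R ℤ.- (blockSum i ℤ.+ 0ℤ)) ∣  ≡⟨ cong ℤ.∣_∣ (lemma₁ (S 1 (R + i)) (S 1 R) (blockSum i)) ⟩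
        ℤ.∣ prev ∣  ≤⟨ m≤n+m _ ℤ.∣ D ∣ ⟩
        ℤ.∣ D ∣ + ℤ.∣ prev ∣  ∎
      bound (yes pp) rewrite +-suc R i = begin
        ℤ.∣ S 1 p[ i ] ℤ.- (S 1 R ℤ.- (blockSum i ℤ.+ S p[ i ] R)) ∣
          ≡⟨ cong (λ x → ℤ.∣ x ℤ.- (S 1 R ℤ.- (blockSum i ℤ.+ S p[ i ] R)) ∣) (trans (S-prime 1 (R + i) pp) (cong (λ x → S 1 (R + i) ℤ.- x) (S-cong {z = R + i} (*-identityˡ p[ i ])))) ⟩
        ℤ.∣ (S 1 (R + i) ℤ.- S p[ i ] (R + i)) ℤ.- (S 1 R ℤ.- (blockSum i ℤ.+ S p[ i ] R)) ∣
          ≡⟨ cong ℤ.∣_∣ (lemma₂ (S 1 (R + i)) (S 1 R) (blockSum i) (S p[ i ] (R + i)) (S p[ i ] R)) ⟩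
        ℤ.∣ (ℤ.- D) ℤ.+ prev ∣
          ≤⟨ ≤-trans (ℤP.∣i+j∣≤∣i∣+∣j∣ (ℤ.- D) prev) (+-monoˡ-≤ ℤ.∣ prev ∣ (≤-reflexive (ℤP.∣-i∣≡∣i∣ D))) ⟩
        ℤ.∣ D ∣ + ℤ.∣ prev ∣ ∎
        where
        S-cong : ∀ {d e z} {{_ : NonZero d}} {{_ : NonZero e}} → d ≡ e → S d z ≡ S e z
        S-cong refl = refl

    -- Moving the cut-off n ≤ X into the summand gives all primes of a block the same range of m, so
    -- that the two sums can be interchanged.
    F : ℕ → ℤ
    F n = f n when (n ≤ᵇ X)

    bilinear : ℕ → ℕ → ℤ
    bilinear β m = ∑ᶻ β (λ i → F (p[ i ] * m) when isPrime p[ i ])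

    S-extend : ∀ i → S p[ i ] R ≡ ∑ᶻ (X / R) (λ j → F (p[ i ] * suc j) when rough R (suc j))
    S-extend i = sym (begin
      ∑ᶻ (X / R) G  ≡⟨ cong (λ n → ∑ᶻ n G) (sym (m+[n∸m]≡n X/p≤X/R)) ⟩
      ∑ᶻ (X / p[ i ] + (X / R ∸ X / p[ i ])) G  ≡⟨ ∑ᶻ-split (X / p[ i ]) (X / R ∸ X / p[ i ]) ⟩
      ∑ᶻ (X / p[ i ]) G ℤ.+ ∑ᶻ (X / R ∸ X / p[ i ]) (λ j → G (X / p[ i ] + j))
        ≡⟨ cong₂ ℤ._+_ (∑ᶻ-cong (X / p[ i ]) (λ j j< → inside j j<)) (∑ᶻ-0 (X / R ∸ X / p[ i ]) (λ j _ → outside (X / p[ i ] + j) (m≤m+n _ j))) ⟩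
      S p[ i ] R ℤ.+ 0ℤ  ≡⟨ ℤP.+-identityʳ _ ⟩
      S p[ i ] R  ∎)
      where
      open ≡-Reasoning
      G : ℕ → ℤ
      G j = F (p[ i ] * suc j) when rough R (suc j)
      X/p≤X/R : X / p[ i ] ≤ X / R
      X/p≤X/R = /-monoʳ-≤ X (m≤n⇒m≤1+n (m≤m+n R i))
      inside : ∀ j → j < X / p[ i ] → G j ≡ (f (p[ i ] * suc j) when rough R (suc j))
      inside j j< with (p[ i ] * suc j) ≤ᵇ X | ≤⇒≤ᵇ (≤-trans (≤-reflexive (*-comm p[ i ] (suc j))) (≤-trans (*-monoˡ-≤ p[ i ] j<) (m/n*n≤m X p[ i ])))
      ... | true | _ = refl
      outside : ∀ j → X / p[ i ] ≤ j → G j ≡ 0ℤ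
      outside j ≤j with (p[ i ] * suc j) ≤ᵇ X in eq
      ... | true  = ⊥-elim (<⇒≱ (<-≤-trans (<suc/* X p[ i ]) (*-monoˡ-≤ p[ i ] (s≤s ≤j))) (≤-trans (≤-reflexive (*-comm (suc j) p[ i ])) (≤ᵇ⇒≤ (p[ i ] * suc j) X (subst T (sym eq) _))))
      ... | false with rough R (suc j)
      ...   | true  = refl
      ...   | false = refl

    blockSum≡ : ∀ β → blockSum β ≡ ∑ᶻ (X / R) (λ j → bilinear β (suc j) when rough R (suc j))
    blockSum≡ β = begin
      blockSum β
        ≡⟨ ∑ᶻ-cong β (λ i _ → trans (cong (_when isPrime p[ i ]) (S-extend i)) (sym (∑ᶻ-when (X / R) (isPrime p[ i ])))) ⟩
      ∑ᶻ β (λ i → ∑ᶻ (X / R) (λ j → F (p[ i ] * suc j) when rough R (suc j) when isPrime p[ i ]))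
        ≡⟨ ∑ᶻ-swap β (X / R) ⟩
      ∑ᶻ (X / R) (λ j → ∑ᶻ β (λ i → F (p[ i ] * suc j) when rough R (suc j) when isPrime p[ i ]))
        ≡⟨ ∑ᶻ-cong (X / R) (λ j _ → trans (∑ᶻ-cong β (λ i _ → when-comm (F (p[ i ] * suc j)) (rough R (suc j)) (isPrime p[ i ]))) (∑ᶻ-when β (rough R (suc j)))) ⟩
      ∑ᶻ (X / R) (λ j → bilinear β (suc j) when rough R (suc j)) ∎
      where
      open ≡-Reasoning
      when-comm : ∀ x c d → (x when c when d) ≡ (x when d when c)
      when-comm x true  true  = refl
      when-comm x true  false = refl
      when-comm x false true  = refl
      when-comm x false false = refl

    ∣block∣≤ : ∀ β → ℤ.∣ S 1 (R + β) ℤ.- S 1 R ∣ ≤ ∑ (X / R) (λ j → ℤ.∣ bilinear β (suc j) ∣) + β * (β * (X / (R * R) * b))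
    ∣block∣≤ β = begin
      ℤ.∣ S 1 (R + β) ℤ.- S 1 R ∣  ≡⟨ cong ℤ.∣_∣ (lemma (S 1 (R + β)) (S 1 R) (blockSum β)) ⟩
      ℤ.∣ (ℤ.- blockSum β) ℤ.+ (S 1 (R + β) ℤ.- (S 1 R ℤ.- blockSum β)) ∣  ≤⟨ ℤP.∣i+j∣≤∣i∣+∣j∣ (ℤ.- blockSum β) _ ⟩
      ℤ.∣ ℤ.- blockSum β ∣ + ℤ.∣ S 1 (R + β) ℤ.- (S 1 R ℤ.- blockSum β) ∣  ≤⟨ +-mono-≤ main (sieve-block β β ≤-refl) ⟩
      ∑ (X / R) (λ j → ℤ.∣ bilinear β (suc j) ∣) + β * (β * (X / (R * R) * b))  ∎
      where
      open ≤-Reasoning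
      lemma : ∀ a c x → a ℤ.- c ≡ (ℤ.- x) ℤ.+ (a ℤ.- (c ℤ.- x))
      lemma = solve-∀ᶻ
      main : ℤ.∣ ℤ.- blockSum β ∣ ≤ ∑ (X / R) (λ j → ℤ.∣ bilinear β (suc j) ∣)
      main = begin
        ℤ.∣ ℤ.- blockSum β ∣  ≡⟨ trans (ℤP.∣-i∣≡∣i∣ (blockSum β)) (cong ℤ.∣_∣ (blockSum≡ β)) ⟩
        ℤ.∣ ∑ᶻ (X / R) (λ j → bilinear β (suc j) when rough R (suc j)) ∣  ≤⟨ ∣∑ᶻ∣≤∑∣∣ (X / R) ⟩
        ∑ (X / R) (λ j → ℤ.∣ bilinear β (suc j) when rough R (suc j) ∣)  ≤⟨ ∑-mono (X / R) (λ j _ → ∣when∣≤ (bilinear β (suc j)) (rough R (suc j))) ⟩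
        ∑ (X / R) (λ j → ℤ.∣ bilinear β (suc j) ∣)  ∎

-- Approximate roots and the phase of a difference

pow-cancel-≤ : ∀ k {a b} → 1 ≤ k → a ^ k ≤ b ^ k → a ≤ b
pow-cancel-≤ k {a} {b} 1≤k le with a ≤? b
... | yes a≤b = a≤b
... | no a≰b  = ⊥-elim (<⇒≱ (^-monoˡ-< k {{>-nonZero 1≤k}} (≰⇒> a≰b)) le)

square-cancel-≤ : ∀ {a b} → a * a ≤ b * b → a ≤ b
square-cancel-≤ {a} {b} le = pow-cancel-≤ 2 (s≤s z≤n) (subst₂ _≤_ (cong (a *_) (sym (*-identityʳ a))) (cong (b *_) (sym (*-identityʳ b))) le)

-- Bernoulli's inequality y^k - x^k ≤ k τ y^(k-1) for y = x + τ, multiplied by y and freed of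
-- subtraction.
bernoulli : ∀ k x τ → (x + τ) * (x + τ) ^ k ≤ (x + τ) * x ^ k + k * τ * (x + τ) ^ k
bernoulli zero    x τ = m≤m+n _ _
bernoulli (suc k) x τ = begin
  y * (y * y ^ k)  ≤⟨ *-monoʳ-≤ y (bernoulli k x τ) ⟩
  y * (y * x ^ k + k * τ * y ^ k)  ≡⟨ lemma₁ x τ (x ^ k) k (y ^ k) ⟩
  y * (x * x ^ k) + τ * (y * x ^ k) + k * τ * (y * y ^ k)  ≤⟨ +-monoˡ-≤ (k * τ * (y * y ^ k)) (+-monoʳ-≤ (y * (x * x ^ k)) (*-monoʳ-≤ τ (*-monoʳ-≤ y (^-monoˡ-≤ k (m≤m+n x τ))))) ⟩
  y * (x * x ^ k) + τ * (y * y ^ k) + k * τ * (y * y ^ k)  ≡⟨ lemma₂ (y * (x * x ^ k)) τ (y * y ^ k) k ⟩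
  y * (x * x ^ k) + suc k * τ * (y * y ^ k)  ∎
  where
  open ≤-Reasoning
  y = x + τ
  lemma₁ : ∀ x τ a k e → (x + τ) * ((x + τ) * a + k * τ * e) ≡ (x + τ) * (x * a) + τ * ((x + τ) * a) + k * τ * ((x + τ) * e)
  lemma₁ = solve-∀
  lemma₂ : ∀ a τ e k → a + τ * e + k * τ * e ≡ a + suc k * τ * e
  lemma₂ = solve-∀

-- For a ≥ c the hypothesis bounds a/c by X^(1/k) ≤ √X. This is where k ≥ 2 is used: roots stay
-- below the square root.
square-from-power : ∀ k a c X → 2 ≤ k → 1 ≤ c → 1 ≤ X → a ^ k ≤ c ^ k * X → a * a ≤ c * c * X
square-from-power (suc zero) a c X (s≤s ()) 1≤c 1≤X le
square-from-power (suc (suc k)) a c X _ 1≤c 1≤X le with ≤-total a c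
... | inj₁ a≤c = ≤-trans (*-mono-≤ a≤c a≤c) (≤-trans (≤-reflexive (sym (*-identityʳ (c * c)))) (*-monoʳ-≤ (c * c) 1≤X))
... | inj₂ c≤a = *-cancelʳ-≤ _ _ (c ^ k) {{m^n≢0 c k {{>-nonZero 1≤c}}}} (begin
  a * a * c ^ k  ≤⟨ *-monoʳ-≤ (a * a) (^-monoˡ-≤ k c≤a) ⟩
  a * a * a ^ k  ≡⟨ *-assoc a a (a ^ k) ⟩
  a * (a * a ^ k)  ≤⟨ le ⟩
  c * (c * c ^ k) * X  ≡⟨ lemma c (c ^ k) X ⟩
  c * c * X * c ^ k  ∎)
  where
  open ≤-Reasoning
  lemma : ∀ c e X → c * (c * e) * X ≡ c * c * X * e
  lemma = solve-∀

module _ {k : ℕ} (1≤k : 1 ≤ k) where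

  -- Q^k plays the role of a huge denominator: iroot k (Q^k n) / Q approximates n^(1/k).
  scaled-root-≥ : ∀ Q n → 1 ≤ n → Q ≤ iroot k (Q ^ k * n)
  scaled-root-≥ Q n 1≤n = iroot-greatest k _ Q 1≤k (≤-trans (≤-reflexive (sym (*-identityʳ (Q ^ k)))) (*-monoʳ-≤ (Q ^ k) 1≤n))

  scaled-root-≤ : ∀ Q n → iroot k (Q ^ k * n) ≤ Q * n
  scaled-root-≤ Q n = pow-cancel-≤ k 1≤k (begin
    iroot k (Q ^ k * n) ^ k  ≤⟨ iroot-lower k _ 1≤k ⟩
    Q ^ k * n  ≤⟨ *-monoʳ-≤ (Q ^ k) (n≤n^k k n 1≤k) ⟩
    Q ^ k * n ^ k  ≡⟨ sym (^-distribʳ-* k Q n) ⟩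
    (Q * n) ^ k  ∎)
    where open ≤-Reasoning

-- For two multipliers p′ < p the difference of A (p m) = ⌊N (p m)^(1/k)⌋ and A (p′ m)
-- follows a single phase E m = ⌊κ m^(1/k)⌋ up to a bounded error.
module Phase {k : ℕ} (2≤k : 2 ≤ k) (N Q : ℕ) {{N≢0 : NonZero N}} {{Q≢0 : NonZero Q}} (p p′ : ℕ) (1≤p′ : 1 ≤ p′) (p′<p : p′ < p) where

  1≤k : 1 ≤ k
  1≤k = <⇒≤ 2≤k

  A : ℕ → ℕ
  A n = iroot k (N ^ k * n)

  B : ℕ → ℕ
  B n = iroot k (Q ^ k * n)

  ΔB : ℕ
  ΔB = B p ∸ B p′

  -- V / U is κ^k for κ = N · `ΔB` / Q, a rational substitute for N (p^(1/k) - p′^(1/k)).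
  U V : ℕ
  U = Q ^ k
  V = (N * ΔB) ^ k

  instance
    U≢0 : NonZero U
    U≢0 = m^n≢0 Q k

  E : ℕ → ℕ
  E m = iroot k (V * m / U)

  B-mono : ∀ {m n} → m ≤ n → B m ≤ B n
  B-mono m≤n = iroot-mono k 1≤k (*-monoʳ-≤ (Q ^ k) m≤n)

  B′+ΔB : B p′ + ΔB ≡ B p
  B′+ΔB = m+[n∸m]≡n (B-mono (<⇒≤ p′<p))

  E-lower : ∀ m → U * E m ^ k ≤ V * m
  E-lower m = ≤-trans (*-monoʳ-≤ U (iroot-lower k (V * m / U) 1≤k)) (≤-trans (≤-reflexive (*-comm U _)) (m/n*n≤m (V * m) U))

  E-upper : ∀ m → V * m < U * suc (E m) ^ k
  E-upper m = <-≤-trans (<suc/* (V * m) U) (≤-trans (*-monoˡ-≤ U (iroot-upper k (V * m / U) 1≤k)) (≤-reflexive (*-comm _ U)))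

  private
    swap-middle : ∀ a b c → a * b * c ≡ a * c * b
    swap-middle = solve-∀

  E-≤-root : ∀ m → E m * (Q * Q) ≤ N * ΔB * suc (B m)
  E-≤-root m = pow-cancel-≤ k 1≤k (begin
    (E m * (Q * Q)) ^ k  ≡⟨ trans (^-distribʳ-* k (E m) (Q * Q)) (cong (E m ^ k *_) (^-distribʳ-* k Q Q)) ⟩
    E m ^ k * (U * U)  ≡⟨ lemma₁ (E m ^ k) U ⟩
    U * E m ^ k * U  ≤⟨ *-monoˡ-≤ U (E-lower m) ⟩
    V * m * U  ≡⟨ lemma₂ V m U ⟩
    V * (U * m)  ≤⟨ *-monoʳ-≤ V (<⇒≤ (iroot-upper k (U * m) 1≤k)) ⟩
    V * suc (B m) ^ k  ≡⟨ sym (^-distribʳ-* k (N * ΔB) (suc (B m))) ⟩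
    (N * ΔB * suc (B m)) ^ k  ∎)
    where
    open ≤-Reasoning
    lemma₁ : ∀ e u → e * (u * u) ≡ u * e * u
    lemma₁ = solve-∀
    lemma₂ : ∀ v m u → v * m * u ≡ v * (u * m)
    lemma₂ = solve-∀

  E-≥-root : ∀ m → N * ΔB * B m ≤ suc (E m) * (Q * Q)
  E-≥-root m = pow-cancel-≤ k 1≤k (begin
    (N * ΔB * B m) ^ k  ≡⟨ ^-distribʳ-* k (N * ΔB) (B m) ⟩
    V * B m ^ k  ≤⟨ *-monoʳ-≤ V (iroot-lower k (U * m) 1≤k) ⟩
    V * (U * m)  ≡⟨ lemma₁ V U m ⟩
    V * m * U  ≤⟨ *-monoˡ-≤ U (<⇒≤ (E-upper m)) ⟩
    U * suc (E m) ^ k * U  ≡⟨ lemma₂ U (suc (E m) ^ k) ⟩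
    suc (E m) ^ k * (U * U)  ≡⟨ sym (trans (^-distribʳ-* k (suc (E m)) (Q * Q)) (cong (suc (E m) ^ k *_) (^-distribʳ-* k Q Q))) ⟩
    (suc (E m) * (Q * Q)) ^ k  ∎)
    where
    open ≤-Reasoning
    lemma₁ : ∀ v u m → v * (u * m) ≡ v * m * u
    lemma₁ = solve-∀
    lemma₂ : ∀ u e → u * e * u ≡ e * (u * u)
    lemma₂ = solve-∀

  -- Multiplicativity (r m)^(1/k) = r^(1/k) m^(1/k), with both roots rounded at scale Q, whence the
  -- factor Q².
  A-≤-root : ∀ r m → A (r * m) * (Q * Q) ≤ N * suc (B r) * suc (B m)
  A-≤-root r m = pow-cancel-≤ k 1≤k (begin
    (A (r * m) * (Q * Q)) ^ k  ≡⟨ trans (^-distribʳ-* k (A (r * m)) (Q * Q)) (cong (A (r * m) ^ k *_) (^-distribʳ-* k Q Q)) ⟩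
    A (r * m) ^ k * (U * U)  ≤⟨ *-monoˡ-≤ (U * U) (iroot-lower k (N ^ k * (r * m)) 1≤k) ⟩
    N ^ k * (r * m) * (U * U)  ≡⟨ lemma (N ^ k) r m U ⟩
    N ^ k * (U * r) * (U * m)  ≤⟨ *-mono-≤ (*-monoʳ-≤ (N ^ k) (<⇒≤ (iroot-upper k (U * r) 1≤k))) (<⇒≤ (iroot-upper k (U * m) 1≤k)) ⟩
    N ^ k * suc (B r) ^ k * suc (B m) ^ k  ≡⟨ sym (trans (^-distribʳ-* k (N * suc (B r)) (suc (B m))) (cong (_* suc (B m) ^ k) (^-distribʳ-* k N (suc (B r))))) ⟩
    (N * suc (B r) * suc (B m)) ^ k  ∎)
    where
    open ≤-Reasoning
    lemma : ∀ n r m u → n * (r * m) * (u * u) ≡ n * (u * r) * (u * m)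
    lemma = solve-∀

  A-≥-root : ∀ r m → N * B r * B m ≤ suc (A (r * m)) * (Q * Q)
  A-≥-root r m = pow-cancel-≤ k 1≤k (begin
    (N * B r * B m) ^ k  ≡⟨ trans (^-distribʳ-* k (N * B r) (B m)) (cong (_* B m ^ k) (^-distribʳ-* k N (B r))) ⟩
    N ^ k * B r ^ k * B m ^ k  ≤⟨ *-mono-≤ (*-monoʳ-≤ (N ^ k) (iroot-lower k (U * r) 1≤k)) (iroot-lower k (U * m) 1≤k) ⟩
    N ^ k * (U * r) * (U * m)  ≡⟨ lemma (N ^ k) r m U ⟩
    N ^ k * (r * m) * (U * U)  ≤⟨ *-monoˡ-≤ (U * U) (<⇒≤ (iroot-upper k (N ^ k * (r * m)) 1≤k)) ⟩
    suc (A (r * m)) ^ k * (U * U)  ≡⟨ sym (trans (^-distribʳ-* k (suc (A (r * m))) (Q * Q)) (cong (suc (A (r * m)) ^ k *_) (^-distribʳ-* k Q Q))) ⟩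
    (suc (A (r * m)) * (Q * Q)) ^ k  ∎)
    where
    open ≤-Reasoning
    lemma : ∀ n r m u → n * (u * r) * (u * m) ≡ n * (r * m) * (u * u)
    lemma = solve-∀

  A-mono : ∀ m → A (p′ * m) ≤ A (p * m)
  A-mono m = iroot-mono k 1≤k (*-monoʳ-≤ (N ^ k) (*-monoˡ-≤ m (<⇒≤ p′<p)))

  module _ (m : ℕ) (Q-large : N * (p + m + 1) ≤ Q) where

    private
      instance
        Q²≢0 : NonZero (Q * Q)
        Q²≢0 = m*n≢0 Q Q

    -- The product of two rounded roots leaves cross terms of order Q, negligible against Q² once Q
    -- is large. Nothing in the final bounds depends on Q, so it may be as large as desired.
    error≤Q² : N * (B p + B m + 1) ≤ Q * Q
    error≤Q² = begin
      N * (B p + B m + 1)  ≤⟨ *-monoʳ-≤ N (+-mono-≤ (+-mono-≤ (scaled-root-≤ 1≤k Q p) (scaled-root-≤ 1≤k Q m)) (>-nonZero⁻¹ Q)) ⟩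
      N * (Q * p + Q * m + Q)  ≡⟨ lemma N Q p m ⟩
      Q * (N * (p + m + 1))  ≤⟨ *-monoʳ-≤ Q Q-large ⟩
      Q * Q  ∎
      where
      open ≤-Reasoning
      lemma : ∀ n q p m → n * (q * p + q * m + q) ≡ q * (n * (p + m + 1))
      lemma = solve-∀

    -- Three units: one for the floor in `A (p′ * m)`, one for the floor in `E m`, one for the
    -- rounding at scale Q.
    phase-≤ : A (p * m) ∸ A (p′ * m) ≤ E m + 3
    phase-≤ = m≤n+o⇒m∸n≤o (A (p * m)) (A (p′ * m)) (*-cancelʳ-≤ _ _ (Q * Q) (begin
      A (p * m) * (Q * Q)  ≤⟨ A-≤-root p m ⟩
      N * suc (B p) * suc (B m)  ≡⟨ cong (λ x → N * suc x * suc (B m)) (sym B′+ΔB) ⟩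
      N * suc (B p′ + ΔB) * suc (B m)  ≡⟨ lemma₁ N (B p′) ΔB (B m) ⟩
      N * B p′ * B m + N * ΔB * B m + N * (B p′ + ΔB + B m + 1)  ≤⟨ +-mono-≤ (+-mono-≤ (A-≥-root p′ m) (E-≥-root m)) (≤-trans (≤-reflexive (cong (λ x → N * (x + B m + 1)) B′+ΔB)) error≤Q²) ⟩
      suc (A (p′ * m)) * (Q * Q) + suc (E m) * (Q * Q) + Q * Q  ≡⟨ lemma₂ (A (p′ * m)) (E m) (Q * Q) ⟩
      (A (p′ * m) + (E m + 3)) * (Q * Q)  ∎))
      where
      open ≤-Reasoning
      lemma₁ : ∀ n b d c → n * suc (b + d) * suc c ≡ n * b * c + n * d * c + n * (b + d + c + 1)
      lemma₁ = solve-∀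
      lemma₂ : ∀ a e q → suc a * q + suc e * q + q ≡ (a + (e + 3)) * q
      lemma₂ = solve-∀

    phase-≥ : E m ≤ A (p * m) ∸ A (p′ * m) + 3
    phase-≥ = +-cancelʳ-≤ (A (p′ * m)) _ _ (*-cancelʳ-≤ _ _ (Q * Q) (begin
      (E m + A (p′ * m)) * (Q * Q)  ≡⟨ *-distribʳ-+ (Q * Q) (E m) _ ⟩
      E m * (Q * Q) + A (p′ * m) * (Q * Q)  ≤⟨ +-mono-≤ (E-≤-root m) (A-≤-root p′ m) ⟩
      N * ΔB * suc (B m) + N * suc (B p′) * suc (B m)  ≡⟨ lemma₁ N ΔB (B m) (B p′) ⟩
      N * (B p′ + ΔB) * B m + N * (B p′ + ΔB + B m + 1)  ≡⟨ cong (λ x → N * x * B m + N * (x + B m + 1)) B′+ΔB ⟩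
      N * B p * B m + N * (B p + B m + 1)  ≤⟨ +-mono-≤ (A-≥-root p m) error≤Q² ⟩
      suc (A (p * m)) * (Q * Q) + Q * Q  ≤⟨ m≤m+n _ (1 * (Q * Q)) ⟩
      suc (A (p * m)) * (Q * Q) + Q * Q + 1 * (Q * Q)  ≡⟨ lemma₂ (A (p * m)) (Q * Q) ⟩
      (A (p * m) + 3) * (Q * Q)  ≡⟨ cong (λ x → (x + 3) * (Q * Q)) (sym (m∸n+n≡m (A-mono m))) ⟩
      (A (p * m) ∸ A (p′ * m) + A (p′ * m) + 3) * (Q * Q)  ≡⟨ cong (_* (Q * Q)) (lemma₃ (A (p * m) ∸ A (p′ * m)) (A (p′ * m))) ⟩
      (A (p * m) ∸ A (p′ * m) + 3 + A (p′ * m)) * (Q * Q)  ∎))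
      where
      open ≤-Reasoning
      lemma₁ : ∀ n d c b → n * d * suc c + n * suc b * suc c ≡ n * (b + d) * c + n * (b + d + c + 1)
      lemma₁ = solve-∀
      lemma₂ : ∀ a q → suc a * q + q + 1 * q ≡ (a + 3) * q
      lemma₂ = solve-∀
      lemma₃ : ∀ a b → a + b + 3 ≡ a + 3 + b
      lemma₃ = solve-∀

  -- Bernoulli's inequality with τ = `ΔB` + 1 gives U (p - p′) ≤ k τ (B p + 1)^(k-1), and p ≤ C (p -
  -- p′) turns this into Q ≤ C k 2^k τ. The hypothesis on Q absorbs the 1 in τ at the price of a
  -- factor 2.
  ΔB-lower : ∀ C → p ≤ C * (p ∸ p′) → 2 * (C * (k * 2 ^ k)) ≤ Q → Q ≤ 2 * (C * (k * 2 ^ k)) * ΔB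
  ΔB-lower C p≤ Q≥ = +-cancelʳ-≤ (c + c) _ _ (begin
    Q + (c + c)  ≤⟨ +-monoʳ-≤ Q (≤-trans (≤-reflexive (cong (_+_ c) (sym (+-identityʳ c)))) Q≥) ⟩
    Q + Q  ≤⟨ +-mono-≤ Q≤ Q≤ ⟩
    c * suc ΔB + c * suc ΔB  ≡⟨ lemma c ΔB ⟩
    2 * c * ΔB + (c + c)  ∎)
    where
    open ≤-Reasoning
    c = C * (k * 2 ^ k)
    τ = suc ΔB
    lemma : ∀ c d → c * suc d + c * suc d ≡ 2 * c * d + (c + c)
    lemma = solve-∀
    instance
      p≢0 : NonZero p
      p≢0 = >-nonZero (<-trans 1≤p′ p′<p)
    B′+τ : B p′ + τ ≡ suc (B p)
    B′+τ = trans (+-suc (B p′) ΔB) (cong suc B′+ΔB)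
    gap : U * (p ∸ p′) * suc (B p) ≤ k * τ * suc (B p) ^ k
    gap = +-cancelˡ-≤ (U * p′ * suc (B p)) _ _ (begin
      U * p′ * suc (B p) + U * (p ∸ p′) * suc (B p)  ≡⟨ lemma₁ U p′ (p ∸ p′) (suc (B p)) ⟩
      suc (B p) * (U * (p′ + (p ∸ p′)))  ≡⟨ cong (λ x → suc (B p) * (U * x)) (m+[n∸m]≡n (<⇒≤ p′<p)) ⟩
      suc (B p) * (U * p)  ≤⟨ *-monoʳ-≤ (suc (B p)) (<⇒≤ (iroot-upper k (U * p) 1≤k)) ⟩
      suc (B p) * suc (B p) ^ k  ≤⟨ subst (λ y → y * y ^ k ≤ y * B p′ ^ k + k * τ * y ^ k) B′+τ (bernoulli k (B p′) τ) ⟩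
      suc (B p) * B p′ ^ k + k * τ * suc (B p) ^ k  ≤⟨ +-monoˡ-≤ _ (≤-trans (*-monoʳ-≤ (suc (B p)) (iroot-lower k (U * p′) 1≤k)) (≤-reflexive (*-comm (suc (B p)) _))) ⟩
      U * p′ * suc (B p) + k * τ * suc (B p) ^ k  ∎)
      where
      lemma₁ : ∀ u a d b → u * a * b + u * d * b ≡ b * (u * (a + d))
      lemma₁ = solve-∀
    sucB^k≤ : suc (B p) ^ k ≤ 2 ^ k * (U * p)
    sucB^k≤ = begin
      suc (B p) ^ k  ≤⟨ ^-monoˡ-≤ k (≤-trans (+-monoˡ-≤ (B p) (≤-trans (>-nonZero⁻¹ Q) (scaled-root-≥ 1≤k Q p (>-nonZero⁻¹ p)))) (≤-reflexive (cong (_+_ (B p)) (sym (+-identityʳ (B p)))))) ⟩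
      (2 * B p) ^ k  ≡⟨ ^-distribʳ-* k 2 (B p) ⟩
      2 ^ k * B p ^ k  ≤⟨ *-monoʳ-≤ (2 ^ k) (iroot-lower k (U * p) 1≤k) ⟩
      2 ^ k * (U * p)  ∎
    Q≤ : Q ≤ c * τ
    Q≤ = *-cancelʳ-≤ _ _ (U * p) {{m*n≢0 U p}} (begin
      Q * (U * p)  ≤⟨ *-monoʳ-≤ Q (*-monoʳ-≤ U p≤) ⟩
      Q * (U * (C * (p ∸ p′)))  ≡⟨ lemma₁ Q U C (p ∸ p′) ⟩
      C * (U * (p ∸ p′) * Q)  ≤⟨ *-monoʳ-≤ C (*-monoʳ-≤ (U * (p ∸ p′)) (m≤n⇒m≤1+n (scaled-root-≥ 1≤k Q p (>-nonZero⁻¹ p)))) ⟩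
      C * (U * (p ∸ p′) * suc (B p))  ≤⟨ *-monoʳ-≤ C gap ⟩
      C * (k * τ * suc (B p) ^ k)  ≤⟨ *-monoʳ-≤ C (*-monoʳ-≤ (k * τ) sucB^k≤) ⟩
      C * (k * τ * (2 ^ k * (U * p)))  ≡⟨ lemma₂ C k τ (2 ^ k) (U * p) ⟩
      C * (k * 2 ^ k) * τ * (U * p)  ∎)
      where
      lemma₁ : ∀ q u c d → q * (u * (c * d)) ≡ c * (u * d * q)
      lemma₁ = solve-∀
      lemma₂ : ∀ c k t e x → c * (k * t * (e * x)) ≡ c * (k * e) * t * x
      lemma₂ = solve-∀

  -- The ratio p / p′ is at most 1 + 1/K, hence so is the ratio of the k-th roots. Since K + 1 ≤ Q ≤
  -- `B p′`, the rounding costs one more `B p′`.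
  ΔB-upper : ∀ K → K * (p ∸ p′) ≤ p′ → K + 1 ≤ Q → K * ΔB ≤ 2 * B p′
  ΔB-upper K Kd≤ Q≥ = +-cancelˡ-≤ (K * B p′) _ _ (begin
    K * B p′ + K * ΔB  ≡⟨ sym (*-distribˡ-+ K (B p′) ΔB) ⟩
    K * (B p′ + ΔB)  ≡⟨ cong (K *_) B′+ΔB ⟩
    K * B p  ≤⟨ KB≤ ⟩
    suc (B p′) * suc K  ≡⟨ lemma₁ (B p′) K ⟩
    K * B p′ + (B p′ + (K + 1))  ≤⟨ +-monoʳ-≤ (K * B p′) (+-monoʳ-≤ (B p′) (≤-trans Q≥ (≤-trans (scaled-root-≥ 1≤k Q p′ 1≤p′) (≤-reflexive (sym (+-identityʳ (B p′))))))) ⟩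
    K * B p′ + 2 * B p′  ∎)
    where
    open ≤-Reasoning
    lemma₁ : ∀ b k → suc b * suc k ≡ k * b + (b + (k + 1))
    lemma₁ = solve-∀
    Kp≤ : K * p ≤ suc K * p′
    Kp≤ = begin
      K * p  ≡⟨ trans (cong (K *_) (sym (m+[n∸m]≡n (<⇒≤ p′<p)))) (*-distribˡ-+ K p′ (p ∸ p′)) ⟩
      K * p′ + K * (p ∸ p′)  ≤⟨ +-monoʳ-≤ (K * p′) Kd≤ ⟩
      K * p′ + p′  ≡⟨ +-comm (K * p′) p′ ⟩
      suc K * p′  ∎
    K^kp≤ : ∀ j → 1 ≤ j → K ^ j * p ≤ suc K ^ j * p′
    K^kp≤ (suc j) _ = begin
      K * K ^ j * p  ≡⟨ lemma₂ K (K ^ j) p ⟩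
      K ^ j * (K * p)  ≤⟨ *-mono-≤ (^-monoˡ-≤ j (n≤1+n K)) Kp≤ ⟩
      suc K ^ j * (suc K * p′)  ≡⟨ lemma₃ (suc K ^ j) (suc K) p′ ⟩
      suc K * suc K ^ j * p′  ∎
      where
      lemma₂ : ∀ a b c → a * b * c ≡ b * (a * c)
      lemma₂ = solve-∀
      lemma₃ : ∀ a b c → a * (b * c) ≡ b * a * c
      lemma₃ = solve-∀
    KB≤ : K * B p ≤ suc (B p′) * suc K
    KB≤ = pow-cancel-≤ k 1≤k (begin
      (K * B p) ^ k  ≡⟨ ^-distribʳ-* k K (B p) ⟩
      K ^ k * B p ^ k  ≤⟨ *-monoʳ-≤ (K ^ k) (iroot-lower k (U * p) 1≤k) ⟩
      K ^ k * (U * p)  ≡⟨ lemma₂ (K ^ k) U p ⟩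
      U * (K ^ k * p)  ≤⟨ *-monoʳ-≤ U (K^kp≤ k 1≤k) ⟩
      U * (suc K ^ k * p′)  ≡⟨ lemma₃ U (suc K ^ k) p′ ⟩
      U * p′ * suc K ^ k  ≤⟨ *-monoˡ-≤ (suc K ^ k) (<⇒≤ (iroot-upper k (U * p′) 1≤k)) ⟩
      suc (B p′) ^ k * suc K ^ k  ≡⟨ sym (^-distribʳ-* k (suc (B p′)) (suc K)) ⟩
      (suc (B p′) * suc K) ^ k  ∎)
      where
      lemma₂ : ∀ a b c → a * (b * c) ≡ b * (a * c)
      lemma₂ = solve-∀
      lemma₃ : ∀ a b c → a * (b * c) ≡ a * c * b
      lemma₃ = solve-∀

  -- The hypothesis says `ΔB` / Q ≥ 1/H, so κ Z^(1/k) ≥ Z^(1/k) / H ≥ K.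
  E-large : ∀ K H Z → Q ≤ H * ΔB → (H * K) ^ k ≤ Z → K ≤ E Z
  E-large K H Z Q≤ HK≤Z = iroot-greatest k (V * Z / U) K 1≤k (*≤⇒≤/ (K ^ k) U (V * Z) (begin
    K ^ k * Q ^ k  ≡⟨ sym (^-distribʳ-* k K Q) ⟩
    (K * Q) ^ k  ≤⟨ ^-monoˡ-≤ k (*-monoʳ-≤ K Q≤) ⟩
    (K * (H * ΔB)) ^ k  ≡⟨ trans (cong (_^ k) (lemma K H ΔB)) (^-distribʳ-* k ΔB (H * K)) ⟩
    ΔB ^ k * (H * K) ^ k  ≤⟨ *-mono-≤ (^-monoˡ-≤ k (m≤n*m ΔB N)) HK≤Z ⟩
    V * Z  ∎))
    where
    open ≤-Reasoning
    lemma : ∀ k h d → k * (h * d) ≡ d * (h * k)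
    lemma = solve-∀

  -- Up to rounding, K κ Z^(1/k) ≤ 2N (p′ Z)^(1/k) ≤ 4N X^(1/k), and k ≥ 2 gives X^(1/k) ≤ √X ≤ 2Z.
  E-small : ∀ K Z X → K * ΔB ≤ 2 * B p′ → p′ * Z ≤ 2 * X → 1 ≤ X → X ≤ 4 * (Z * Z) → E Z * K ≤ 8 * N * Z
  E-small K Z X KΔB≤ p′Z≤ 1≤X X≤ = square-cancel-≤ (begin
    E Z * K * (E Z * K)  ≤⟨ square-from-power k (E Z * K) (4 * N) X 2≤k (≤-trans (>-nonZero⁻¹ N) (m≤n*m N 4)) 1≤X power ⟩
    4 * N * (4 * N) * X  ≤⟨ *-monoʳ-≤ (4 * N * (4 * N)) X≤ ⟩
    4 * N * (4 * N) * (4 * (Z * Z)) ≡⟨ lemma N Z ⟩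
    8 * N * Z * (8 * N * Z)  ∎)
    where
    open ≤-Reasoning
    lemma : ∀ n z → 4 * n * (4 * n) * (4 * (z * z)) ≡ 8 * n * z * (8 * n * z)
    lemma = solve-∀
    power : (E Z * K) ^ k ≤ (4 * N) ^ k * X
    power = *-cancelˡ-≤ U (begin
      U * (E Z * K) ^ k  ≡⟨ trans (cong (U *_) (^-distribʳ-* k (E Z) K)) (sym (*-assoc U _ _)) ⟩
      U * E Z ^ k * K ^ k  ≤⟨ *-monoˡ-≤ (K ^ k) (E-lower Z) ⟩
      V * Z * K ^ k  ≡⟨ swap-middle V Z (K ^ k) ⟩
      V * K ^ k * Z  ≡⟨ cong (_* Z) (trans (sym (^-distribʳ-* k (N * ΔB) K)) (cong (_^ k) (lemma₂ N ΔB K))) ⟩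
      (N * (K * ΔB)) ^ k * Z  ≤⟨ *-monoˡ-≤ Z (^-monoˡ-≤ k (*-monoʳ-≤ N KΔB≤)) ⟩
      (N * (2 * B p′)) ^ k * Z  ≡⟨ cong (_* Z) (trans (cong (_^ k) (lemma₃ N (B p′))) (^-distribʳ-* k (2 * N) (B p′))) ⟩
      (2 * N) ^ k * B p′ ^ k * Z  ≤⟨ *-monoˡ-≤ Z (*-monoʳ-≤ ((2 * N) ^ k) (iroot-lower k (U * p′) 1≤k)) ⟩
      (2 * N) ^ k * (U * p′) * Z  ≡⟨ lemma₄ ((2 * N) ^ k) U p′ Z ⟩
      U * ((2 * N) ^ k * (p′ * Z))  ≤⟨ *-monoʳ-≤ U (*-monoʳ-≤ ((2 * N) ^ k) p′Z≤) ⟩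
      U * ((2 * N) ^ k * (2 * X))  ≤⟨ *-monoʳ-≤ U (*-monoʳ-≤ ((2 * N) ^ k) (*-monoˡ-≤ X (n≤n^k k 2 1≤k))) ⟩
      U * ((2 * N) ^ k * (2 ^ k * X))  ≡⟨ cong (U *_) (trans (sym (*-assoc ((2 * N) ^ k) (2 ^ k) X)) (cong (_* X) (trans (sym (^-distribʳ-* k (2 * N) 2)) (cong (_^ k) (lemma₅ N))))) ⟩
      U * ((4 * N) ^ k * X)  ∎)
      where
      lemma₂ : ∀ n d k → n * d * k ≡ n * (k * d)
      lemma₂ = solve-∀
      lemma₃ : ∀ n b → n * (2 * b) ≡ 2 * n * b
      lemma₃ = solve-∀
      lemma₄ : ∀ e u p z → e * (u * p) * z ≡ u * (e * (p * z))
      lemma₄ = solve-∀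
      lemma₅ : ∀ n → 2 * n * 2 ≡ 4 * n
      lemma₅ = solve-∀

  module _ (g : ℕ → ℤ) (Θ : ℕ) (bounded : ∀ j → ℤ.∣ ∑ᶻ j g ∣ ≤ Θ) (K : ℕ) {{_ : NonZero K}} (Z X C : ℕ)
    (K-large : Θ * (4 * (k * 2 ^ k) + 40 * N) ≤ K)
    (Q-large : N * (p + Z + 1) + 2 * (C * (k * 2 ^ k)) + (K + 1) ≤ Q)
    (close : K * (p ∸ p′) ≤ p′) (far : p ≤ C * (p ∸ p′))
    (Z-large : (2 * (C * (k * 2 ^ k)) * K) ^ k ≤ Z)
    (p′Z≤ : p′ * Z ≤ 2 * X) (1≤X : 1 ≤ X) (X≤ : X ≤ 4 * (Z * Z)) where

    private
      c = k * 2 ^ k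
      Q≥₂ : 2 * (C * c) ≤ Q
      Q≥₂ = ≤-trans (m≤n+m _ (N * (p + Z + 1))) (≤-trans (m≤m+n _ (K + 1)) Q-large)
      Q≥₃ : K + 1 ≤ Q
      Q≥₃ = ≤-trans (m≤n+m _ (N * (p + Z + 1) + 2 * (C * c))) Q-large
      Q≤HΔB : Q ≤ 2 * (C * c) * ΔB
      Q≤HΔB = ΔB-lower C far Q≥₂
      K≤E : K ≤ E Z
      K≤E = E-large K (2 * (C * c)) Z Q≤HΔB Z-large
      EK≤ : E Z * K ≤ 8 * N * Z
      EK≤ = E-small K Z X (ΔB-upper K close Q≥₃) p′Z≤ 1≤X X≤
      instance
        ΔB≢0 : NonZero ΔB
        ΔB≢0 = >-nonZero (n≢0⇒n>0 (λ eq → <⇒≱ (>-nonZero⁻¹ Q) (≤-trans Q≤HΔB (≤-reflexive (trans (cong (2 * (C * c) *_) eq) (*-zeroʳ (2 * (C * c))))))))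
        V≢0 : NonZero V
        V≢0 = m^n≢0 (N * ΔB) k {{m*n≢0 N ΔB}}
        E≢0 : NonZero (E Z)
        E≢0 = >-nonZero (≤-trans (>-nonZero⁻¹ K) K≤E)

    -- The cells give Θ (4c Z / E + 5 E) with E = `E Z`. Too few cells are excluded by E ≥ K and too
    -- short ones by E ≤ 8 N Z / K; the total Θ (4c + 40N) Z / K is at most Z by the size of K.
    ∣sum-E∣≤ : ℤ.∣ ∑ᶻ Z (g ∘ E) ∣ ≤ Z
    ∣sum-E∣≤ = *-cancelˡ-≤ K (≤-trans K∣∣≤ (*-monoˡ-≤ Z K-large))
      where
      open ≤-Reasoning
      s = ℤ.∣ ∑ᶻ Z (g ∘ E) ∣
      cells : V * E Z * s ≤ Θ * (4 * c * (U * E Z ^ k) + 5 * V * (E Z * E Z))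
      cells = Cells.V-J-∣sum∣≤ k U V 1≤k E E-lower E-upper g Θ bounded Z (E Z) (>-nonZero⁻¹ (E Z)) ≤-refl
      E-s≤ : E Z * s ≤ Θ * (4 * c * Z + 5 * (E Z * E Z))
      E-s≤ = *-cancelˡ-≤ V (begin
        V * (E Z * s)  ≡⟨ sym (*-assoc V (E Z) s) ⟩
        V * E Z * s  ≤⟨ cells ⟩
        Θ * (4 * c * (U * E Z ^ k) + 5 * V * (E Z * E Z))  ≤⟨ *-monoʳ-≤ Θ (+-monoˡ-≤ (5 * V * (E Z * E Z)) (*-monoʳ-≤ (4 * c) (E-lower Z))) ⟩
        Θ * (4 * c * (V * Z) + 5 * V * (E Z * E Z))  ≡⟨ lemma Θ c V Z (E Z * E Z) ⟩
        V * (Θ * (4 * c * Z + 5 * (E Z * E Z)))  ∎)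
        where
        lemma : ∀ t c v z e → t * (4 * c * (v * z) + 5 * v * e) ≡ v * (t * (4 * c * z + 5 * e))
        lemma = solve-∀
      K∣∣≤ : K * s ≤ Θ * (4 * c + 40 * N) * Z
      K∣∣≤ = *-cancelˡ-≤ (E Z) (begin
        E Z * (K * s)  ≡⟨ lemma₁ (E Z) K s ⟩
        K * (E Z * s)  ≤⟨ *-monoʳ-≤ K E-s≤ ⟩
        K * (Θ * (4 * c * Z + 5 * (E Z * E Z)))  ≡⟨ lemma₂ K Θ c Z (E Z) ⟩
        Θ * (4 * c * Z * K + 5 * E Z * (E Z * K))  ≤⟨ *-monoʳ-≤ Θ (+-mono-≤ (*-monoʳ-≤ (4 * c * Z) K≤E) (*-monoʳ-≤ (5 * E Z) EK≤)) ⟩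
        Θ * (4 * c * Z * E Z + 5 * E Z * (8 * N * Z))  ≡⟨ lemma₃ Θ c Z (E Z) N ⟩
        E Z * (Θ * (4 * c + 40 * N) * Z)  ∎)
        where
        lemma₁ : ∀ e k s → e * (k * s) ≡ k * (e * s)
        lemma₁ = solve-∀
        lemma₂ : ∀ k t c z e → k * (t * (4 * c * z + 5 * (e * e))) ≡ t * (4 * c * z * k + 5 * e * (e * k))
        lemma₂ = solve-∀
        lemma₃ : ∀ t c z e n → t * (4 * c * z * e + 5 * e * (8 * n * z)) ≡ e * (t * (4 * c + 40 * n) * z)
        lemma₃ = solve-∀

-- Bilinear sums over blocks of primes

∑ᶻ-rotate : ∀ a b c {h : ℕ → ℕ → ℕ → ℤ} →
  ∑ᶻ a (λ t → ∑ᶻ b (λ m → ∑ᶻ c (h t m))) ≡ ∑ᶻ c (λ i → ∑ᶻ a (λ t → ∑ᶻ b (λ m → h t m i)))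
∑ᶻ-rotate a b c = trans (∑ᶻ-cong a (λ t _ → ∑ᶻ-swap b c)) (∑ᶻ-swap a c)

∑ᶻ-product : ∀ m n {f g} → ∑ᶻ m f ℤ.* ∑ᶻ n g ≡ ∑ᶻ m (λ i → ∑ᶻ n (λ j → f i ℤ.* g j))
∑ᶻ-product m n {f} {g} = sym (trans (∑ᶻ-cong m (λ i _ → ∑ᶻ-*ˡ n (f i))) (∑ᶻ-*ʳ m (∑ᶻ n g)))

∑-∣square∣ : ∀ n {g : ℕ → ℤ} → + ∑ n (λ i → ℤ.∣ g i ∣ * ℤ.∣ g i ∣) ≡ ∑ᶻ n (λ i → g i ℤ.* g i)
∑-∣square∣ zero    = refl
∑-∣square∣ (suc n) {g} = trans (ℤP.pos-+ _ (ℤ.∣ g n ∣ * ℤ.∣ g n ∣)) (cong₂ ℤ._+_ (∑-∣square∣ n {g}) (square (g n)))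
  where
  square : ∀ i → + (ℤ.∣ i ∣ * ℤ.∣ i ∣) ≡ i ℤ.* i
  square (ℤ.+ n)      = ℤP.pos-* n n
  square (ℤ.-[1+ n ]) = refl

+-∑ : ∀ n {g : ℕ → ℕ} → + ∑ n g ≡ ∑ᶻ n (λ i → + g i)
+-∑ zero    = refl
+-∑ (suc n) {g} = trans (ℤP.pos-+ (∑ n g) (g n)) (cong (ℤ._+ + g n) (+-∑ n))

when-* : ∀ x y c d → (x when c) ℤ.* (y when d) ≡ (x ℤ.* y when d when c)
when-* x y true  true  = refl
when-* x y true  false = ℤP.*-zeroʳ x
when-* x y false d     = refl

near : ℕ → ℕ → ℕ → Bool
near G i j = (i <ᵇ j + G) ∧ (j <ᵇ i + G)

near-false : ∀ G i j → i + G ≤ j ⊎ j + G ≤ i → near G i j ≡ false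
near-false G i j far with i <ᵇ j + G in eq₁ | j <ᵇ i + G in eq₂
... | false | _     = refl
... | true  | false = refl
... | true  | true  with far
...   | inj₁ le = ⊥-elim (<⇒≱ (<ᵇ⇒< j (i + G) (subst T (sym eq₂) _)) le)
...   | inj₂ le = ⊥-elim (<⇒≱ (<ᵇ⇒< i (j + G) (subst T (sym eq₁) _)) le)

near-or-far : ∀ G i j → near G i j ≡ false → i + G ≤ j ⊎ j + G ≤ i
near-or-far G i j eq with i + G ≤? j | j + G ≤? i
... | yes le | _      = inj₁ le
... | no _   | yes le = inj₂ le
... | no ≰₁  | no ≰₂  = ⊥-elim (true≢false (<⇒<ᵇ (≰⇒> ≰₂)) (<⇒<ᵇ (≰⇒> ≰₁)) eq)
  where
  true≢false : ∀ {c d} → T c → T d → c ∧ d ≡ false → ⊥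
  true≢false {true} {true} _ _ ()

indicator : Bool → ℕ
indicator c = if c then 1 else 0

near-count : ∀ G i n → ∑ n (λ j → indicator (near G i j)) ≤ 2 * G
near-count G i zero    = z≤n
near-count G i (suc n) with i + G ≤? n
... | yes le rewrite near-false G i n (inj₁ le) = ≤-trans (≤-reflexive (+-identityʳ _)) (near-count G i n)
... | no ≰ = begin
  ∑ (suc n) (λ j → indicator (near G i j))  ≤⟨ early (suc n) ⟩
  suc n + G ∸ i  ≤⟨ ∸-monoˡ-≤ i (+-monoˡ-≤ G (≰⇒> ≰)) ⟩
  i + G + G ∸ i  ≡⟨ trans (cong (_∸ i) (+-assoc i G G)) (m+n∸m≡n i (G + G)) ⟩
  G + G  ≡⟨ cong (_+_ G) (sym (+-identityʳ G)) ⟩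
  2 * G  ∎
  where
  open ≤-Reasoning
  early : ∀ n → ∑ n (λ j → indicator (near G i j)) ≤ n + G ∸ i
  early zero    = z≤n
  early (suc n) with near G i n in eq
  ... | false = ≤-trans (≤-reflexive (+-identityʳ _)) (≤-trans (early n) (∸-monoˡ-≤ i (n≤1+n (n + G))))
  ... | true  = ≤-trans (+-monoˡ-≤ 1 (early n)) (≤-reflexive (trans (+-comm _ 1) (sym (+-∸-assoc 1 i≤n+G))))
    where
    ∧-fst : ∀ {c d} → c ∧ d ≡ true → T c
    ∧-fst {true} _ = _
    i≤n+G : i ≤ n + G
    i≤n+G = <⇒≤ (<ᵇ⇒< i (n + G) (∧-fst eq))

am-gm : ∀ x y → 2 * (x * y) ≤ x * x + y * y
am-gm x y with ≤-total x y
... | inj₁ x≤y = subst (λ y → 2 * (x * y) ≤ x * x + y * y) (m+[n∸m]≡n x≤y)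
    (≤-trans (m≤m+n _ ((y ∸ x) * (y ∸ x))) (≤-reflexive (lemma x (y ∸ x))))
  where
  lemma : ∀ x d → 2 * (x * (x + d)) + d * d ≡ x * x + (x + d) * (x + d)
  lemma = solve-∀
... | inj₂ y≤x = subst (λ x → 2 * (x * y) ≤ x * x + y * y) (m+[n∸m]≡n y≤x)
    (≤-trans (m≤m+n _ ((x ∸ y) * (x ∸ y))) (≤-reflexive (lemma y (x ∸ y))))
  where
  lemma : ∀ y d → 2 * ((y + d) * y) + d * d ≡ (y + d) * (y + d) + y * y
  lemma = solve-∀

-- `A n` is n^(1/k) in units of 1/N and t rotates the circle of length M. With b = 2q and N = 2w,
-- the position of `A n` modulo M is n^(1/k) / q modulo 1.
module Shifts (k b w N : ℕ) {{b≢0 : NonZero b}} {{w≢0 : NonZero w}} where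

  open Wave b w public

  A : ℕ → ℕ
  A n = iroot k (N ^ k * n)

  f : ℕ → ℕ → ℤ
  f t n = φ (A n + t)

  ∣f∣≤b : ∀ t n → ℤ.∣ f t n ∣ ≤ b
  ∣f∣≤b t n = ∣φ∣≤b (A n + t)

  module Sieveₜ (X t : ℕ) = Sieve (f t) b (∣f∣≤b t) X

module Dispersion {k : ℕ} (2≤k : 2 ≤ k) (b w N : ℕ) {{b≢0 : NonZero b}} {{w≢0 : NonZero w}} {{N≢0 : NonZero N}}
  (K X R β G C s : ℕ) {{K≢0 : NonZero K}} {{R≢0 : NonZero R}} (2≤R : 2 ≤ R) where

  open Shifts k b w N

  private
    c = k * 2 ^ k
    Z₁ = suc (X / R)

  p[_] : ℕ → ℕ
  p[ i ] = suc (R + i)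

  F : ℕ → ℕ → ℤ
  F t n = f t n when (n ≤ᵇ X)

  v : ℕ → ℕ → ℤ
  v t m = ∑ᶻ β (λ i → F t (p[ i ] * m) when isPrime p[ i ])

  inner : ℕ → ℕ → ℤ
  inner i j = ∑ᶻ M (λ t → ∑ᶻ Z₁ (λ m → F t (p[ i ] * m) ℤ.* F t (p[ j ] * m)))

  sum-squares : ∑ᶻ M (λ t → ∑ᶻ Z₁ (λ m → v t m ℤ.* v t m)) ≡
    ∑ᶻ β (λ i → ∑ᶻ β (λ j → inner i j when isPrime p[ j ] when isPrime p[ i ]))
  sum-squares = begin
    ∑ᶻ M (λ t → ∑ᶻ Z₁ (λ m → v t m ℤ.* v t m))
      ≡⟨ ∑ᶻ-cong M (λ t _ → ∑ᶻ-cong Z₁ (λ m _ → trans (∑ᶻ-product β β) (∑ᶻ-cong β (λ i _ → ∑ᶻ-cong β (λ j _ → when-* (F t (p[ i ] * m)) (F t (p[ j ] * m)) (isPrime p[ i ]) (isPrime p[ j ])))))) ⟩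
    ∑ᶻ M (λ t → ∑ᶻ Z₁ (λ m → ∑ᶻ β (λ i → ∑ᶻ β (λ j → h t m i j))))
      ≡⟨ ∑ᶻ-rotate M Z₁ β ⟩
    ∑ᶻ β (λ i → ∑ᶻ M (λ t → ∑ᶻ Z₁ (λ m → ∑ᶻ β (λ j → h t m i j))))
      ≡⟨ ∑ᶻ-cong β (λ i _ → ∑ᶻ-rotate M Z₁ β) ⟩
    ∑ᶻ β (λ i → ∑ᶻ β (λ j → ∑ᶻ M (λ t → ∑ᶻ Z₁ (λ m → h t m i j))))
      ≡⟨ ∑ᶻ-cong β (λ i _ → ∑ᶻ-cong β (λ j _ → pull i j)) ⟩
    ∑ᶻ β (λ i → ∑ᶻ β (λ j → inner i j when isPrime p[ j ] when isPrime p[ i ])) ∎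
    where
    open ≡-Reasoning
    h : ℕ → ℕ → ℕ → ℕ → ℤ
    h t m i j = F t (p[ i ] * m) ℤ.* F t (p[ j ] * m) when isPrime p[ j ] when isPrime p[ i ]
    ∑ᶻ-when₂ : ∀ n c d {g} → ∑ᶻ n (λ i → g i when c when d) ≡ (∑ᶻ n g when c when d)
    ∑ᶻ-when₂ n c d = trans (∑ᶻ-when n d) (cong (_when d) (∑ᶻ-when n c))
    pull : ∀ i j → ∑ᶻ M (λ t → ∑ᶻ Z₁ (λ m → h t m i j)) ≡ (inner i j when isPrime p[ j ] when isPrime p[ i ])
    pull i j = trans (∑ᶻ-cong M (λ t _ → ∑ᶻ-when₂ Z₁ (isPrime p[ j ]) (isPrime p[ i ]))) (∑ᶻ-when₂ M (isPrime p[ j ]) (isPrime p[ i ]))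

  ∣F∣≤b : ∀ t n → ℤ.∣ F t n ∣ ≤ b
  ∣F∣≤b t n = ≤-trans (∣when∣≤ (f t n) (n ≤ᵇ X)) (∣f∣≤b t n)

  ∣inner∣≤ : ∀ i j → ℤ.∣ inner i j ∣ ≤ M * (Z₁ * (b * b))
  ∣inner∣≤ i j = ∣∑ᶻ∣≤ M _ (λ t _ → ∣∑ᶻ∣≤ Z₁ (b * b) (λ m _ → ≤-trans (≤-reflexive (ℤP.abs-* (F t (p[ i ] * m)) _)) (*-mono-≤ (∣F∣≤b t (p[ i ] * m)) (∣F∣≤b t (p[ j ] * m)))))

  inner-sym : ∀ i j → inner i j ≡ inner j i
  inner-sym i j = ∑ᶻ-cong M (λ t _ → ∑ᶻ-cong Z₁ (λ m _ → ℤP.*-comm (F t (p[ i ] * m)) (F t (p[ j ] * m))))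

  module _ (R²≤X : R * R ≤ X) (Kβ≤R : K * β ≤ R) where

    private
      X/p≤X/R : ∀ i → X / p[ i ] ≤ X / R
      X/p≤X/R i = /-monoʳ-≤ X (m≤n⇒m≤1+n (m≤m+n R i))
      β≤R : β ≤ R
      β≤R = ≤-trans (m≤n*m β K) Kβ≤R
      p≤2R : ∀ i → i < β → p[ i ] ≤ 2 * R
      p≤2R i i<β = ≤-trans (≤-reflexive (sym (+-suc R i))) (≤-trans (+-monoʳ-≤ R (≤-trans i<β β≤R)) (≤-reflexive (cong (_+_ R) (sym (+-identityʳ R)))))
      p≤X : ∀ i → i < β → p[ i ] ≤ X
      p≤X i i<β = ≤-trans (p≤2R i i<β) (≤-trans (*-monoˡ-≤ R 2≤R) R²≤X)

    -- The larger prime decides the cut-off. Inside it the sum over t is the autocorrelation at the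
    -- difference of the two phases; outside every product vanishes.
    inner-ordered : ∀ i j → j ≤ i → inner i j ≡ ∑ᶻ (suc (X / p[ i ])) (λ m → Ψ (A (p[ i ] * m) ∸ A (p[ j ] * m)))
    inner-ordered i j j≤i = begin
      inner i j  ≡⟨ ∑ᶻ-swap M Z₁ ⟩
      ∑ᶻ Z₁ g  ≡⟨ cong (λ n → ∑ᶻ n g) (sym (m+[n∸m]≡n (s≤s (X/p≤X/R i)))) ⟩
      ∑ᶻ (Z + (Z₁ ∸ Z)) g  ≡⟨ ∑ᶻ-split Z (Z₁ ∸ Z) ⟩
      ∑ᶻ Z g ℤ.+ ∑ᶻ (Z₁ ∸ Z) (λ m → g (Z + m))  ≡⟨ cong₂ ℤ._+_ (∑ᶻ-cong Z inside) (∑ᶻ-0 (Z₁ ∸ Z) (λ m _ → outside (Z + m) (m≤m+n Z m))) ⟩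
      ∑ᶻ Z (λ m → Ψ (A (p[ i ] * m) ∸ A (p[ j ] * m))) ℤ.+ 0ℤ  ≡⟨ ℤP.+-identityʳ _ ⟩
      ∑ᶻ Z (λ m → Ψ (A (p[ i ] * m) ∸ A (p[ j ] * m)))  ∎
      where
      open ≡-Reasoning
      Z = suc (X / p[ i ])
      g : ℕ → ℤ
      g m = ∑ᶻ M (λ t → F t (p[ i ] * m) ℤ.* F t (p[ j ] * m))
      pⱼ≤pᵢ : p[ j ] ≤ p[ i ]
      pⱼ≤pᵢ = s≤s (+-monoʳ-≤ R j≤i)
      F-inside : ∀ t n → n ≤ X → F t n ≡ f t n
      F-inside t n n≤X with n ≤ᵇ X | ≤⇒≤ᵇ n≤X
      ... | true | _ = refl
      inside : ∀ m → m < Z → g m ≡ Ψ (A (p[ i ] * m) ∸ A (p[ j ] * m))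
      inside m m<Z = trans (∑ᶻ-cong M (λ t _ → cong₂ ℤ._*_ (trans (F-inside t (p[ i ] * m) pm≤X) (cong (λ a → φ (a + t)) (sym (m∸n+n≡m A-mono)))) (F-inside t (p[ j ] * m) (≤-trans (*-monoˡ-≤ m pⱼ≤pᵢ) pm≤X))))
                           (correlation (A (p[ i ] * m) ∸ A (p[ j ] * m)) (A (p[ j ] * m)))
        where
        pm≤X : p[ i ] * m ≤ X
        pm≤X = ≤-trans (≤-reflexive (*-comm p[ i ] m)) (≤-trans (*-monoˡ-≤ p[ i ] (≤-pred m<Z)) (m/n*n≤m X p[ i ]))
        A-mono : A (p[ j ] * m) ≤ A (p[ i ] * m)
        A-mono = iroot-mono k (<⇒≤ 2≤k) (*-monoʳ-≤ (N ^ k) (*-monoˡ-≤ m pⱼ≤pᵢ))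
      outside : ∀ m → Z ≤ m → g m ≡ 0ℤ
      outside m Z≤m = ∑ᶻ-0 M (λ t _ → trans (cong (ℤ._* F t (p[ j ] * m)) (F-outside t)) (ℤP.*-zeroˡ (F t (p[ j ] * m))))
        where
        F-outside : ∀ t → F t (p[ i ] * m) ≡ 0ℤ
        F-outside t with (p[ i ] * m) ≤ᵇ X in eq
        ... | false = refl
        ... | true  = ⊥-elim (<⇒≱ (<-≤-trans (<suc/* X p[ i ]) (*-monoˡ-≤ p[ i ] Z≤m)) (≤-trans (≤-reflexive (*-comm m p[ i ])) (≤ᵇ⇒≤ (p[ i ] * m) X (subst T (sym eq) _))))

    module _ (1≤G : 1 ≤ G) (2R≤CG : 2 * R ≤ C * G) (K-large : M * (M * b) * (4 * c + 40 * N) ≤ K)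
             (X-large : (2 * (C * c) * K) ^ k * (2 * R) ≤ X) where

      -- Replacing the true phase difference by `Ph.E` costs 3 Lipschitz steps of 2b² per m, and the
      -- remaining sum of `Ψ` along `Ph.E` is at most Z ≤ Z b²; hence 7 = 6 + 1. Against the trivial
      -- bound a factor M is saved.
      ∣inner-far∣≤ : ∀ i j → i < β → j + G ≤ i → ℤ.∣ inner i j ∣ ≤ Z₁ * (7 * (b * b))
      ∣inner-far∣≤ i j i<β j+G≤i = begin
        ℤ.∣ inner i j ∣  ≡⟨ cong ℤ.∣_∣ (trans (inner-ordered i j j≤i) split) ⟩
        ℤ.∣ ∑ᶻ Z (λ m → Ψ (D m) ℤ.- Ψ (Ph.E m)) ℤ.+ ∑ᶻ Z (Ψ ∘ Ph.E) ∣  ≤⟨ ℤP.∣i+j∣≤∣i∣+∣j∣ (∑ᶻ Z (λ m → Ψ (D m) ℤ.- Ψ (Ph.E m))) _ ⟩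
        ℤ.∣ ∑ᶻ Z (λ m → Ψ (D m) ℤ.- Ψ (Ph.E m)) ∣ + ℤ.∣ ∑ᶻ Z (Ψ ∘ Ph.E) ∣
          ≤⟨ +-mono-≤ (∣∑ᶻ∣≤ Z (3 * (2 * (b * b))) (λ m m<Z → Ψ-close 3 (Ph.phase-≤ m (Q-range m m<Z)) (Ph.phase-≥ m (Q-range m m<Z))))
                      (Ph.∣sum-E∣≤ Ψ (M * (M * b)) Ψ-partial-sums K Z X C K-large ≤-refl close far Z-large p′Z≤2X 1≤X X≤4Z²) ⟩
        Z * (3 * (2 * (b * b))) + Z  ≤⟨ +-monoʳ-≤ _ (≤-trans (≤-reflexive (sym (*-identityʳ Z))) (*-monoʳ-≤ Z (>-nonZero⁻¹ (b * b) {{m*n≢0 b b}}))) ⟩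
        Z * (3 * (2 * (b * b))) + Z * (b * b)  ≡⟨ lemma Z (b * b) ⟩
        Z * (7 * (b * b))  ≤⟨ *-monoˡ-≤ (7 * (b * b)) (s≤s (X/p≤X/R i)) ⟩
        Z₁ * (7 * (b * b))  ∎
        where
        open ≤-Reasoning
        p = p[ i ]
        p′ = p[ j ]
        Z = suc (X / p)
        j<i : j < i
        j<i = <-≤-trans (m<m+n j 1≤G) j+G≤i
        j≤i = <⇒≤ j<i
        p′<p : p′ < p
        p′<p = s≤s (+-monoʳ-< R j<i)
        p∸p′≡ : p ∸ p′ ≡ i ∸ j
        p∸p′≡ = [m+n]∸[m+o]≡n∸o R i j
        -- The sum of the lower bounds on Q needed by `error≤Q²`, `ΔB-lower` and `ΔB-upper`.
        Q = N * (p + Z + 1) + 2 * (C * c) + (K + 1)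
        instance
          Q≢0 : NonZero Q
          Q≢0 = >-nonZero (<-≤-trans (>-nonZero⁻¹ K) (≤-trans (m≤m+n K 1) (m≤n+m (K + 1) (N * (p + Z + 1) + 2 * (C * c)))))
        module Ph = Phase 2≤k N Q p p′ (s≤s z≤n) p′<p
        D : ℕ → ℕ
        D m = A (p * m) ∸ A (p′ * m)
        lemma : ∀ z b → z * (3 * (2 * b)) + z * b ≡ z * (7 * b)
        lemma = solve-∀
        lemma₂ : ∀ a e → a ≡ (a ℤ.- e) ℤ.+ e
        lemma₂ = solve-∀ᶻ
        split : ∑ᶻ Z (λ m → Ψ (D m)) ≡ ∑ᶻ Z (λ m → Ψ (D m) ℤ.- Ψ (Ph.E m)) ℤ.+ ∑ᶻ Z (Ψ ∘ Ph.E)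
        split = trans (∑ᶻ-cong Z (λ m _ → lemma₂ (Ψ (D m)) (Ψ (Ph.E m)))) (∑ᶻ-+ Z)
        Q-range : ∀ m → m < Z → N * (p + m + 1) ≤ Q
        Q-range m m<Z = ≤-trans (*-monoʳ-≤ N (+-monoˡ-≤ 1 (+-monoʳ-≤ p (<⇒≤ m<Z)))) (≤-trans (m≤m+n _ (2 * (C * c))) (m≤m+n _ (K + 1)))
        close : K * (p ∸ p′) ≤ p′
        close = begin
          K * (p ∸ p′)  ≡⟨ cong (K *_) p∸p′≡ ⟩
          K * (i ∸ j)  ≤⟨ *-monoʳ-≤ K (≤-trans (m∸n≤m i j) (<⇒≤ i<β)) ⟩
          K * β  ≤⟨ Kβ≤R ⟩
          R  ≤⟨ m≤n⇒m≤1+n (m≤m+n R j) ⟩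
          p′  ∎
        far : p ≤ C * (p ∸ p′)
        far = begin
          p  ≤⟨ p≤2R i i<β ⟩
          2 * R  ≤⟨ 2R≤CG ⟩
          C * G  ≤⟨ *-monoʳ-≤ C (m+n≤o⇒m≤o∸n G (≤-trans (≤-reflexive (+-comm G j)) j+G≤i)) ⟩
          C * (i ∸ j)  ≡⟨ cong (C *_) (sym p∸p′≡) ⟩
          C * (p ∸ p′)  ∎
        Z-large : (2 * (C * c) * K) ^ k ≤ Z
        Z-large = ≤-trans (*≤⇒≤/ _ p X (≤-trans (*-monoʳ-≤ ((2 * (C * c) * K) ^ k) (p≤2R i i<β)) X-large)) (n≤1+n (X / p))
        p′Z≤2X : p′ * Z ≤ 2 * X
        p′Z≤2X = begin
          p′ * Z  ≤⟨ *-monoˡ-≤ Z (<⇒≤ p′<p) ⟩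
          p * suc (X / p)  ≡⟨ trans (*-suc p (X / p)) (cong (_+_ p) (*-comm p (X / p))) ⟩
          p + X / p * p  ≤⟨ +-mono-≤ (p≤X i i<β) (m/n*n≤m X p) ⟩
          X + X  ≡⟨ cong (_+_ X) (sym (+-identityʳ X)) ⟩
          2 * X  ∎
        1≤X : 1 ≤ X
        1≤X = ≤-trans (s≤s z≤n) (p≤X i i<β)
        X≤Z*2R : X ≤ Z * (2 * R)
        X≤Z*2R = ≤-trans (<⇒≤ (<suc/* X p)) (*-monoʳ-≤ Z (p≤2R i i<β))
        X≤4Z² : X ≤ 4 * (Z * Z)
        X≤4Z² = *-cancelʳ-≤ X _ (R * R) {{m*n≢0 R R}} (begin
          X * (R * R)  ≤⟨ *-monoʳ-≤ X R²≤X ⟩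
          X * X  ≤⟨ *-mono-≤ X≤Z*2R X≤Z*2R ⟩
          Z * (2 * R) * (Z * (2 * R))  ≡⟨ lemma₃ Z R ⟩
          4 * (Z * Z) * (R * R)  ∎)
          where
          lemma₃ : ∀ z r → z * (2 * r) * (z * (2 * r)) ≡ 4 * (z * z) * (r * r)
          lemma₃ = solve-∀

      ∣inner∣-cases : ∀ i j → i < β → j < β → ℤ.∣ inner i j ∣ ≤ indicator (near G i j) * (M * (Z₁ * (b * b))) + Z₁ * (7 * (b * b))
      ∣inner∣-cases i j i<β j<β with near G i j in eq
      ... | true  = ≤-trans (∣inner∣≤ i j) (≤-trans (≤-reflexive (sym (*-identityˡ _))) (m≤m+n _ _))
      ... | false with near-or-far G i j eq
      ...   | inj₁ far = ≤-trans (≤-reflexive (cong ℤ.∣_∣ (inner-sym i j))) (∣inner-far∣≤ j i j<β far)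
      ...   | inj₂ far = ∣inner-far∣≤ i j i<β far

      -- Near pairs number at most 2 G β and keep the trivial bound M Z₁ b², which G M ≤ β turns
      -- into 2 β² b² Z₁. Far pairs add 7 β² b² Z₁.
      sum-squares-≤ : G * M ≤ β → ∑ M (λ t → ∑ Z₁ (λ m → ℤ.∣ v t m ∣ * ℤ.∣ v t m ∣)) ≤ 9 * (β * β) * (b * b) * Z₁
      sum-squares-≤ GM≤β = begin
        ∑ M (λ t → ∑ Z₁ (λ m → ℤ.∣ v t m ∣ * ℤ.∣ v t m ∣))
          ≡⟨ cong ℤ.∣_∣ (trans (+-∑ M) (trans (∑ᶻ-cong M (λ t _ → ∑-∣square∣ Z₁ {v t})) sum-squares)) ⟩
        ℤ.∣ ∑ᶻ β (λ i → ∑ᶻ β (λ j → inner i j when isPrime p[ j ] when isPrime p[ i ])) ∣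
          ≤⟨ ∣∑ᶻ∣≤ β row (λ i i<β → ≤-trans (∣∑ᶻ∣≤∑∣∣ β) (row-bound i i<β)) ⟩
        β * row
          ≤⟨ *-monoʳ-≤ β (+-monoˡ-≤ (β * (Z₁ * (7 * (b * b)))) (≤-trans (≤-reflexive (lemma₁ G M Z₁ (b * b))) (*-monoʳ-≤ (2 * Z₁ * (b * b)) GM≤β))) ⟩
        β * (2 * Z₁ * (b * b) * β + β * (Z₁ * (7 * (b * b))))
          ≡⟨ lemma₂ β Z₁ (b * b) ⟩
        9 * (β * β) * (b * b) * Z₁ ∎
        where
        open ≤-Reasoning
        row = 2 * G * (M * (Z₁ * (b * b))) + β * (Z₁ * (7 * (b * b)))
        lemma₁ : ∀ g m z b → 2 * g * (m * (z * b)) ≡ 2 * z * b * (g * m)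
        lemma₁ = solve-∀
        lemma₂ : ∀ β z b → β * (2 * z * b * β + β * (z * (7 * b))) ≡ 9 * (β * β) * b * z
        lemma₂ = solve-∀
        row-bound : ∀ i → i < β → ∑ β (λ j → ℤ.∣ inner i j when isPrime p[ j ] when isPrime p[ i ] ∣) ≤ row
        row-bound i i<β = begin
          ∑ β (λ j → ℤ.∣ inner i j when isPrime p[ j ] when isPrime p[ i ] ∣)
            ≤⟨ ∑-mono β (λ j j<β → ≤-trans (∣when∣≤ (inner i j when isPrime p[ j ]) (isPrime p[ i ])) (≤-trans (∣when∣≤ (inner i j) (isPrime p[ j ])) (∣inner∣-cases i j i<β j<β))) ⟩
          ∑ β (λ j → indicator (near G i j) * (M * (Z₁ * (b * b))) + Z₁ * (7 * (b * b)))
            ≡⟨ trans (∑-+ β) (cong₂ _+_ (∑-*ʳ β (M * (Z₁ * (b * b)))) (∑-const β (Z₁ * (7 * (b * b))))) ⟩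
          ∑ β (λ j → indicator (near G i j)) * (M * (Z₁ * (b * b))) + β * (Z₁ * (7 * (b * b)))
            ≤⟨ +-monoˡ-≤ _ (*-monoˡ-≤ (M * (Z₁ * (b * b))) (near-count G i β)) ⟩
          row ∎

      -- Cauchy-Schwarz in the additive form 2 β s |v| ≤ s² |v|² + β². The hypothesis 9 s² b² ≤ M
      -- makes the two contributions equal in size.
      dispersion : G * M ≤ β → 9 * (s * s) * (b * b) ≤ M →
        s * ∑ M (λ t → ∑ Z₁ (λ m → ℤ.∣ v t m ∣)) ≤ Z₁ * β * M
      dispersion GM≤β M-large = *-cancelˡ-≤ (2 * β) {{m*n≢0 2 β}} (begin
        2 * β * (s * ∑ M (λ t → ∑ Z₁ (λ m → ℤ.∣ v t m ∣)))  ≡⟨ sym (*-assoc (2 * β) s _) ⟩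
        2 * β * s * ∑ M (λ t → ∑ Z₁ (λ m → ℤ.∣ v t m ∣))  ≡⟨ trans (sym (∑-*ˡ M (2 * β * s))) (∑-cong M (λ t _ → sym (∑-*ˡ Z₁ (2 * β * s)))) ⟩
        ∑ M (λ t → ∑ Z₁ (λ m → 2 * β * s * ℤ.∣ v t m ∣))  ≤⟨ ∑-mono M (λ t _ → ∑-mono Z₁ (λ m _ → pointwise ℤ.∣ v t m ∣)) ⟩
        ∑ M (λ t → ∑ Z₁ (λ m → s * s * (ℤ.∣ v t m ∣ * ℤ.∣ v t m ∣) + β * β))
          ≡⟨ ∑-cong M (λ t _ → trans (∑-+ Z₁) (cong₂ _+_ (∑-*ˡ Z₁ (s * s)) (∑-const Z₁ (β * β)))) ⟩
        ∑ M (λ t → s * s * ∑ Z₁ (λ m → ℤ.∣ v t m ∣ * ℤ.∣ v t m ∣) + Z₁ * (β * β))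
          ≡⟨ trans (∑-+ M) (cong₂ _+_ (∑-*ˡ M (s * s)) (∑-const M (Z₁ * (β * β)))) ⟩
        s * s * ∑ M (λ t → ∑ Z₁ (λ m → ℤ.∣ v t m ∣ * ℤ.∣ v t m ∣)) + M * (Z₁ * (β * β))
          ≤⟨ +-monoˡ-≤ _ (*-monoʳ-≤ (s * s) (sum-squares-≤ GM≤β)) ⟩
        s * s * (9 * (β * β) * (b * b) * Z₁) + M * (Z₁ * (β * β))  ≡⟨ lemma₁ s β b Z₁ M ⟩
        (9 * (s * s) * (b * b) + M) * (Z₁ * (β * β))  ≤⟨ *-monoˡ-≤ (Z₁ * (β * β)) (+-monoˡ-≤ M M-large) ⟩
        (M + M) * (Z₁ * (β * β))  ≡⟨ lemma₂ M Z₁ β ⟩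
        2 * β * (Z₁ * β * M)  ∎)
        where
        open ≤-Reasoning
        instance
          β≢0 : NonZero β
          β≢0 = >-nonZero (≤-trans (*-mono-≤ 1≤G (>-nonZero⁻¹ M)) GM≤β)
        lemma₁ : ∀ s β b z m → s * s * (9 * (β * β) * (b * b) * z) + m * (z * (β * β)) ≡ (9 * (s * s) * (b * b) + m) * (z * (β * β))
        lemma₁ = solve-∀
        lemma₂ : ∀ m z β → (m + m) * (z * (β * β)) ≡ 2 * β * (z * β * m)
        lemma₂ = solve-∀
        lemma₃ : ∀ β s x → 2 * β * s * x ≡ 2 * (s * x * β)
        lemma₃ = solve-∀
        lemma₄ : ∀ β s x → s * x * (s * x) + β * β ≡ s * s * (x * x) + β * β
        lemma₄ = solve-∀
        pointwise : ∀ x → 2 * β * s * x ≤ s * s * (x * x) + β * β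
        pointwise x = ≤-trans (≤-reflexive (lemma₃ β s x)) (≤-trans (am-gm (s * x) β) (≤-reflexive (lemma₄ β s x)))

      -- Of the 3, two come from the bilinear sum, as Z₁ R ≤ 2X and K β ≤ R, and one from freezing
      -- the sieve level, whose cost β² b X / R² is at most X b / K² ≤ X / (K s).
      block-change : G * M ≤ β → 9 * (s * s) * (b * b) ≤ M → s * b ≤ K →
        K * s * ∑ M (λ t → ℤ.∣ Sieveₜ.S X t 1 (R + β) ℤ.- Sieveₜ.S X t 1 R ∣) ≤ 3 * M * X
      block-change GM≤β M-large sb≤K = begin
        K * s * ∑ M (λ t → ℤ.∣ Sieveₜ.S X t 1 (R + β) ℤ.- Sieveₜ.S X t 1 R ∣)
          ≤⟨ *-monoʳ-≤ (K * s) (∑-mono M (λ t _ → ≤-trans (Sieveₜ.Block.∣block∣≤ X t R β) (+-monoˡ-≤ rest (drop-0 t)))) ⟩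
        K * s * ∑ M (λ t → ∑ Z₁ (λ m → ℤ.∣ v t m ∣) + rest)
          ≡⟨ cong (K * s *_) (trans (∑-+ M) (cong (_+_ (∑ M (λ t → ∑ Z₁ (λ m → ℤ.∣ v t m ∣)))) (∑-const M rest))) ⟩
        K * s * (∑ M (λ t → ∑ Z₁ (λ m → ℤ.∣ v t m ∣)) + M * rest)
          ≡⟨ lemma₁ K s (∑ M (λ t → ∑ Z₁ (λ m → ℤ.∣ v t m ∣))) M rest ⟩
        K * (s * ∑ M (λ t → ∑ Z₁ (λ m → ℤ.∣ v t m ∣))) + M * (K * s * rest)
          ≤⟨ +-mono-≤ (*-monoʳ-≤ K (dispersion GM≤β M-large)) (*-monoʳ-≤ M rest≤) ⟩
        K * (Z₁ * β * M) + M * X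
          ≡⟨ cong (_+ M * X) (lemma₂ K Z₁ β M) ⟩
        M * (Z₁ * (K * β)) + M * X
          ≤⟨ +-monoˡ-≤ (M * X) (*-monoʳ-≤ M (≤-trans (*-monoʳ-≤ Z₁ Kβ≤R) Z₁R≤)) ⟩
        M * (2 * X) + M * X
          ≡⟨ lemma₃ M X ⟩
        3 * M * X ∎
        where
        open ≤-Reasoning
        instance
          R*R≢0 : NonZero (R * R)
          R*R≢0 = m*n≢0 R R
        rest = β * (β * (X / (R * R) * b))
        lemma₁ : ∀ k s a m r → k * s * (a + m * r) ≡ k * (s * a) + m * (k * s * r)
        lemma₁ = solve-∀
        lemma₂ : ∀ k z β m → k * (z * β * m) ≡ m * (z * (k * β))
        lemma₂ = solve-∀
        lemma₃ : ∀ m x → m * (2 * x) + m * x ≡ 3 * m * x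
        lemma₃ = solve-∀
        drop-0 : ∀ t → ∑ (X / R) (λ j → ℤ.∣ v t (suc j) ∣) ≤ ∑ Z₁ (λ m → ℤ.∣ v t m ∣)
        drop-0 t = ≤-trans (m≤n+m _ ℤ.∣ v t 0 ∣) (≤-reflexive (sym (∑-split 1 (X / R))))
        Z₁R≤ : Z₁ * R ≤ 2 * X
        Z₁R≤ = begin
          R + X / R * R  ≤⟨ +-mono-≤ (≤-trans (m≤m*n R R) R²≤X) (m/n*n≤m X R) ⟩
          X + X  ≡⟨ cong (_+_ X) (sym (+-identityʳ X)) ⟩
          2 * X  ∎
        rest≤ : K * s * rest ≤ X
        rest≤ = *-cancelˡ-≤ K (begin
          K * (K * s * (β * (β * (X / (R * R) * b))))  ≡⟨ lemma₄ K s β (X / (R * R)) b ⟩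
          X / (R * R) * (K * β * (K * β)) * (s * b)  ≤⟨ *-mono-≤ (*-monoʳ-≤ (X / (R * R)) (*-mono-≤ Kβ≤R Kβ≤R)) sb≤K ⟩
          X / (R * R) * (R * R) * K  ≤⟨ *-monoˡ-≤ K (m/n*n≤m X (R * R)) ⟩
          X * K  ≡⟨ *-comm X K ⟩
          K * X  ∎)
          where
          lemma₄ : ∀ k s β x b → k * (k * s * (β * (β * (x * b)))) ≡ x * (k * β * (k * β)) * (s * b)
          lemma₄ = solve-∀

-- From sieved sums to equidistribution over primes

∃-prime-divisor : ∀ n → 2 ≤ n → ∃[ p ] (Prime p × p ∣ n)
∃-prime-divisor = <-rec _ go
  where
  go : ∀ n → (∀ {m} → m < n → 2 ≤ m → ∃[ p ] (Prime p × p ∣ m)) → 2 ≤ n → ∃[ p ] (Prime p × p ∣ n)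
  go n rec 2≤n with prime? n
  ... | yes pn = n , pn , ∣-refl
  ... | no ¬pn with ¬prime⇒composite {{n>1⇒nonTrivial 2≤n}} ¬pn
  ...   | hasNonTrivialDivisor {d} d<n d∣n with rec d<n (nonTrivial⇒n>1 d)
  ...     | p , pp , p∣d = p , pp , ∣-trans p∣d d∣n

-- A composite n < y² has a prime factor below y. The lower bound y < n is needed because `rough y`
-- also removes the primes up to y themselves.
rough≡isPrime : ∀ y n → 1 ≤ y → y < n → n < y * y → rough y n ≡ isPrime n
rough≡isPrime y n 1≤y y<n n<y² with prime? n
... | yes pn = rough-true y n (λ p pp p≤y p∣n → <⇒≢ (≤-<-trans p≤y y<n) (prime∣prime⇒≡ pp pn p∣n))
... | no ¬pn with rough y n in eq
...   | false = refl
...   | true  = ⊥-elim (¬pn (rough∧square>⇒prime {{n>1⇒nonTrivial (≤-<-trans 1≤y y<n)}} y-rough n<y²))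
  where
  y-rough : y Rough n
  y-rough (hasNonTrivialDivisor {d} d<y d∣n) with ∃-prime-divisor d (nonTrivial⇒n>1 d)
  ... | p , pp , p∣d with trans (sym eq) (rough-false y n p pp (≤-trans (∣⇒≤ {{nonTrivial⇒nonZero d}} p∣d) (<⇒≤ d<y)) (∣-trans p∣d d∣n))
  ...   | ()

∣when-when∣≤ : ∀ x c d → ℤ.∣ (x when c) ℤ.- (x when d) ∣ ≤ ℤ.∣ x ∣
∣when-when∣≤ x true  true  = ≤-trans (≤-reflexive (cong ℤ.∣_∣ (ℤP.+-inverseʳ x))) z≤n
∣when-when∣≤ x true  false = ≤-reflexive (cong ℤ.∣_∣ (ℤP.+-identityʳ x))
∣when-when∣≤ x false true  = ≤-reflexive (trans (cong ℤ.∣_∣ (ℤP.+-identityˡ (ℤ.- x))) (ℤP.∣-i∣≡∣i∣ x))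
∣when-when∣≤ x false false = z≤n

primeSum : (ℕ → ℤ) → ℕ → ℤ
primeSum f X = ∑ᶻ X (λ i → f (suc i) when isPrime (suc i))

∑-threshold : ∀ n y b {f : ℕ → ℕ} → (∀ i → f i ≤ b) → (∀ i → y ≤ i → i < n → f i ≡ 0) → ∑ n f ≤ y * b
∑-threshold zero    y b bd vanish = z≤n
∑-threshold (suc n) y b {f} bd vanish with y ≤? n
... | yes y≤n = ≤-trans (≤-reflexive (trans (cong (_+_ (∑ n f)) (vanish n y≤n ≤-refl)) (+-identityʳ _))) (∑-threshold n y b bd (λ i y≤i i<n → vanish i y≤i (m<n⇒m<1+n i<n)))
... | no y≰n  = ≤-trans (∑-≤-const (suc n) b (λ i _ → bd i)) (*-monoˡ-≤ b (≰⇒> y≰n))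

-- Primality and roughness agree above y; the arguments up to y are estimated trivially.
primeSum-sieve : ∀ f b (∣f∣≤b : ∀ n → ℤ.∣ f n ∣ ≤ b) X y → 1 ≤ y → X < y * y →
  ℤ.∣ primeSum f X ℤ.- Sieve.S f b ∣f∣≤b X 1 y ∣ ≤ y * b
primeSum-sieve f b ∣f∣≤b X y 1≤y X<y² = begin
  ℤ.∣ primeSum f X ℤ.- Sieve.S f b ∣f∣≤b X 1 y ∣
    ≡⟨ cong (λ s → ℤ.∣ primeSum f X ℤ.- s ∣) (trans (cong (λ n → ∑ᶻ n (λ i → f (1 * suc i) when rough y (suc i))) (n/1≡n X)) (∑ᶻ-cong X (λ i _ → cong (λ n → f n when rough y (suc i)) (*-identityˡ (suc i))))) ⟩
  ℤ.∣ primeSum f X ℤ.- ∑ᶻ X (λ i → f (suc i) when rough y (suc i)) ∣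
    ≡⟨ cong ℤ.∣_∣ (sym (∑ᶻ-- X)) ⟩
  ℤ.∣ ∑ᶻ X (λ i → (f (suc i) when isPrime (suc i)) ℤ.- (f (suc i) when rough y (suc i))) ∣
    ≤⟨ ∣∑ᶻ∣≤∑∣∣ X ⟩
  ∑ X (λ i → ℤ.∣ (f (suc i) when isPrime (suc i)) ℤ.- (f (suc i) when rough y (suc i)) ∣)
    ≤⟨ ∑-threshold X y b (λ i → ≤-trans (∣when-when∣≤ (f (suc i)) (isPrime (suc i)) (rough y (suc i))) (∣f∣≤b (suc i)))
         (λ i y≤i i<X → cong ℤ.∣_∣ (trans (cong (λ c → (f (suc i) when isPrime (suc i)) ℤ.- (f (suc i) when c)) (rough≡isPrime y (suc i) 1≤y (s≤s y≤i) (≤-<-trans i<X X<y²))) (ℤP.+-inverseʳ (f (suc i) when isPrime (suc i))))) ⟩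
  y * b ∎
  where open ≤-Reasoning

module Levels (K X : ℕ) {{K≢0 : NonZero K}} where

  -- Past √X the level stays put, so surplus iterations are harmless and the last level is still at
  -- most 2√X.
  next : ℕ → ℕ
  next R = if (R * R) ≤ᵇ X then R + R / K else R

  iter : ℕ → ℕ → ℕ
  iter zero    R = R
  iter (suc n) R = iter n (next R)

  next-≤ : ∀ R → R * R ≤ X → next R ≡ R + R / K
  next-≤ R le with (R * R) ≤ᵇ X | ≤⇒≤ᵇ le
  ... | true | _ = refl

  next-> : ∀ R → X < R * R → next R ≡ R
  next-> R gt with (R * R) ≤ᵇ X in eq
  ... | false = refl
  ... | true  = ⊥-elim (<⇒≱ gt (≤ᵇ⇒≤ (R * R) X (subst T (sym eq) _)))

  R≤next : ∀ R → R ≤ next R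
  R≤next R with (R * R) ≤ᵇ X
  ... | true  = m≤m+n R (R / K)
  ... | false = ≤-refl

  R≤iter : ∀ n R → R ≤ iter n R
  R≤iter zero    R = ≤-refl
  R≤iter (suc n) R = ≤-trans (R≤next R) (R≤iter n (next R))

  iter-> : ∀ n R → X < R * R → iter n R ≡ R
  iter-> zero    R gt = refl
  iter-> (suc n) R gt = trans (cong (iter n) (next-> R gt)) (iter-> n R gt)

  iter-+ : ∀ m n R → iter (m + n) R ≡ iter n (iter m R)
  iter-+ zero    n R = refl
  iter-+ (suc m) n R = iter-+ m n (next R)

  iter²≤4X : ∀ n R → R * R ≤ X → iter n R * iter n R ≤ 4 * X
  iter²≤4X n R R²≤X = go n R (≤-trans R²≤X (m≤n*m X 4))
    where
    lemma : ∀ r → (r + r) * (r + r) ≡ 4 * (r * r)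
    lemma = solve-∀
    go : ∀ n R → R * R ≤ 4 * X → iter n R * iter n R ≤ 4 * X
    go zero    R le = le
    go (suc n) R le with R * R ≤? X
    ... | yes R²≤X rewrite next-≤ R R²≤X = go n (R + R / K) (≤-trans (*-mono-≤ (+-monoʳ-≤ R (m/n≤m R K)) (+-monoʳ-≤ R (m/n≤m R K))) (≤-trans (≤-reflexive (lemma R)) (*-monoʳ-≤ 4 R²≤X)))
    ... | no R²≰X rewrite next-> R (≰⇒> R²≰X) = go n R le

  grow : ∀ n R β → β ≤ R / K → X < iter n R * iter n R ⊎ R + n * β ≤ iter n R
  grow zero    R β le = inj₂ (≤-reflexive (+-identityʳ R))
  grow (suc n) R β le with R * R ≤? X
  ... | no R²≰X = inj₁ (subst (λ r → X < r * r) (sym (iter-> (suc n) R (≰⇒> R²≰X))) (≰⇒> R²≰X))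
  ... | yes R²≤X rewrite next-≤ R R²≤X with grow n (R + R / K) β (≤-trans le (/-monoˡ-≤ K (m≤m+n R (R / K))))
  ...   | inj₁ gt = inj₁ gt
  ...   | inj₂ ge = inj₂ (≤-trans (≤-trans (+-monoʳ-≤ R (+-monoˡ-≤ (n * β) le)) (≤-reflexive (sym (+-assoc R (R / K) (n * β))))) ge)

  -- Each of the 2K steps adds at least ⌊R/K⌋ ≥ 1, and 2K ⌊R/K⌋ ≥ R because R ≥ K.
  double : ∀ R → K ≤ R → X < iter (2 * K) R * iter (2 * K) R ⊎ 2 * R ≤ iter (2 * K) R
  double R K≤R with grow (2 * K) R (R / K) ≤-refl
  ... | inj₁ gt = inj₁ gt
  ... | inj₂ ge = inj₂ (≤-trans (+-monoʳ-≤ R (≤-trans (≤-reflexive (+-identityʳ R)) (begin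
      R  ≤⟨ <⇒≤ (<suc/* R K) ⟩
      K + R / K * K  ≤⟨ +-monoˡ-≤ _ (≤-trans (≤-reflexive (sym (*-identityˡ K))) (*-monoˡ-≤ K (*≤⇒≤/ 1 K R (≤-trans (≤-reflexive (*-identityˡ K)) K≤R)))) ⟩
      R / K * K + R / K * K  ≡⟨ lemma (R / K) K ⟩
      2 * K * (R / K)  ∎))) ge)
    where
    open ≤-Reasoning
    lemma : ∀ q k → q * k + q * k ≡ 2 * k * q
    lemma = solve-∀

  reach : ∀ L R → K ≤ R → X < iter (L * (2 * K)) R * iter (L * (2 * K)) R ⊎ 2 ^ L * R ≤ iter (L * (2 * K)) R
  reach zero    R K≤R = inj₂ (≤-reflexive (+-identityʳ R))
  reach (suc L) R K≤R rewrite iter-+ (2 * K) (L * (2 * K)) R with double R K≤R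
  ... | inj₁ gt = inj₁ (subst (λ r → X < r * r) (sym (iter-> (L * (2 * K)) _ gt)) gt)
  ... | inj₂ ge with reach L (iter (2 * K) R) (≤-trans K≤R (R≤iter (2 * K) R))
  ...   | inj₁ gt = inj₁ gt
  ...   | inj₂ ge′ = inj₂ (≤-trans (≤-trans (≤-reflexive (lemma (2 ^ L) R)) (*-monoʳ-≤ (2 ^ L) ge)) ge′)
    where
    lemma : ∀ e r → 2 * e * r ≡ e * (2 * r)
    lemma = solve-∀

  reach-√X : ∀ L R → K ≤ R → X < 2 ^ L * 2 ^ L → X < iter (L * (2 * K)) R * iter (L * (2 * K)) R
  reach-√X L R K≤R X< with reach L R K≤R
  ... | inj₁ gt = gt
  ... | inj₂ ge = <-≤-trans X< (*-mono-≤ le le)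
    where
    le : 2 ^ L ≤ iter (L * (2 * K)) R
    le = ≤-trans (m≤m*n (2 ^ L) R {{>-nonZero (≤-trans (>-nonZero⁻¹ K) K≤R)}}) ge

module Equidistribution {k : ℕ} (2≤k : 2 ≤ k) (b w N K z₀ s L W r X : ℕ)
  {{b≢0 : NonZero b}} {{w≢0 : NonZero w}} {{N≢0 : NonZero N}} {{K≢0 : NonZero K}} where

  open Shifts k b w N
  open Levels K X

  private
    c = k * 2 ^ k
    1≤k : 1 ≤ k
    1≤k = <⇒≤ 2≤k

  S : ℕ → ℕ → ℤ
  S t z = Sieveₜ.S X t 1 z

  module _ (2≤z₀ : 2 ≤ z₀) (z₀²≤X : z₀ * z₀ ≤ X) (KM≤z₀ : K * M ≤ z₀)
    (M-large : 9 * (s * s) * (b * b) ≤ M) (sb≤K : s * b ≤ K)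
    (K-large : M * (M * b) * (4 * c + 40 * N) ≤ K)
    (X-large : 2 * (2 * (8 * K * M * c) * K) ^ k * (2 * (2 * (8 * K * M * c) * K) ^ k) ≤ X) where

    private
      H = 2 * (2 * (8 * K * M * c) * K) ^ k

    level : ∀ R → z₀ ≤ R → K * s * ∑ M (λ t → ℤ.∣ S t (next R) ℤ.- S t R ∣) ≤ 3 * M * X
    level R z₀≤R with R * R ≤? X
    ... | no R²≰X rewrite next-> R (≰⇒> R²≰X) = ≤-trans (≤-reflexive (trans (cong (K * s *_) (∑-0 M (λ t _ → cong ℤ.∣_∣ (ℤP.+-inverseʳ (S t R))))) (*-zeroʳ (K * s)))) z≤n
    ... | yes R²≤X rewrite next-≤ R R²≤X =
      Dispersion.block-change 2≤k b w N K X R β G (8 * K * M) s {{R≢0 = R≢0}} (≤-trans 2≤z₀ z₀≤R) R²≤X Kβ≤R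
        (*≤⇒≤/ 1 M β (≤-trans (≤-reflexive (*-identityˡ M)) M≤β)) 2R≤ K-large X≥ (m/n*n≤m β M) M-large sb≤K
      where
      open ≤-Reasoning
      β = R / K
      G = β / M
      R≢0 : NonZero R
      R≢0 = >-nonZero (≤-trans (s≤s z≤n) (≤-trans 2≤z₀ z₀≤R))
      Kβ≤R : K * β ≤ R
      Kβ≤R = ≤-trans (≤-reflexive (*-comm K β)) (m/n*n≤m R K)
      M≤β : M ≤ β
      M≤β = *≤⇒≤/ M K R (≤-trans (≤-reflexive (*-comm M K)) (≤-trans KM≤z₀ z₀≤R))
      double-quotient : ∀ a d {{_ : NonZero d}} → d ≤ a → a ≤ 2 * d * (a / d)
      double-quotient a d d≤a = begin
        a  ≤⟨ <⇒≤ (<suc/* a d) ⟩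
        d + a / d * d  ≤⟨ +-monoˡ-≤ _ (≤-trans (≤-reflexive (sym (*-identityˡ d))) (*-monoˡ-≤ d (*≤⇒≤/ 1 d a (≤-trans (≤-reflexive (*-identityˡ d)) d≤a)))) ⟩
        a / d * d + a / d * d  ≡⟨ lemma (a / d) d ⟩
        2 * d * (a / d)  ∎
        where
        lemma : ∀ q k → q * k + q * k ≡ 2 * k * q
        lemma = solve-∀
      -- Each of the two roundings in G = ⌊⌊R/K⌋/M⌋ loses at most a factor 2, so C = 2 · 2K · 2M.
      2R≤ : 2 * R ≤ 8 * K * M * G
      2R≤ = begin
        2 * R  ≤⟨ *-monoʳ-≤ 2 (double-quotient R K (≤-trans (m≤m*n K M) (≤-trans KM≤z₀ z₀≤R))) ⟩
        2 * (2 * K * β)  ≤⟨ *-monoʳ-≤ 2 (*-monoʳ-≤ (2 * K) (double-quotient β M M≤β)) ⟩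
        2 * (2 * K * (2 * M * G))  ≡⟨ lemma K M G ⟩
        8 * K * M * G  ∎
        where
        lemma : ∀ k m g → 2 * (2 * k * (2 * m * g)) ≡ 8 * k * m * g
        lemma = solve-∀
      -- The product of H ≤ √X and R ≤ √X.
      X≥ : (2 * (8 * K * M * c) * K) ^ k * (2 * R) ≤ X
      X≥ = square-cancel-≤ (begin
        (2 * (8 * K * M * c) * K) ^ k * (2 * R) * ((2 * (8 * K * M * c) * K) ^ k * (2 * R))  ≡⟨ lemma ((2 * (8 * K * M * c) * K) ^ k) R ⟩
        H * H * (R * R)  ≤⟨ *-mono-≤ X-large R²≤X ⟩
        X * X  ∎)
        where
        lemma : ∀ h r → h * (2 * r) * (h * (2 * r)) ≡ 2 * h * (2 * h) * (r * r)
        lemma = solve-∀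

    levels : ∀ n R → z₀ ≤ R → K * s * ∑ M (λ t → ℤ.∣ S t (iter n R) ℤ.- S t R ∣) ≤ n * (3 * M * X)
    levels zero    R z₀≤R = ≤-reflexive (trans (cong (K * s *_) (∑-0 M (λ t _ → cong ℤ.∣_∣ (ℤP.+-inverseʳ (S t R))))) (*-zeroʳ (K * s)))
    levels (suc n) R z₀≤R = begin
      K * s * ∑ M (λ t → ℤ.∣ S t (iter n R′) ℤ.- S t R ∣)
        ≤⟨ *-monoʳ-≤ (K * s) (≤-trans (∑-mono M (λ t _ → triangle (S t (iter n R′)) (S t R′) (S t R))) (≤-reflexive (∑-+ M))) ⟩
      K * s * (∑ M (λ t → ℤ.∣ S t R′ ℤ.- S t R ∣) + ∑ M (λ t → ℤ.∣ S t (iter n R′) ℤ.- S t R′ ∣))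
        ≡⟨ *-distribˡ-+ (K * s) _ _ ⟩
      K * s * ∑ M (λ t → ℤ.∣ S t R′ ℤ.- S t R ∣) + K * s * ∑ M (λ t → ℤ.∣ S t (iter n R′) ℤ.- S t R′ ∣)
        ≤⟨ +-mono-≤ (level R z₀≤R) (levels n R′ (≤-trans z₀≤R (R≤next R))) ⟩
      suc n * (3 * M * X) ∎
      where
      open ≤-Reasoning
      R′ = next R
      triangle : ∀ x y z → ℤ.∣ x ℤ.- z ∣ ≤ ℤ.∣ y ℤ.- z ∣ + ℤ.∣ x ℤ.- y ∣
      triangle x y z = ≤-trans (≤-reflexive (cong ℤ.∣_∣ (lemma x y z))) (ℤP.∣i+j∣≤∣i∣+∣j∣ (y ℤ.- z) (x ℤ.- y))
        where
        lemma : ∀ x y z → x ℤ.- z ≡ (y ℤ.- z) ℤ.+ (x ℤ.- y)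
        lemma = solve-∀ᶻ

    J : ℕ
    J = A X

    module _ (1≤X : 1 ≤ X) (t : ℕ) where

      private
        instance
          J⁺≢0 : NonZero J
          J⁺≢0 = >-nonZero (iroot-pos k _ 1≤k (*-mono-≤ (>-nonZero⁻¹ (N ^ k) {{m^n≢0 N k}}) 1≤X))

      -- Along the multiples of d the phase N (d m)^(1/k) is itself of the form treated by `Cells`,
      -- with U = 1 and V = N^k d, so no average over t is needed. The bound is uniform in d because
      -- J = `A X` dominates the last phase for every d.
      typeI-bound : ∀ Y → 4 * c * X + 5 * (J * J) ≤ J * Y → ∀ d {{_ : NonZero d}} → ℤ.∣ Sieveₜ.S X t d 0 ∣ ≤ M * b * Y + 2 * b
      typeI-bound Y JY d = begin
        ℤ.∣ ∑ᶻ Z (λ i → g (E (suc i))) ∣  ≡⟨ cong ℤ.∣_∣ shift ⟩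
        ℤ.∣ ∑ᶻ Z (g ∘ E) ℤ.+ (g (E Z) ℤ.- g (E 0)) ∣  ≤⟨ ≤-trans (ℤP.∣i+j∣≤∣i∣+∣j∣ (∑ᶻ Z (g ∘ E)) _) (+-mono-≤ sum≤ ends≤) ⟩
        M * b * Y + 2 * b  ∎
        where
        open ≤-Reasoning
        Z = X / d
        V = N ^ k * d
        E : ℕ → ℕ
        E m = A (d * m)
        g : ℕ → ℤ
        g a = φ (a + t)
        instance
          V≢0 : NonZero V
          V≢0 = m*n≢0 (N ^ k) d {{m^n≢0 N k}}
        shift : ∑ᶻ Z (λ i → g (E (suc i))) ≡ ∑ᶻ Z (g ∘ E) ℤ.+ (g (E Z) ℤ.- g (E 0))
        shift = +ᶻ-cancelˡ (g (E 0)) (trans (sym (∑ᶻ-head Z {g ∘ E})) (lemma (∑ᶻ Z (g ∘ E)) (g (E Z)) (g (E 0))))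
          where
          lemma : ∀ a e h → a ℤ.+ e ≡ h ℤ.+ (a ℤ.+ (e ℤ.- h))
          lemma = solve-∀ᶻ
        ends≤ : ℤ.∣ g (E Z) ℤ.- g (E 0) ∣ ≤ 2 * b
        ends≤ = ≤-trans (ℤP.∣i-j∣≤∣i∣+∣j∣ (g (E Z)) (g (E 0))) (≤-trans (+-mono-≤ (∣φ∣≤b (E Z + t)) (∣φ∣≤b (E 0 + t))) (≤-reflexive (cong (_+_ b) (sym (+-identityʳ b)))))
        E-lower : ∀ m → 1 * E m ^ k ≤ V * m
        E-lower m = ≤-trans (≤-reflexive (*-identityˡ _)) (≤-trans (iroot-lower k (N ^ k * (d * m)) 1≤k) (≤-reflexive (sym (*-assoc (N ^ k) d m))))
        E-upper : ∀ m → V * m < 1 * suc (E m) ^ k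
        E-upper m = ≤-<-trans (≤-reflexive (*-assoc (N ^ k) d m)) (<-≤-trans (iroot-upper k (N ^ k * (d * m)) 1≤k) (≤-reflexive (sym (*-identityˡ _))))
        EZ≤J : E Z ≤ J
        EZ≤J = iroot-mono k 1≤k (*-monoʳ-≤ (N ^ k) (≤-trans (≤-reflexive (*-comm d Z)) (m/n*n≤m X d)))
        sum≤ : ℤ.∣ ∑ᶻ Z (g ∘ E) ∣ ≤ M * b * Y
        sum≤ = *-cancelˡ-≤ (V * J) {{m*n≢0 V J}} (begin
          V * J * ℤ.∣ ∑ᶻ Z (g ∘ E) ∣  ≤⟨ Cells.V-J-∣sum∣≤ k 1 V 1≤k E E-lower E-upper g (M * b) (φ-partial-sums t) Z J (>-nonZero⁻¹ J) EZ≤J ⟩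
          M * b * (4 * c * (1 * J ^ k) + 5 * V * (J * J))  ≤⟨ *-monoʳ-≤ (M * b) (+-monoˡ-≤ _ (*-monoʳ-≤ (4 * c) J^k≤)) ⟩
          M * b * (4 * c * (V * X) + 5 * V * (J * J))  ≡⟨ lemma₁ (M * b) c V X (J * J) ⟩
          M * b * V * (4 * c * X + 5 * (J * J))  ≤⟨ *-monoʳ-≤ (M * b * V) JY ⟩
          M * b * V * (J * Y)  ≡⟨ lemma₂ (M * b) V J Y ⟩
          V * J * (M * b * Y)  ∎)
          where
          lemma₁ : ∀ m c v x j → m * (4 * c * (v * x) + 5 * v * j) ≡ m * v * (4 * c * x + 5 * j)
          lemma₁ = solve-∀
          lemma₂ : ∀ m v j y → m * v * (j * y) ≡ v * j * (m * y)
          lemma₂ = solve-∀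
          J^k≤ : 1 * J ^ k ≤ V * X
          J^k≤ = ≤-trans (≤-reflexive (*-identityˡ _)) (≤-trans (iroot-lower k (N ^ k * X) 1≤k) (*-monoˡ-≤ X (m≤m*n (N ^ k) d)))

    module _ (Y : ℕ) (1≤X : 1 ≤ X) (JY : 4 * c * X + 5 * (J * J) ≤ J * Y)
      (tail-small : W * b * (suc z₀ * suc (suc z₀)) ≤ 2 ^ r * 2)
      (main-small : W * (suc z₀ ^ r * (M * b * Y + 2 * b)) ≤ X)
      (X<4^L : X < 2 ^ L * 2 ^ L) (s-large : 6 * L * W ≤ s) (root-small : 2 * b * W * (2 * b * W) ≤ X) where

      sieved-small : ∀ t → W * ℤ.∣ S t z₀ ∣ ≤ 2 * X
      sieved-small t = begin
        W * ℤ.∣ S t z₀ ∣  ≤⟨ *-monoʳ-≤ W (proj₁ (proj₂ leg)) ⟩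
        W * (main + tail)  ≡⟨ *-distribˡ-+ W main tail ⟩
        W * main + W * tail  ≤⟨ +-mono-≤ main-small tail≤ ⟩
        X + X  ≡⟨ cong (_+_ X) (sym (+-identityʳ X)) ⟩
        2 * X  ∎
        where
        open ≤-Reasoning
        leg = Sieveₜ.legendre X t {M * b * Y + 2 * b} (λ d → typeI-bound 1≤X t Y JY d) z₀ r 1
        tail = proj₁ leg
        main = suc z₀ ^ r * (M * b * Y + 2 * b)
        tail≤ : W * tail ≤ X
        tail≤ = *-cancelˡ-≤ (2 ^ r * 2) {{m*n≢0 (2 ^ r) 2 {{m^n≢0 2 r}}}} (begin
          2 ^ r * 2 * (W * tail)  ≡⟨ lemma₁ (2 ^ r) W tail ⟩
          W * (2 ^ r * 1 * tail * 2)  ≤⟨ *-monoʳ-≤ W (proj₂ (proj₂ leg)) ⟩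
          W * (b * X * (suc z₀ * suc (suc z₀)))  ≡⟨ lemma₂ W b X (suc z₀ * suc (suc z₀)) ⟩
          W * b * (suc z₀ * suc (suc z₀)) * X  ≤⟨ *-monoˡ-≤ X tail-small ⟩
          2 ^ r * 2 * X  ∎)
          where
          lemma₁ : ∀ e w t → e * 2 * (w * t) ≡ w * (e * 1 * t * 2)
          lemma₁ = solve-∀
          lemma₂ : ∀ w b x z → w * (b * x * z) ≡ w * b * z * x
          lemma₂ = solve-∀

      -- The 4 is 1 for arguments up to y, 1 for the blocks and 2 for Legendre's sieve. The blocks
      -- number 2 K L and cost 3 M X / (K s) each; K cancels, and s ≥ 6 L W beats the logarithmic
      -- number L of doublings.
      equidistribution : W * ∑ M (λ t → ℤ.∣ primeSum (f t) X ∣) ≤ 4 * M * X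
      equidistribution = begin
        W * ∑ M (λ t → ℤ.∣ primeSum (f t) X ∣)
          ≤⟨ *-monoʳ-≤ W (≤-trans (∑-mono M (λ t _ → pointwise t)) (≤-reflexive (trans (∑-+ M) (cong₂ _+_ (∑-const M (y * b)) (∑-+ M))))) ⟩
        W * (M * (y * b) + (∑ M (λ t → ℤ.∣ S t y ℤ.- S t z₀ ∣) + ∑ M (λ t → ℤ.∣ S t z₀ ∣)))
          ≡⟨ lemma₁ W M (y * b) (∑ M (λ t → ℤ.∣ S t y ℤ.- S t z₀ ∣)) (∑ M (λ t → ℤ.∣ S t z₀ ∣)) ⟩
        M * (W * (y * b)) + W * ∑ M (λ t → ℤ.∣ S t y ℤ.- S t z₀ ∣) + W * ∑ M (λ t → ℤ.∣ S t z₀ ∣)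
          ≤⟨ +-mono-≤ (+-mono-≤ (*-monoʳ-≤ M root≤) blocks≤) sieved≤ ⟩
        M * X + M * X + M * (2 * X)
          ≡⟨ lemma₂ M X ⟩
        4 * M * X ∎
        where
        open ≤-Reasoning
        n = L * (2 * K)
        y = iter n z₀
        1≤y : 1 ≤ y
        1≤y = ≤-trans (≤-trans (s≤s z≤n) 2≤z₀) (R≤iter n z₀)
        X<y² : X < y * y
        X<y² = reach-√X L z₀ (≤-trans (m≤m*n K M) KM≤z₀) X<4^L
        lemma₁ : ∀ w m y a c → w * (m * y + (a + c)) ≡ m * (w * y) + w * a + w * c
        lemma₁ = solve-∀
        lemma₂ : ∀ m x → m * x + m * x + m * (2 * x) ≡ 4 * m * x
        lemma₂ = solve-∀
        split : ∀ x y z → x ≡ (x ℤ.- y) ℤ.+ ((y ℤ.- z) ℤ.+ z)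
        split = solve-∀ᶻ
        pointwise : ∀ t → ℤ.∣ primeSum (f t) X ∣ ≤ y * b + (ℤ.∣ S t y ℤ.- S t z₀ ∣ + ℤ.∣ S t z₀ ∣)
        pointwise t = begin
          ℤ.∣ primeSum (f t) X ∣
            ≡⟨ cong ℤ.∣_∣ (split (primeSum (f t) X) (S t y) (S t z₀)) ⟩
          ℤ.∣ (primeSum (f t) X ℤ.- S t y) ℤ.+ ((S t y ℤ.- S t z₀) ℤ.+ S t z₀) ∣
            ≤⟨ ≤-trans (ℤP.∣i+j∣≤∣i∣+∣j∣ (primeSum (f t) X ℤ.- S t y) _) (+-mono-≤ (primeSum-sieve (f t) b (∣f∣≤b t) X y 1≤y X<y²) (ℤP.∣i+j∣≤∣i∣+∣j∣ (S t y ℤ.- S t z₀) (S t z₀))) ⟩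
          y * b + (ℤ.∣ S t y ℤ.- S t z₀ ∣ + ℤ.∣ S t z₀ ∣) ∎
        sieved≤ : W * ∑ M (λ t → ℤ.∣ S t z₀ ∣) ≤ M * (2 * X)
        sieved≤ = ≤-trans (≤-reflexive (sym (∑-*ˡ M W))) (∑-≤-const M (2 * X) (λ t _ → sieved-small t))
        root≤ : W * (y * b) ≤ X
        root≤ = square-cancel-≤ (*-cancelˡ-≤ 4 (begin
          4 * (W * (y * b) * (W * (y * b)))  ≡⟨ lemma₃ W y b ⟩
          y * y * (2 * b * W * (2 * b * W))  ≤⟨ *-mono-≤ (iter²≤4X n z₀ z₀²≤X) root-small ⟩
          4 * X * X  ≡⟨ *-assoc 4 X X ⟩
          4 * (X * X)  ∎))
          where
          lemma₃ : ∀ w y b → 4 * (w * (y * b) * (w * (y * b))) ≡ y * y * (2 * b * w * (2 * b * w))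
          lemma₃ = solve-∀
        blocks≤ : W * ∑ M (λ t → ℤ.∣ S t y ℤ.- S t z₀ ∣) ≤ M * X
        blocks≤ with L ≟ 0 | W ≟ 0
        ... | _ | yes refl = z≤n
        ... | yes refl | no _ = ≤-trans (≤-reflexive (trans (cong (W *_) (∑-0 M (λ t _ → cong ℤ.∣_∣ (ℤP.+-inverseʳ (S t z₀))))) (*-zeroʳ W))) z≤n
        ... | no L≢0 | no W≢0 = *-cancelˡ-≤ (K * (6 * L)) {{m*n≢0 K (6 * L) {{it}} {{m*n≢0 6 L {{it}} {{≢-nonZero L≢0}}}}}} (begin
            K * (6 * L) * (W * D)  ≡⟨ lemma₃ K L W D ⟩
            K * (6 * L * W) * D  ≤⟨ *-monoˡ-≤ D (*-monoʳ-≤ K s-large) ⟩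
            K * s * D  ≤⟨ levels n z₀ ≤-refl ⟩
            L * (2 * K) * (3 * M * X)  ≡⟨ lemma₄ L K M X ⟩
            K * (6 * L) * (M * X)  ∎)
          where
          D = ∑ M (λ t → ℤ.∣ S t y ℤ.- S t z₀ ∣)
          it : ∀ {A : Set} {{_ : A}} → A
          it {{x}} = x
          lemma₃ : ∀ k l w d → k * (6 * l) * (w * d) ≡ k * (6 * l * w) * d
          lemma₃ = solve-∀
          lemma₄ : ∀ l k m x → l * (2 * k) * (3 * m * x) ≡ k * (6 * l) * (m * x)
          lemma₄ = solve-∀

-- Chebyshev's lower bound for the number of primes

binom : ℕ → ℕ → ℕ
binom n       zero    = 1
binom zero    (suc j) = 0
binom (suc n) (suc j) = binom n j + binom n (suc j)

binom-zero : ∀ n j → n < j → binom n j ≡ 0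
binom-zero zero    (suc j) _         = refl
binom-zero (suc n) (suc j) (s≤s n<j) = cong₂ _+_ (binom-zero n j n<j) (binom-zero n (suc j) (m<n⇒m<1+n n<j))

-- The relation (j + 1) C(n, j + 1) = (n - j) C(n, j) without subtraction.
suc*binom : ∀ n j → suc j * binom n (suc j) + j * binom n j ≡ n * binom n j
suc*binom zero    zero    = refl
suc*binom zero    (suc j) = cong₂ _+_ (*-zeroʳ j) (*-zeroʳ j)
suc*binom (suc n) zero    = trans (lemma (binom n 1)) (cong suc (trans (sym (trans (+-identityʳ (1 * binom n 1)) (*-identityˡ (binom n 1)))) (suc*binom n zero)))
  where
  lemma : ∀ x → 1 * (1 + x) + 0 ≡ suc x
  lemma = solve-∀
suc*binom (suc n) (suc j) = begin
  suc (suc j) * (b + c) + suc j * (a + b)  ≡⟨ lemma₁ j a b c ⟩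
  (suc (suc j) * c + suc j * b) + (suc j * b + j * a) + a + b  ≡⟨ cong₂ (λ x y → x + y + a + b) (suc*binom n (suc j)) (suc*binom n j) ⟩
  n * b + n * a + a + b  ≡⟨ lemma₂ n a b ⟩
  suc n * (a + b)  ∎
  where
  open ≡-Reasoning
  a = binom n j
  b = binom n (suc j)
  c = binom n (suc (suc j))
  lemma₁ : ∀ j a b c → suc (suc j) * (b + c) + suc j * (a + b) ≡ (suc (suc j) * c + suc j * b) + (suc j * b + j * a) + a + b
  lemma₁ = solve-∀
  lemma₂ : ∀ n a b → n * b + n * a + a + b ≡ suc n * (a + b)
  lemma₂ = solve-∀

-- Leibniz's harmonic triangle: 1/u(n,j) = 1/u(n-1,j) - 1/u(n,j+1) with u(n,j) = (n+1) binom n j.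
leibniz-∣ : ∀ L j n → j ≤ n → (∀ i → 1 ≤ i → i ≤ suc n → i ∣ L) → suc n * binom n j ∣ L
leibniz-∣ L zero    n       _         all = subst (_∣ L) (sym (*-identityʳ (suc n))) (all (suc n) (s≤s z≤n) ≤-refl)
-- Here α = L / u(n, j) and β = L / u(n + 1, j); the triangle relation makes α - β the quotient of L
-- by u(n + 1, j + 1). It is checked after multiplication by j + 1.
leibniz-∣ L (suc j) (suc n) (s≤s j≤n) all = divides (α ∸ β) (*-cancelˡ-≡ L _ (suc j) (sym (begin
    suc j * ((α ∸ β) * u)  ≡⟨ lemma₁ (suc j) (α ∸ β) u ⟩
    (α ∸ β) * (suc j * u)  ≡⟨ *-distribʳ-∸ (suc j * u) α β ⟩
    α * (suc j * u) ∸ β * (suc j * u)  ≡⟨ cong₂ _∸_ α-part β-part ⟩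
    suc (suc n) * L ∸ (suc n ∸ j) * L  ≡⟨ sym (*-distribʳ-∸ L (suc (suc n)) (suc n ∸ j)) ⟩
    (suc (suc n) ∸ (suc n ∸ j)) * L  ≡⟨ cong (_* L) (trans (cong (suc (suc n) ∸_) (+-∸-assoc 1 j≤n)) (trans (cong (_∸ (n ∸ j)) (sym (cong suc (m+[n∸m]≡n j≤n)))) (m+n∸n≡m (suc j) (n ∸ j)))) ⟩
    suc j * L  ∎)))
  where
  open ≡-Reasoning
  ih₁ = leibniz-∣ L j n j≤n (λ i 1≤i i≤ → all i 1≤i (m≤n⇒m≤1+n i≤))
  ih₂ = leibniz-∣ L j (suc n) (m≤n⇒m≤1+n j≤n) all
  α = quotient ih₁
  β = quotient ih₂
  u = suc (suc n) * binom (suc n) (suc j)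
  lemma₁ : ∀ a b c → a * (b * c) ≡ b * (a * c)
  lemma₁ = solve-∀
  down : suc j * binom (suc n) (suc j) ≡ (suc n ∸ j) * binom (suc n) j
  down = +-cancelʳ-≡ (j * binom (suc n) j) _ _ (trans (suc*binom (suc n) j) (trans (cong (_* binom (suc n) j) (sym (m∸n+n≡m (m≤n⇒m≤1+n j≤n)))) (*-distribʳ-+ (binom (suc n) j) (suc n ∸ j) j)))
  absorb : suc j * binom (suc n) (suc j) ≡ suc n * binom n j
  absorb = trans (lemma₂ (suc j) (binom n j) (binom n (suc j))) (trans (lemma₃ j (binom n j) (binom n (suc j))) (cong (_+_ (binom n j)) (suc*binom n j)))
    where
    lemma₂ : ∀ s a b → s * (a + b) ≡ s * a + s * b
    lemma₂ = solve-∀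
    lemma₃ : ∀ j a b → suc j * a + suc j * b ≡ a + (suc j * b + j * a)
    lemma₃ = solve-∀
  α-part : α * (suc j * u) ≡ suc (suc n) * L
  α-part = begin
    α * (suc j * u)  ≡⟨ lemma₂ α (suc j) (suc (suc n)) (binom (suc n) (suc j)) ⟩
    suc (suc n) * (α * (suc j * binom (suc n) (suc j)))  ≡⟨ cong (λ x → suc (suc n) * (α * x)) absorb ⟩
    suc (suc n) * (α * (suc n * binom n j))  ≡⟨ cong (suc (suc n) *_) (sym (m∣n⇒n≡quotient*m ih₁)) ⟩
    suc (suc n) * L  ∎
    where
    lemma₂ : ∀ a s n b → a * (s * (n * b)) ≡ n * (a * (s * b))
    lemma₂ = solve-∀
  β-part : β * (suc j * u) ≡ (suc n ∸ j) * L
  β-part = begin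
    β * (suc j * u)  ≡⟨ lemma₂ β (suc j) (suc (suc n)) (binom (suc n) (suc j)) ⟩
    β * (suc (suc n) * (suc j * binom (suc n) (suc j)))  ≡⟨ cong (λ x → β * (suc (suc n) * x)) down ⟩
    β * (suc (suc n) * ((suc n ∸ j) * binom (suc n) j))  ≡⟨ lemma₄ β (suc (suc n)) (suc n ∸ j) (binom (suc n) j) ⟩
    (suc n ∸ j) * (β * (suc (suc n) * binom (suc n) j))  ≡⟨ cong ((suc n ∸ j) *_) (sym (m∣n⇒n≡quotient*m ih₂)) ⟩
    (suc n ∸ j) * L  ∎
    where
    lemma₂ : ∀ a s n b → a * (s * (n * b)) ≡ a * (n * (s * b))
    lemma₂ = solve-∀
    lemma₄ : ∀ a n m b → a * (n * (m * b)) ≡ m * (a * (n * b))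
    lemma₄ = solve-∀

sum-binom : ∀ n → ∑ (suc n) (binom n) ≡ 2 ^ n
sum-binom zero    = refl
sum-binom (suc n) = begin
  ∑ (suc (suc n)) (binom (suc n))  ≡⟨ ∑-split 1 (suc n) ⟩
  1 + ∑ (suc n) (λ j → binom n j + binom n (suc j))  ≡⟨ cong suc (∑-+ (suc n)) ⟩
  1 + (∑ (suc n) (binom n) + ∑ (suc n) (λ j → binom n (suc j)))  ≡⟨ lemma (∑ (suc n) (binom n)) (∑ (suc n) (λ j → binom n (suc j))) ⟩
  ∑ (suc n) (binom n) + (1 + ∑ (suc n) (λ j → binom n (suc j)))  ≡⟨ cong (_+_ (∑ (suc n) (binom n))) (trans (sym (∑-split 1 (suc n) {binom n})) (trans (cong (_+_ (∑ (suc n) (binom n))) (binom-zero n (suc n) ≤-refl)) (+-identityʳ _))) ⟩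
  ∑ (suc n) (binom n) + ∑ (suc n) (binom n)  ≡⟨ cong₂ _+_ (sum-binom n) (trans (sum-binom n) (sym (+-identityʳ (2 ^ n)))) ⟩
  2 ^ suc n  ∎
  where
  open ≡-Reasoning
  lemma : ∀ a b → 1 + (a + b) ≡ a + (1 + b)
  lemma = solve-∀

-- All n + 1 entries (n + 1) C(n, j) of a row of Leibniz's triangle divide L, and they add up to (n
-- + 1) 2^n.
common-multiple-large : ∀ L n → 1 ≤ L → (∀ i → 1 ≤ i → i ≤ suc n → i ∣ L) → 2 ^ n ≤ L
common-multiple-large L n 1≤L all = *-cancelˡ-≤ (suc n) (begin
  suc n * 2 ^ n  ≡⟨ cong (suc n *_) (sym (sum-binom n)) ⟩
  suc n * ∑ (suc n) (binom n)  ≡⟨ sym (∑-*ˡ (suc n) (suc n)) ⟩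
  ∑ (suc n) (λ j → suc n * binom n j)  ≤⟨ ∑-≤-const (suc n) L (λ j j< → ∣⇒≤ {{>-nonZero 1≤L}} (leibniz-∣ L j n (≤-pred j<) all)) ⟩
  suc n * L  ∎)
  where open ≤-Reasoning

power-split : ∀ p → 2 ≤ p → ∀ d → 1 ≤ d → ∃[ a ] ∃[ d′ ] (d ≡ p ^ a * d′ × ¬ p ∣ d′)
power-split p 2≤p = <-rec _ go
  where
  go : ∀ d → (∀ {d′} → d′ < d → 1 ≤ d′ → ∃[ a ] ∃[ d″ ] (d′ ≡ p ^ a * d″ × ¬ p ∣ d″)) → 1 ≤ d → ∃[ a ] ∃[ d′ ] (d ≡ p ^ a * d′ × ¬ p ∣ d′)
  go d rec 1≤d with p ∣? d
  ... | no p∤d            = 0 , d , sym (+-identityʳ d) , p∤d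
  ... | yes (divides (suc c) eq) with rec {suc c} (<-≤-trans (m<m*n (suc c) p 2≤p) (≤-reflexive (sym eq))) (s≤s z≤n)
  ...   | a , d′ , c≡ , p∤d′ = suc a , d′ , trans eq (trans (cong (_* p) c≡) (lemma (p ^ a) d′ p)) , p∤d′
    where
    lemma : ∀ e d p → e * d * p ≡ p * e * d
    lemma = solve-∀
  go d rec 1≤d | yes (divides zero refl) = ⊥-elim (n≮n 0 1≤d)

largest-exponent : ∀ p N → 2 ≤ p → 1 ≤ N → ∃[ e ] (p ^ e ≤ N × N < p ^ suc e)
largest-exponent p (suc zero)    2≤p _ = 0 , ≤-refl , ≤-trans 2≤p (≤-reflexive (sym (*-identityʳ p)))
largest-exponent p (suc (suc N)) 2≤p _ with largest-exponent p (suc N) 2≤p (s≤s z≤n)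
... | e , lo , hi with p ^ suc e ≤? suc (suc N)
...   | no gt  = e , m≤n⇒m≤1+n lo , ≰⇒> gt
...   | yes le = suc e , le , (begin-strict
        suc (suc N)  ≤⟨ hi ⟩
        p ^ suc e  <⟨ ^-monoʳ-< p 2≤p (n<1+n (suc e)) ⟩
        p ^ suc (suc e)  ∎)
  where open ≤-Reasoning

module PrimeIndex {P : ℕ → ℕ} (isEnum : IsPrimeEnumeration P) where

  open IsPrimeEnumeration isEnum public

  P≥2 : ∀ i → 1 ≤ i → 2 ≤ P i
  P≥2 i 1≤i = nonTrivial⇒n>1 (P i) {{prime⇒nonTrivial (prime i 1≤i)}}

  P-strict : ∀ i → 1 ≤ i → P i < P (suc i)
  P-strict = strict

  P-mono-< : ∀ i d → 1 ≤ i → P i < P (i + suc d)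
  P-mono-< i zero    1≤i rewrite +-comm i 1 = strict i 1≤i
  P-mono-< i (suc d) 1≤i rewrite +-suc i (suc d) = <-trans (P-mono-< i d 1≤i) (strict (i + suc d) (≤-trans 1≤i (m≤m+n i (suc d))))

  P-<⇒ : ∀ {i j} → 1 ≤ i → i < j → P i < P j
  P-<⇒ {i} {j} 1≤i i<j = subst (λ x → P i < P x) (trans (+-suc i (j ∸ suc i)) (m+[n∸m]≡n i<j)) (P-mono-< i (j ∸ suc i) 1≤i)

  P-≤⇒ : ∀ {i j} → 1 ≤ i → i ≤ j → P i ≤ P j
  P-≤⇒ {i} {j} 1≤i i≤j with m≤n⇒m<n∨m≡n i≤j
  ... | inj₁ i<j  = <⇒≤ (P-<⇒ 1≤i i<j)
  ... | inj₂ refl = ≤-refl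

  P-cancel-< : ∀ {i j} → 1 ≤ j → P i < P j → i < j
  P-cancel-< {i} {j} 1≤j lt with i <? j
  ... | yes i<j = i<j
  ... | no i≮j  = ⊥-elim (<⇒≱ lt (P-≤⇒ 1≤j (≮⇒≥ i≮j)))

  P-≥ : ∀ i → 1 ≤ i → suc i ≤ P i
  P-≥ (suc zero)    1≤i = P≥2 1 ≤-refl
  P-≥ (suc (suc i)) 1≤i = <-≤-trans (s≤s (P-≥ (suc i) (s≤s z≤n))) (strict (suc i) (s≤s z≤n))

  module _ (N : ℕ) (1≤N : 1 ≤ N) where

    -- When the first i primes are those up to N, this is lcm(1, ..., N): every factor is the
    -- largest power of its prime not exceeding N.
    multiple : ℕ → ℕ
    multiple zero    = 1
    multiple (suc i) = P (suc i) ^ proj₁ (largest-exponent (P (suc i)) N (P≥2 (suc i) (s≤s z≤n)) 1≤N) * multiple i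

    multiple≥1 : ∀ i → 1 ≤ multiple i
    multiple≥1 zero    = ≤-refl
    multiple≥1 (suc i) = *-mono-≤ (>-nonZero⁻¹ _ {{m^n≢0 (P (suc i)) (proj₁ (largest-exponent (P (suc i)) N (P≥2 (suc i) (s≤s z≤n)) 1≤N)) {{prime⇒nonZero (prime (suc i) (s≤s z≤n))}}}}) (multiple≥1 i)

    multiple≤ : ∀ i → multiple i ≤ N ^ i
    multiple≤ zero    = ≤-refl
    multiple≤ (suc i) = *-mono-≤ (proj₁ (proj₂ (largest-exponent (P (suc i)) N (P≥2 (suc i) (s≤s z≤n)) 1≤N))) (multiple≤ i)

    ∣multiple : ∀ i d → 1 ≤ d → d ≤ N → (∀ q → Prime q → q ∣ d → ∃[ j ] (1 ≤ j × j ≤ i × P j ≡ q)) → d ∣ multiple i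
    ∣multiple zero d 1≤d d≤N factors with d ≤? 1
    ... | yes d≤1 = ∣-reflexive (≤-antisym d≤1 1≤d)
    ... | no d≰1  = ⊥-elim (none (∃-prime-divisor d (≰⇒> d≰1)))
      where
      none : ∃[ p ] (Prime p × p ∣ d) → ⊥
      none (p , pp , p∣d) with factors p pp p∣d
      ... | j , 1≤j , j≤0 , _ = n≮n 0 (≤-trans 1≤j j≤0)
    ∣multiple (suc i) d 1≤d d≤N factors with power-split (P (suc i)) (P≥2 (suc i) (s≤s z≤n)) d 1≤d
    ... | a , d′ , refl , p∤d′ = *-pres-∣ p^a∣ (∣multiple i d′ 1≤d′ d′≤N factors′)
      where
      p = P (suc i)
      e = proj₁ (largest-exponent p N (P≥2 (suc i) (s≤s z≤n)) 1≤N)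
      instance
        p≢0 : NonZero p
        p≢0 = prime⇒nonZero (prime (suc i) (s≤s z≤n))
        p^a≢0 : NonZero (p ^ a)
        p^a≢0 = m^n≢0 p a
      1≤d′ : 1 ≤ d′
      1≤d′ = n≢0⇒n>0 (λ eq → n≮n 0 (≤-trans 1≤d (≤-reflexive (trans (cong (p ^ a *_) eq) (*-zeroʳ (p ^ a))))))
      d′≤N : d′ ≤ N
      d′≤N = ≤-trans (m≤n*m d′ (p ^ a)) d≤N
      a≤e : a ≤ e
      a≤e with a ≤? e
      ... | yes le = le
      ... | no gt  = ⊥-elim (<⇒≱ (proj₂ (proj₂ (largest-exponent p N (P≥2 (suc i) (s≤s z≤n)) 1≤N))) (≤-trans (^-monoʳ-≤ p (≰⇒> gt)) (≤-trans (m≤m*n (p ^ a) d′ {{>-nonZero 1≤d′}}) d≤N)))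
      p^a∣ : p ^ a ∣ p ^ e
      p^a∣ = subst (p ^ a ∣_) (trans (sym (^-distribˡ-+-* p a (e ∸ a))) (cong (p ^_) (m+[n∸m]≡n a≤e))) (m∣m*n (p ^ (e ∸ a)))
      factors′ : ∀ q → Prime q → q ∣ d′ → ∃[ j ] (1 ≤ j × j ≤ i × P j ≡ q)
      factors′ q pq q∣d′ with factors q pq (∣n⇒∣m*n (p ^ a) q∣d′)
      ... | j , 1≤j , j≤ , Pj≡q with m≤n⇒m<n∨m≡n j≤
      ...   | inj₁ j<   = j , 1≤j , ≤-pred j< , Pj≡q
      ...   | inj₂ refl = ⊥-elim (p∤d′ (subst (_∣ d′) (sym Pj≡q) q∣d′))

  2^P≤ : ∀ i → 1 ≤ i → 2 ^ pred (P i) ≤ P i ^ i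
  2^P≤ i 1≤i = ≤-trans (common-multiple-large (multiple N 1≤N i) (pred N) (multiple≥1 N 1≤N i) all) (multiple≤ N 1≤N i)
    where
    N = P i
    1≤N : 1 ≤ N
    1≤N = <⇒≤ (P≥2 i 1≤i)
    all : ∀ d → 1 ≤ d → d ≤ suc (pred N) → d ∣ multiple N 1≤N i
    all d 1≤d d≤ = ∣multiple N 1≤N i d 1≤d d≤N factors
      where
      d≤N : d ≤ N
      d≤N = ≤-trans d≤ (≤-reflexive (suc-pred N {{>-nonZero 1≤N}}))
      factors : ∀ q → Prime q → q ∣ d → ∃[ j ] (1 ≤ j × j ≤ i × P j ≡ q)
      factors q pq q∣d with complete q pq
      ... | j , 1≤j , refl = j , 1≤j , j≤i , refl
        where
        j≤i : j ≤ i
        j≤i with j ≤? i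
        ... | yes le = le
        ... | no gt  = ⊥-elim (<⇒≱ (P-<⇒ 1≤i (≰⇒> gt)) (≤-trans (∣⇒≤ {{>-nonZero 1≤d}} q∣d) d≤N))

  -- A bootstrap: inserting P i ≤ 2^B into 2^(P i - 1) ≤ (P i)^i leaves P i - 1 ≤ B i. With B of the
  -- order of log P i this is the bound O(i log i).
  P≤ : ∀ i B → 1 ≤ i → P i ≤ 2 ^ B → P i ≤ suc (B * i)
  P≤ i B 1≤i le = ≤-trans (≤-reflexive (sym (suc-pred (P i) {{prime⇒nonZero (prime i 1≤i)}}))) (s≤s (cancel (begin
    2 ^ pred (P i)  ≤⟨ 2^P≤ i 1≤i ⟩
    P i ^ i  ≤⟨ ^-monoˡ-≤ i le ⟩
    (2 ^ B) ^ i  ≡⟨ ^-*-assoc 2 B i ⟩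
    2 ^ (B * i)  ∎)))
    where
    open ≤-Reasoning
    cancel : ∀ {a b} → 2 ^ a ≤ 2 ^ b → a ≤ b
    cancel {a} {b} le with a ≤? b
    ... | yes a≤b = a≤b
    ... | no a≰b  = ⊥-elim (<⇒≱ (^-monoʳ-< 2 ≤-refl (≰⇒> a≰b)) le)

-- Subset sums

data Sub : List ℕ → ℕ → Set where
  []   : Sub [] 0
  skip : ∀ {x xs t} → Sub xs t → Sub (x ∷ xs) t
  take : ∀ {x xs t} → Sub xs t → Sub (x ∷ xs) (x + t)

total : List ℕ → ℕ
total []       = 0
total (x ∷ xs) = x + total xs

Sub-none : ∀ xs → Sub xs 0
Sub-none []       = []
Sub-none (x ∷ xs) = skip (Sub-none xs)

Sub-++ : ∀ {xs ys s t} → Sub xs s → Sub ys t → Sub (xs ++ ys) (s + t)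
Sub-++ []                    q = q
Sub-++ (skip p)              q = skip (Sub-++ p q)
Sub-++ {x ∷ xs} {ys} {_} {t} (take {t = s} p) q = subst (Sub (x ∷ xs ++ ys)) (sym (+-assoc x s t)) (take (Sub-++ p q))

Sub-↭ : ∀ {xs ys t} → xs ↭ ys → Sub xs t → Sub ys t
Sub-↭ Perm.refl          s               = s
Sub-↭ (prep x p)         (skip s)        = skip (Sub-↭ p s)
Sub-↭ (prep x p)         (take s)        = take (Sub-↭ p s)
Sub-↭ (swap x y p)       (skip (skip s)) = skip (skip (Sub-↭ p s))
Sub-↭ (swap x y p)       (skip (take s)) = take (skip (Sub-↭ p s))
Sub-↭ (swap x y p)       (take (skip s)) = skip (take (Sub-↭ p s))
Sub-↭ (swap {ys = ys} x y p) (take (take {t = t} s)) = subst (Sub (y ∷ x ∷ ys)) (lemma y x t) (take (take (Sub-↭ p s)))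
  where
  lemma : ∀ y x t → y + (x + t) ≡ x + (y + t)
  lemma = solve-∀
Sub-↭ (Perm.trans p q)   s               = Sub-↭ q (Sub-↭ p s)

module _ {A : Set} where

  count : (A → Bool) → List A → ℕ
  count p []       = 0
  count p (x ∷ xs) = indicator (p x) + count p xs

  count-↭ : ∀ p {xs ys} → xs ↭ ys → count p xs ≡ count p ys
  count-↭ p Perm.refl        = refl
  count-↭ p (prep x e)       = cong (_+_ (indicator (p x))) (count-↭ p e)
  count-↭ p (swap {ys = ys} x y e) = trans (cong (λ c → indicator (p x) + (indicator (p y) + c)) (count-↭ p e)) (lemma (indicator (p x)) (indicator (p y)) (count p ys))
    where
    lemma : ∀ a b c → a + (b + c) ≡ b + (a + c)
    lemma = solve-∀
  count-↭ p (Perm.trans e f) = trans (count-↭ p e) (count-↭ p f)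

  count-++ : ∀ p xs {ys} → count p (xs ++ ys) ≡ count p xs + count p ys
  count-++ p []       = refl
  count-++ p (x ∷ xs) {ys} = trans (cong (_+_ (indicator (p x))) (count-++ p xs)) (sym (+-assoc (indicator (p x)) (count p xs) (count p ys)))

  indicator-mono : ∀ {c d} → (T c → T d) → indicator c ≤ indicator d
  indicator-mono {false}         f = z≤n
  indicator-mono {true}  {true}  f = ≤-refl
  indicator-mono {true}  {false} f = ⊥-elim (f _)

  indicator≤1 : ∀ c → indicator c ≤ 1
  indicator≤1 true  = ≤-refl
  indicator≤1 false = z≤n

  count-mono : ∀ {p r} xs → (∀ x → T (p x) → T (r x)) → count p xs ≤ count r xs
  count-mono []       f = z≤n
  count-mono (x ∷ xs) f = +-mono-≤ (indicator-mono (f x)) (count-mono xs f)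

  count≤length : ∀ p xs → count p xs ≤ length xs
  count≤length p []       = z≤n
  count≤length p (x ∷ xs) = +-mono-≤ (indicator≤1 (p x)) (count≤length p xs)

  count-true : ∀ xs → count (λ _ → true) xs ≡ length xs
  count-true []       = refl
  count-true (x ∷ xs) = cong suc (count-true xs)

  count-rest : ∀ p {xs} ys {zs} → xs ↭ ys ++ zs → count p xs ≤ length ys + count p zs
  count-rest p ys {zs} e = ≤-trans (≤-reflexive (trans (count-↭ p e) (count-++ p ys))) (+-monoˡ-≤ (count p zs) (count≤length p ys))

  pick : ∀ p xs → 1 ≤ count p xs → ∃[ x ] ∃[ ys ] (T (p x) × xs ↭ x ∷ ys)
  pick p (x ∷ xs) le with p x in eq
  ... | true  = x , xs , subst T (sym eq) _ , ↭-refl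
  ... | false = let y , ys , py , e = pick p xs le in y , x ∷ ys , py , ↭-trans (prep x e) (swap x y ↭-refl)

  pick-many : ∀ p n xs → n ≤ count p xs → ∃[ ys ] ∃[ zs ] (length ys ≡ n × All (λ y → T (p y)) ys × xs ↭ ys ++ zs)
  pick-many p zero    xs le = [] , xs , refl , [] , ↭-refl
  pick-many p (suc n) xs le =
    let y , xs′ , py , e = pick p xs (≤-trans (s≤s z≤n) le)
        ys , zs , len , ps , e′ = pick-many p n xs′ (≤-pred (≤-trans le (count-rest p (y ∷ []) e)))
    in y ∷ ys , zs , cong suc len , py ∷ ps , ↭-trans e (prep y e′)

  bounded-or-exceeds : ∀ B (g : ℕ → ℕ) c → (∀ j → j < B → g j ≤ c) ⊎ ∃[ j ] (j < B × c < g j)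
  bounded-or-exceeds zero    g c = inj₁ (λ _ ())
  bounded-or-exceeds (suc B) g c with bounded-or-exceeds B g c | g B ≤? c
  ... | inj₂ (j , j< , gt) | _      = inj₂ (j , m<n⇒m<1+n j< , gt)
  ... | inj₁ _             | no gt  = inj₂ (B , ≤-refl , ≰⇒> gt)
  ... | inj₁ all           | yes le = inj₁ below
    where
    below : ∀ j → j < suc B → g j ≤ c
    below j j<1+B with m<1+n⇒m<n∨m≡n j<1+B
    ... | inj₁ j<B  = all j j<B
    ... | inj₂ refl = le

  indicator-∧-≤ : ∀ c κ B → κ < B → indicator c ≤ ∑ B (λ j → indicator (c ∧ (κ ≡ᵇ j)))
  indicator-∧-≤ c κ (suc B) κ<1+B with m<1+n⇒m<n∨m≡n κ<1+B
  ... | inj₁ κ<B  = ≤-trans (indicator-∧-≤ c κ B κ<B) (m≤m+n _ _)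
  ... | inj₂ refl = ≤-trans (indicator-mono (here c)) (m≤n+m _ (∑ B (λ j → indicator (c ∧ (κ ≡ᵇ j)))))
    where
    here : ∀ c → T c → T (c ∧ (κ ≡ᵇ κ))
    here true _ = ≡⇒≡ᵇ κ κ refl

  count-by-key : ∀ p (key : A → ℕ) B xs → All (λ x → T (p x) → key x < B) xs →
    count p xs ≤ ∑ B (λ j → count (λ x → p x ∧ (key x ≡ᵇ j)) xs)
  count-by-key p key B []       []         = z≤n
  count-by-key p key B (x ∷ xs) (lt ∷ lts) = ≤-trans (+-mono-≤ (first (p x) refl) (count-by-key p key B xs lts)) (≤-reflexive (sym (∑-+ B)))
    where
    first : ∀ c → p x ≡ c → indicator c ≤ ∑ B (λ j → indicator (p x ∧ (key x ≡ᵇ j)))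
    first false eq = z≤n
    first true  eq = ≤-trans (≤-reflexive (cong indicator (sym eq))) (indicator-∧-≤ (p x) (key x) B (lt (subst T (sym eq) _)))

  pigeonhole : ∀ p (key : A → ℕ) B c xs → All (λ x → T (p x) → key x < B) xs → B * c < count p xs →
    ∃[ j ] (j < B × c < count (λ x → p x ∧ (key x ≡ᵇ j)) xs)
  pigeonhole p key B c xs lts lt with bounded-or-exceeds B (λ j → count (λ x → p x ∧ (key x ≡ᵇ j)) xs) c
  ... | inj₂ found = found
  ... | inj₁ all   = ⊥-elim (<⇒≱ lt (≤-trans (count-by-key p key B xs lts) (∑-≤-const B c all)))

T-∧ : ∀ {c d} → T (c ∧ d) → T c × T d
T-∧ {true} t = _ , t

T-not : ∀ {c} → T (not c) → c ≡ false
T-not {false} _ = refl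

%≡⇒∣∸ : ∀ d {{_ : NonZero d}} x y → x ≤ y → x % d ≡ y % d → d ∣ y ∸ x
%≡⇒∣∸ d x y x≤y eq = divides (y / d ∸ x / d) (begin
  y ∸ x  ≡⟨ cong₂ _∸_ (m≡m%n+[m/n]*n y d) (m≡m%n+[m/n]*n x d) ⟩
  (y % d + y / d * d) ∸ (x % d + x / d * d)  ≡⟨ cong (λ r → (y % d + y / d * d) ∸ (r + x / d * d)) eq ⟩
  (y % d + y / d * d) ∸ (y % d + x / d * d)  ≡⟨ [m+n]∸[m+o]≡n∸o (y % d) _ _ ⟩
  y / d * d ∸ x / d * d  ≡⟨ sym (*-distribʳ-∸ d (y / d) (x / d)) ⟩
  (y / d ∸ x / d) * d  ∎)
  where open ≡-Reasoning

/≡⇒∸< : ∀ d {{_ : NonZero d}} x y → x / d ≡ y / d → y ∸ x < d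
/≡⇒∸< d x y eq = m<n+o⇒m∸n<o y x (<-≤-trans (<suc/* y d) (≤-trans (≤-reflexive (+-comm d (y / d * d)))
  (+-monoˡ-≤ d (≤-trans (≤-reflexive (cong (_* d) (sym eq))) (m/n*n≤m x d)))))

-- A pair (u , d) stands for the two elements u and u + d; using exactly one of them contributes u,
-- with an optional extra d.
Pairs : Set
Pairs = List (ℕ × ℕ)

flatten : Pairs → List ℕ
flatten []             = []
flatten ((u , d) ∷ ps) = u ∷ u + d ∷ flatten ps

length-flatten : ∀ ps → length (flatten ps) ≡ 2 * length ps
length-flatten []       = refl
length-flatten (_ ∷ ps) = trans (cong (suc ∘ suc) (length-flatten ps)) (lemma (length ps))
  where
  lemma : ∀ n → suc (suc (2 * n)) ≡ 2 * suc n
  lemma = solve-∀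

flatten-++ : ∀ ps qs → flatten (ps ++ qs) ≡ flatten ps ++ flatten qs
flatten-++ []             qs = refl
flatten-++ ((u , d) ∷ ps) qs = cong (λ xs → u ∷ u + d ∷ xs) (flatten-++ ps qs)

flatten-↭ : ∀ {ps qs} → ps ↭ qs → flatten ps ↭ flatten qs
flatten-↭ Perm.refl              = ↭-refl
flatten-↭ (prep (u , d) e)       = prep u (prep (u + d) (flatten-↭ e))
flatten-↭ (swap {xs = ps} (u , d) (v , c) e) = ↭-trans (PermP.shifts (u ∷ u + d ∷ []) (v ∷ v + c ∷ []) {flatten ps}) (PermP.++⁺ˡ (v ∷ v + c ∷ u ∷ u + d ∷ []) (flatten-↭ e))
flatten-↭ (Perm.trans e f)       = ↭-trans (flatten-↭ e) (flatten-↭ f)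

module _ (Y g : ℕ) where

  Bounded : List ℕ → Set
  Bounded = All (_≤ Y)

  -- For k ≥ 2 several primes share a root, so lists may repeat entries; g caps the repetition.
  Mult : List ℕ → Set
  Mult xs = ∀ r → count (_≡ᵇ r) xs ≤ g

  Bounded-rest : ∀ {xs} ys {zs} → xs ↭ ys ++ zs → Bounded xs → Bounded zs
  Bounded-rest ys e bd = AllP.++⁻ʳ ys (PermP.All-resp-↭ e bd)

  Mult-rest : ∀ {xs} ys {zs} → xs ↭ ys ++ zs → Mult xs → Mult zs
  Mult-rest ys {zs} e m r = ≤-trans (≤-trans (m≤n+m _ (count (_≡ᵇ r) ys)) (≤-reflexive (sym (trans (count-↭ (_≡ᵇ r) e) (count-++ (_≡ᵇ r) ys))))) (m r)

  near-values : ∀ lo x xs → Mult xs → count (near lo x) xs ≤ 2 * lo * g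
  near-values lo x xs m = begin
    count (near lo x) xs  ≤⟨ count-by-key (near lo x) (_∸ (x ∸ lo)) (2 * lo) xs (All.tabulate (λ {y} _ → key< y)) ⟩
    ∑ (2 * lo) (λ j → count (λ y → near lo x y ∧ (y ∸ (x ∸ lo) ≡ᵇ j)) xs)  ≤⟨ ∑-≤-const (2 * lo) g (λ j _ → ≤-trans (count-mono xs (λ y → same j y)) (m (j + (x ∸ lo)))) ⟩
    2 * lo * g  ∎
    where
    open ≤-Reasoning
    bounds : ∀ y → T (near lo x y) → x < y + lo × y < x + lo
    bounds y t = <ᵇ⇒< x (y + lo) (proj₁ (T-∧ t)) , <ᵇ⇒< y (x + lo) (proj₂ (T-∧ {x <ᵇ y + lo} t))
    low : ∀ y → T (near lo x y) → x ∸ lo ≤ y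
    low y t = m≤n+o⇒m∸n≤o x lo (≤-trans (<⇒≤ (proj₁ (bounds y t))) (≤-reflexive (+-comm y lo)))
    lo≢0 : ∀ y → T (near lo x y) → NonZero (2 * lo)
    lo≢0 y t = m*n≢0 2 lo {{_}} {{≢-nonZero (λ eq → <-asym (<-≤-trans (proj₁ (bounds y t)) (≤-reflexive (trans (cong (_+_ y) eq) (+-identityʳ y))))
                                                           (<-≤-trans (proj₂ (bounds y t)) (≤-reflexive (trans (cong (_+_ x) eq) (+-identityʳ x)))))}}
    key< : ∀ y → T (near lo x y) → y ∸ (x ∸ lo) < 2 * lo
    key< y t = m<n+o⇒m∸n<o y (x ∸ lo) {{lo≢0 y t}} (<-≤-trans (proj₂ (bounds y t)) (≤-trans (+-monoˡ-≤ lo (m≤n+m∸n x lo)) (≤-reflexive (lemma lo (x ∸ lo)))))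
      where
      lemma : ∀ l a → l + a + l ≡ a + 2 * l
      lemma = solve-∀
    same : ∀ j y → T (near lo x y ∧ (y ∸ (x ∸ lo) ≡ᵇ j)) → T (y ≡ᵇ j + (x ∸ lo))
    same j y t = ≡⇒≡ᵇ y _ (trans (sym (m∸n+n≡m (low y (proj₁ (T-∧ t))))) (cong (_+ (x ∸ lo)) (≡ᵇ⇒≡ _ j (proj₂ (T-∧ {near lo x y} t)))))

  module Extract (lo hi δ : ℕ) {{_ : NonZero hi}} {{_ : NonZero δ}} where

    -- The classes by quotient by `hi` and residue modulo δ number (1 + Y / hi) δ. Some class then
    -- holds an x and more than 2 lo g further elements, too many for all of them to lie within `lo`
    -- of x.
    threshold : ℕ
    threshold = suc (Y / hi) * (δ * suc (suc (2 * lo * g)))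

    GoodPair : ℕ × ℕ → Set
    GoodPair (u , d) = u ≤ Y × lo ≤ d × d < hi × δ ∣ d

    ExtractedPair : List ℕ → Set
    ExtractedPair xs = ∃[ u ] ∃[ d ] ∃[ ys ] (xs ↭ u ∷ u + d ∷ ys × GoodPair (u , d))

    ordered-pair : ∀ {xs} u v ys → u + lo ≤ v → u ≤ Y → xs ↭ u ∷ v ∷ ys → u / hi ≡ v / hi → u % δ ≡ v % δ → ExtractedPair xs
    ordered-pair {xs} u v ys lo≤ u≤Y e eq/ eq% = u , v ∸ u , ys , subst (λ v → xs ↭ u ∷ v ∷ ys) (sym (m+[n∸m]≡n u≤v)) e ,
      u≤Y , m+n≤o⇒m≤o∸n lo (≤-trans (≤-reflexive (+-comm lo u)) lo≤) , /≡⇒∸< hi u v eq/ , %≡⇒∣∸ δ u v u≤v eq%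
      where
      u≤v : u ≤ v
      u≤v = ≤-trans (m≤m+n u lo) lo≤

    far-pair : ∀ {xs} x y ys → xs ↭ x ∷ y ∷ ys → All (_≤ Y) (x ∷ y ∷ ys) → near lo x y ≡ false → x / hi ≡ y / hi → x % δ ≡ y % δ → ExtractedPair xs
    far-pair x y ys e (x≤Y ∷ y≤Y ∷ _) far eq/ eq% with near-or-far lo x y far
    ... | inj₁ le = ordered-pair x y ys le x≤Y e eq/ eq%
    ... | inj₂ le = ordered-pair y x ys le y≤Y (↭-trans e (swap x y ↭-refl)) (sym eq/) (sym eq%)

    bin : ℕ → ℕ → ℕ → Bool
    bin j₁ j₂ x = (x / hi ≡ᵇ j₁) ∧ (x % δ ≡ᵇ j₂)

    bin-/ : ∀ j₁ j₂ x → T (bin j₁ j₂ x) → x / hi ≡ j₁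
    bin-/ j₁ j₂ x t = ≡ᵇ⇒≡ _ j₁ (proj₁ (T-∧ t))

    bin-% : ∀ j₁ j₂ x → T (bin j₁ j₂ x) → x % δ ≡ j₂
    bin-% j₁ j₂ x t = ≡ᵇ⇒≡ _ j₂ (proj₂ (T-∧ {x / hi ≡ᵇ j₁} t))

    pick-far : ∀ p x xs → Mult xs → 2 * lo * g < count p xs → ∃[ y ] ∃[ ys ] (T (p y ∧ not (near lo x y)) × xs ↭ y ∷ ys)
    pick-far p x xs m lt = pick _ xs (+-cancelʳ-≤ (2 * lo * g) 1 _ (≤-trans lt (≤-trans (split xs) (+-monoʳ-≤ (count (λ y → p y ∧ not (near lo x y)) xs) (near-values lo x xs m)))))
      where
      case : ∀ c d → indicator c ≤ indicator (c ∧ not d) + indicator d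
      case false d     = z≤n
      case true  true  = ≤-refl
      case true  false = ≤-refl
      lemma : ∀ a b c d → a + b + (c + d) ≡ a + c + (b + d)
      lemma = solve-∀
      split : ∀ ys → count p ys ≤ count (λ y → p y ∧ not (near lo x y)) ys + count (near lo x) ys
      split []       = z≤n
      split (y ∷ ys) = ≤-trans (+-mono-≤ (case (p y) (near lo x y)) (split ys))
        (≤-reflexive (lemma (indicator (p y ∧ not (near lo x y))) (indicator (near lo x y)) (count (λ y → p y ∧ not (near lo x y)) ys) (count (near lo x) ys)))

    extract : ∀ xs → Bounded xs → Mult xs → threshold < length xs → ExtractedPair xs
    extract xs bd m lt with pigeonhole (λ _ → true) (_/ hi) (suc (Y / hi)) (δ * suc (suc (2 * lo * g))) xs (All.map (λ x≤Y _ → s≤s (/-monoˡ-≤ hi x≤Y)) bd)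
                             (<-≤-trans lt (≤-reflexive (sym (count-true xs))))
    ... | j₁ , _ , lt₁ with pigeonhole (λ x → x / hi ≡ᵇ j₁) (_% δ) δ (suc (suc (2 * lo * g))) xs (All.tabulate (λ {x} _ _ → m%n<n x δ)) lt₁
    ...   | j₂ , _ , lt₂ with pick (bin j₁ j₂) xs (≤-trans (s≤s z≤n) lt₂)
    ...     | x , xs₁ , bin-x , e₁ with pick-far (bin j₁ j₂) x xs₁ (Mult-rest (x ∷ []) e₁ m) (≤-pred (≤-trans (<⇒≤ lt₂) (count-rest (bin j₁ j₂) (x ∷ []) e₁)))
    ...       | y , ys , far-y , e₂ = far-pair x y ys e (PermP.All-resp-↭ e bd) (T-not (proj₂ (T-∧ {bin j₁ j₂ y} far-y)))
                  (trans (bin-/ j₁ j₂ x bin-x) (sym (bin-/ j₁ j₂ y (proj₁ (T-∧ far-y))))) (trans (bin-% j₁ j₂ x bin-x) (sym (bin-% j₁ j₂ y (proj₁ (T-∧ far-y)))))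
      where
      e : xs ↭ x ∷ y ∷ ys
      e = ↭-trans e₁ (prep x e₂)

    extract-many : ∀ n xs → Bounded xs → Mult xs → threshold + 2 * n ≤ length xs →
      ∃[ ps ] ∃[ ys ] (length ps ≡ n × All GoodPair ps × xs ↭ flatten ps ++ ys)
    extract-many zero    xs bd m le = [] , xs , refl , [] , ↭-refl
    extract-many (suc n) xs bd m le = after (extract xs bd m threshold<)
      where
      threshold< : threshold < length xs
      threshold< = <-≤-trans (m<m+n threshold (m<m+n 0 {2 * suc n} (s≤s z≤n))) le
      lemma : ∀ t n → 2 + (t + 2 * n) ≡ t + 2 * suc n
      lemma = solve-∀
      after : ExtractedPair xs → ∃[ ps ] ∃[ ys ] (length ps ≡ suc n × All GoodPair ps × xs ↭ flatten ps ++ ys)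
      after (u , d , ys , e , good) = extend (extract-many n ys (Bounded-rest (u ∷ u + d ∷ []) e bd) (Mult-rest (u ∷ u + d ∷ []) e m) enough)
        where
        enough : threshold + 2 * n ≤ length ys
        enough = +-cancelˡ-≤ 2 (threshold + 2 * n) (length ys) (≤-trans (≤-reflexive (lemma threshold n)) (≤-trans le (≤-reflexive (PermP.↭-length e))))
        extend : ∃[ ps ] ∃[ zs ] (length ps ≡ n × All GoodPair ps × ys ↭ flatten ps ++ zs) → ∃[ ps ] ∃[ zs ] (length ps ≡ suc n × All GoodPair ps × xs ↭ flatten ps ++ zs)
        extend (ps , zs , len , goods , e′) = (u , d) ∷ ps , zs , cong suc len , good ∷ goods , ↭-trans e (prep u (prep (u + d) e′))

AP : List ℕ → ℕ → ℕ → ℕ → Set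
AP zs u d n = ∀ j → j ≤ n → Sub zs (u + d * j)

-- The progression appears shifted by v and by v + d e; the two copies leave no gap because e ≤ n +
-- 1.
AP-pair : ∀ {zs u d n} v e → e ≤ suc n → AP zs u d n → AP (v ∷ v + d * e ∷ zs) (v + u) d (e + n)
AP-pair {zs} {u} {d} {n} v e e≤ ap j j≤ with j ≤? n
... | yes j≤n = subst (Sub _) (sym (+-assoc v u (d * j))) (take (skip (ap j j≤n)))
... | no j≰n  = subst (Sub _) (trans (lemma v d e u (j ∸ e)) (cong (λ j → v + u + d * j) (m+[n∸m]≡n (≤-trans e≤ (≰⇒> j≰n)))))
                  (skip (take (ap (j ∸ e) (m≤n+o⇒m∸n≤o j e j≤))))
  where
  lemma : ∀ v d e u i → v + d * e + (u + d * i) ≡ v + u + d * (e + i)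
  lemma = solve-∀

AP-single : ∀ {zs u n} x → x ≤ suc n → AP zs u 1 n → AP (x ∷ zs) u 1 (x + n)
AP-single {zs} {u} {n} x x≤ ap j j≤ with j ≤? n
... | yes j≤n = skip (ap j j≤n)
... | no j≰n  = subst (Sub _) (trans (lemma x u (j ∸ x)) (cong (λ j → u + 1 * j) (m+[n∸m]≡n (≤-trans x≤ (≰⇒> j≰n)))))
                  (take (ap (j ∸ x) (m≤n+o⇒m∸n≤o j x j≤)))
  where
  lemma : ∀ x u i → x + (u + 1 * i) ≡ u + 1 * (x + i)
  lemma = solve-∀

AP-pairs : ∀ Y d lo {zs u n} ps → All (λ (v , D) → v ≤ Y × lo ≤ D × D ≤ d * suc n × d ∣ D) ps → {{NonZero d}} → AP zs u d n →
  ∃[ u′ ] ∃[ n′ ] (AP (flatten ps ++ zs) u′ d n′ × u′ ≤ u + length ps * Y × d * n + length ps * lo ≤ d * n′)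
AP-pairs Y d lo {u = u} {n} [] [] ap = u , n , ap , ≤-reflexive (sym (+-identityʳ u)) , ≤-reflexive (+-identityʳ (d * n))
AP-pairs Y d lo {zs} {u} {n} ((v , D) ∷ ps) ((v≤Y , lo≤D , D≤ , divides e eq) ∷ good) ap =
  let u′ , n′ , ap′ , u′≤ , n′≥ = AP-pairs Y d lo {zs} {u} {n} ps good ap
      de≡D = trans (*-comm d e) (sym eq)
      n≤n′ : n ≤ n′
      n≤n′ = *-cancelˡ-≤ d (≤-trans (m≤m+n (d * n) _) n′≥)
      e≤ : e ≤ suc n′
      e≤ = ≤-trans (*-cancelˡ-≤ d (≤-trans (≤-reflexive de≡D) D≤)) (s≤s n≤n′)
  in v + u′ , e + n′ , subst (λ x → AP (v ∷ v + x ∷ flatten ps ++ zs) (v + u′) d (e + n′)) de≡D (AP-pair {u = u′} {d} {n′} v e e≤ ap′) ,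
     ≤-trans (+-mono-≤ v≤Y u′≤) (≤-reflexive (lemma₁ Y u (length ps * Y))) ,
     ≤-trans (≤-trans (≤-reflexive (lemma₂ (d * n) lo (length ps * lo))) (+-mono-≤ (≤-trans lo≤D (≤-reflexive (sym de≡D))) n′≥)) (≤-reflexive (sym (*-distribˡ-+ d e n′)))
  where
  lemma₁ : ∀ y u p → y + (u + p) ≡ u + (y + p)
  lemma₁ = solve-∀
  lemma₂ : ∀ a l p → a + (l + p) ≡ l + (a + p)
  lemma₂ = solve-∀

AP-singles : ∀ {zs u n} Y → Y ≤ n → AP zs u 1 n → ∀ xs → All (_≤ Y) xs → AP (xs ++ zs) u 1 (total xs + n)
AP-singles Y Y≤n ap []       []         = ap
AP-singles {zs} {u} {n} Y Y≤n ap (x ∷ xs) (x≤Y ∷ bd) = subst (AP (x ∷ xs ++ zs) u 1) (sym (+-assoc x (total xs) n))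
  (AP-single {u = u} {total xs + n} x (≤-trans x≤Y (≤-trans Y≤n (≤-trans (m≤n+m n (total xs)) (n≤1+n _)))) (AP-singles {zs} {u} {n} Y Y≤n ap xs bd))

%-*-% : ∀ a b d {{_ : NonZero d}} → (a % d * b) % d ≡ (a * b) % d
%-*-% a b d = sym (trans (cong (_% d) (trans (cong (_* b) (m≡m%n+[m/n]*n a d)) (lemma (a % d) (a / d) d b))) ([m+kn]%n≡m%n (a % d * b) (a / d * b) d))
  where
  lemma : ∀ r q d b → (r + q * d) * b ≡ r * b + q * b * d
  lemma = solve-∀

bézout-residue : ∀ d {{_ : NonZero d}} ρ j → ∃[ i ] (i < d × (i * ρ) % d ≡ (gcd ρ d * j) % d)
bézout-residue d ρ j with Bézout.identity (gcd-GCD ρ d)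
... | Bézout.+- x y eq = (x * j) % d , m%n<n (x * j) d , trans (%-*-% (x * j) ρ d) (trans (cong (_% d) (begin
    x * j * ρ  ≡⟨ lemma₁ x j ρ ⟩
    x * ρ * j  ≡⟨ cong (_* j) (sym eq) ⟩
    (gcd ρ d + y * d) * j  ≡⟨ lemma₂ (gcd ρ d) y d j ⟩
    gcd ρ d * j + y * j * d  ∎)) ([m+kn]%n≡m%n (gcd ρ d * j) (y * j) d))
  where
  open ≡-Reasoning
  lemma₁ : ∀ x j r → x * j * r ≡ x * r * j
  lemma₁ = solve-∀
  lemma₂ : ∀ g y d j → (g + y * d) * j ≡ g * j + y * j * d
  lemma₂ = solve-∀
-- Modulo d the factor `pred d` is -1, which corrects the sign of the Bézout coefficient.
... | Bézout.-+ x y eq = (pred d * x * j) % d , m%n<n (pred d * x * j) d , trans (%-*-% (pred d * x * j) ρ d)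
    (trans (sym ([m+kn]%n≡m%n (pred d * x * j * ρ) (y * j) d)) (trans (cong (_% d) (begin
    pred d * x * j * ρ + y * j * d  ≡⟨ lemma₁ (pred d) x j ρ y d ⟩
    pred d * (x * ρ * j) + y * d * j  ≡⟨ cong (λ z → pred d * (x * ρ * j) + z * j) (sym eq) ⟩
    pred d * (x * ρ * j) + (gcd ρ d + x * ρ) * j  ≡⟨ lemma₂ (pred d) x ρ j (gcd ρ d) ⟩
    gcd ρ d * j + x * ρ * j * suc (pred d)  ≡⟨ cong (λ z → gcd ρ d * j + x * ρ * j * z) (suc-pred d) ⟩
    gcd ρ d * j + x * ρ * j * d  ∎)) ([m+kn]%n≡m%n (gcd ρ d * j) (x * ρ * j) d)))
  where
  open ≡-Reasoning
  lemma₁ : ∀ p x j r y d → p * x * j * r + y * j * d ≡ p * (x * r * j) + y * d * j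
  lemma₁ = solve-∀
  lemma₂ : ∀ p x r j g → p * (x * r * j) + (g + x * r) * j ≡ g * j + x * r * j * suc p
  lemma₂ = solve-∀

prefix-sum : ∀ Y d {{_ : NonZero d}} ρ bs → All (λ b → b ≤ Y × b % d ≡ ρ) bs → ∀ i → i ≤ length bs →
  ∃[ σ ] (Sub bs σ × σ ≤ i * Y × σ % d ≡ (i * ρ) % d)
prefix-sum Y d ρ bs       good             zero    _  = 0 , Sub-none bs , z≤n , refl
prefix-sum Y d ρ (b ∷ bs) ((b≤Y , b%) ∷ good) (suc i) (s≤s i≤) =
  let σ , sub , σ≤ , σ% = prefix-sum Y d ρ bs good i i≤
  in b + σ , take sub , +-mono-≤ b≤Y σ≤ ,
     trans (%-distribˡ-+ b σ d) (trans (cong₂ (λ a c → (a + c) % d) (trans b% (sym (trans (cong (_% d) (sym b%)) (trans (m%n%n≡m%n b d) b%)))) σ%) (sym (%-distribˡ-+ ρ (i * ρ) d)))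

-- To reach u + d Y + gcd(ρ, d) j, take i elements of `bs` with i ρ ≡ gcd(ρ, d) j modulo d; the rest
-- is a multiple of d, supplied by the old progression. The offset d Y keeps that rest nonnegative
-- and costs Y terms.
AP-refine : ∀ {zs u n} Y d {{_ : NonZero d}} ρ e bs → length bs ≡ d → All (λ b → b ≤ Y × b % d ≡ ρ) bs → d ≡ e * gcd ρ d → Y ≤ n →
  AP zs u d n → AP (bs ++ zs) (u + d * Y) (gcd ρ d) (e * (n ∸ Y))
AP-refine {zs} {u} {n} Y d ρ e bs len good d≡ Y≤n ap j j≤ = subst (Sub (bs ++ zs)) target (Sub-++ sub (ap j′ j′≤n))
  where
  d′ = gcd ρ d
  choice = bézout-residue d ρ j
  i = proj₁ choice
  prefix = prefix-sum Y d ρ bs good i (≤-trans (<⇒≤ (proj₁ (proj₂ choice))) (≤-reflexive (sym len)))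
  σ = proj₁ prefix
  sub = proj₁ (proj₂ prefix)
  goal = d * Y + d′ * j
  σ≤goal : σ ≤ goal
  σ≤goal = ≤-trans (proj₁ (proj₂ (proj₂ prefix))) (≤-trans (*-monoˡ-≤ Y (<⇒≤ (proj₁ (proj₂ choice)))) (m≤m+n _ _))
  σ%≡ : σ % d ≡ goal % d
  σ%≡ = trans (proj₂ (proj₂ (proj₂ prefix))) (trans (proj₂ (proj₂ choice)) (sym (trans (cong (_% d) (trans (+-comm (d * Y) (d′ * j)) (cong (_+_ (d′ * j)) (*-comm d Y)))) ([m+kn]%n≡m%n (d′ * j) Y d))))
  divisible = %≡⇒∣∸ d σ goal σ≤goal σ%≡
  j′ = quotient divisible
  σ+ : σ + d * j′ ≡ goal
  σ+ = trans (cong (_+_ σ) (sym (m∣n⇒n≡m*quotient divisible))) (m+[n∸m]≡n σ≤goal)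
  j′≤n : j′ ≤ n
  j′≤n = *-cancelˡ-≤ d (begin
    d * j′  ≤⟨ m≤n+m (d * j′) σ ⟩
    σ + d * j′  ≡⟨ σ+ ⟩
    d * Y + d′ * j  ≤⟨ +-monoʳ-≤ (d * Y) (*-monoʳ-≤ d′ j≤) ⟩
    d * Y + d′ * (e * (n ∸ Y))  ≡⟨ cong (_+_ (d * Y)) (trans (lemma d′ e (n ∸ Y)) (cong (_* (n ∸ Y)) (sym d≡))) ⟩
    d * Y + d * (n ∸ Y)  ≡⟨ trans (sym (*-distribˡ-+ d Y (n ∸ Y))) (cong (d *_) (m+[n∸m]≡n Y≤n)) ⟩
    d * n  ∎)
    where
    open ≤-Reasoning
    lemma : ∀ d e n → d * (e * n) ≡ e * d * n
    lemma = solve-∀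
  target : σ + (u + d * j′) ≡ u + d * Y + d′ * j
  target = trans (lemma σ u (d * j′)) (trans (cong (_+_ u) σ+) (sym (+-assoc u (d * Y) (d′ * j))))
    where
    lemma : ∀ s u x → s + (u + x) ≡ u + (s + x)
    lemma = solve-∀

indivisible : ℕ → ℕ → Bool
indivisible q x = not (does (q ∣? x))

indivisible⇒∤ : ∀ q x → T (indivisible q x) → ¬ q ∣ x
indivisible⇒∤ q x t q∣x with q ∣? x
... | yes _ = t
... | no q∤ = q∤ q∣x

-- For a prime q dividing d, some class ρ modulo d contains d elements prime to q. Then q does not
-- divide ρ, so gcd(ρ, d) is a proper divisor of d and at most d / 2. The d elements used at each
-- stage therefore add up to at most 2d, and likewise the loss in span.
descend : ∀ Y V d → 1 ≤ d → d ≤ V → ∀ zs rest u n c → AP zs u d n → length zs ≤ c → u ≤ c * Y → suc (2 * d) * Y ≤ d * n →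
  All (_≤ Y) rest → (∀ q → Prime q → q ≤ V → V * V + 2 * d ≤ count (indivisible q) rest) →
  ∃[ zs′ ] ∃[ rest′ ] ∃[ u′ ] ∃[ n′ ] (zs ++ rest ↭ zs′ ++ rest′ × AP zs′ u′ 1 n′ × length zs′ ≤ c + 2 * d × u′ ≤ (c + 2 * d) * Y × Y ≤ n′)
descend Y V = <-rec _ go
  where
  Goal : ℕ → Set
  Goal d = 1 ≤ d → d ≤ V → ∀ zs rest u n c → AP zs u d n → length zs ≤ c → u ≤ c * Y → suc (2 * d) * Y ≤ d * n →
    All (_≤ Y) rest → (∀ q → Prime q → q ≤ V → V * V + 2 * d ≤ count (indivisible q) rest) →
    ∃[ zs′ ] ∃[ rest′ ] ∃[ u′ ] ∃[ n′ ] (zs ++ rest ↭ zs′ ++ rest′ × AP zs′ u′ 1 n′ × length zs′ ≤ c + 2 * d × u′ ≤ (c + 2 * d) * Y × Y ≤ n′)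
  go : ∀ d → (∀ {d′} → d′ < d → Goal d′) → Goal d
  go (suc zero) rec 1≤d d≤V zs rest u n c ap len u≤ span bd cnt =
    zs , rest , u , n , ↭-refl , ap , ≤-trans len (m≤m+n c 2) , ≤-trans u≤ (*-monoˡ-≤ Y (m≤m+n c 2)) ,
    ≤-trans (m≤m+n Y (Y + (Y + 0))) (≤-trans span (≤-reflexive (+-identityʳ n)))
  go d@(suc (suc _)) rec 1≤d d≤V zs rest u n c ap len u≤ span bd cnt =
    let zs′ , rest′ , u′ , n′ , e , ap′ , len′ , u′≤ , Y≤ = rec d′<d 1≤d′ (≤-trans (<⇒≤ d′<d) d≤V) (bs ++ zs) rest₁ (u + d * Y) (ε * (n ∸ Y)) (c + d)
          (AP-refine {zs} {u} {n} Y d ρ ε bs bs-len bs-good d≡ Y≤n ap)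
          (≤-trans (≤-reflexive (trans (length-++ bs) (+-comm (length bs) (length zs)))) (+-mono-≤ len (≤-reflexive bs-len)))
          (≤-trans (+-monoˡ-≤ (d * Y) u≤) (≤-reflexive (sym (*-distribʳ-+ Y c d))))
          span′ (AllP.++⁻ʳ bs (PermP.All-resp-↭ e₁ bd)) cnt′
    in zs′ , rest′ , u′ , n′ , ↭-trans rearrange e , ap′ , ≤-trans len′ c-bound , ≤-trans u′≤ (*-monoˡ-≤ Y c-bound) , Y≤
    where
    q-data = ∃-prime-divisor d (s≤s (s≤s z≤n))
    q = proj₁ q-data
    q-prime = proj₁ (proj₂ q-data)
    q∣d = proj₂ (proj₂ q-data)
    hole = pigeonhole (indivisible q) (_% d) d d rest (All.tabulate (λ {x} _ _ → m%n<n x d))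
             (<-≤-trans (≤-<-trans (*-mono-≤ d≤V d≤V) (m<m+n (V * V) (s≤s z≤n))) (cnt q q-prime (≤-trans (∣⇒≤ q∣d) d≤V)))
    ρ = proj₁ hole
    chosen = pick-many (λ x → indivisible q x ∧ (x % d ≡ᵇ ρ)) d rest (<⇒≤ (proj₂ (proj₂ hole)))
    bs = proj₁ chosen
    rest₁ = proj₁ (proj₂ chosen)
    bs-len : length bs ≡ d
    bs-len = proj₁ (proj₂ (proj₂ chosen))
    bs-T = proj₁ (proj₂ (proj₂ (proj₂ chosen)))
    e₁ : rest ↭ bs ++ rest₁
    e₁ = proj₂ (proj₂ (proj₂ (proj₂ chosen)))
    bs-good : All (λ b → b ≤ Y × b % d ≡ ρ) bs
    bs-good = All.zipWith (λ {x} (le , t) → le , ≡ᵇ⇒≡ _ ρ (proj₂ (T-∧ {indivisible q x} t))) (AllP.++⁻ˡ bs (PermP.All-resp-↭ e₁ bd) , bs-T)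
    q∤ρ : ¬ q ∣ ρ
    q∤ρ q∣ρ = contra bs bs-len bs-T
      where
      contra : ∀ bs → length bs ≡ d → All (λ x → T (indivisible q x ∧ (x % d ≡ᵇ ρ))) bs → ⊥
      contra (b ∷ _) _ (t ∷ _) = indivisible⇒∤ q b (proj₁ (T-∧ t))
        (∣n∣m%n⇒∣m q∣d (subst (q ∣_) (sym (≡ᵇ⇒≡ (b % d) ρ (proj₂ (T-∧ {indivisible q b} t)))) q∣ρ))
    d′ = gcd ρ d
    d′∣d : d′ ∣ d
    d′∣d = gcd[m,n]∣n ρ d
    ε = quotient d′∣d
    d≡ : d ≡ ε * d′
    d≡ = m∣n⇒n≡quotient*m d′∣d
    1≤d′ : 1 ≤ d′
    1≤d′ = n≢0⇒n>0 (λ eq → 1+n≢0 (trans d≡ (trans (cong (ε *_) eq) (*-zeroʳ ε))))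
    2≤ε : 2 ≤ ε
    2≤ε = at-least ε d≡
      where
      at-least : ∀ ε → d ≡ ε * d′ → 2 ≤ ε
      at-least zero          eq = ⊥-elim (1+n≢0 eq)
      at-least (suc zero)    eq = ⊥-elim (q∤ρ (∣-trans q∣d (subst (_∣ ρ) (trans (sym (+-identityʳ d′)) (sym eq)) (gcd[m,n]∣m ρ d))))
      at-least (suc (suc ε)) eq = s≤s (s≤s z≤n)
    2d′≤d : 2 * d′ ≤ d
    2d′≤d = ≤-trans (*-monoˡ-≤ d′ 2≤ε) (≤-reflexive (sym d≡))
    d′<d : d′ < d
    d′<d = <-≤-trans (m<m+n d′ (≤-trans 1≤d′ (≤-reflexive (sym (+-identityʳ d′))))) 2d′≤d
    Y≤n : Y ≤ n
    Y≤n = *-cancelˡ-≤ d (≤-trans (*-monoˡ-≤ Y (≤-trans (m≤m+n d (d + 0)) (n≤1+n (2 * d)))) span)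
    -- The refinement loses d Y of the span; what remains of (2d + 1) Y is (d + 1) Y, enough because
    -- 2 d′ ≤ d.
    span′ : suc (2 * d′) * Y ≤ d′ * (ε * (n ∸ Y))
    span′ = +-cancelˡ-≤ (d * Y) _ _ (begin
      d * Y + suc (2 * d′) * Y  ≤⟨ +-monoʳ-≤ (d * Y) (*-monoˡ-≤ Y (s≤s 2d′≤d)) ⟩
      d * Y + suc d * Y  ≡⟨ lemma₁ d Y ⟩
      suc (2 * d) * Y  ≤⟨ span ⟩
      d * n  ≡⟨ trans (cong (d *_) (sym (m+[n∸m]≡n Y≤n))) (*-distribˡ-+ d Y (n ∸ Y)) ⟩
      d * Y + d * (n ∸ Y)  ≡⟨ cong (_+_ (d * Y)) (trans (cong (_* (n ∸ Y)) d≡) (lemma₂ ε d′ (n ∸ Y))) ⟩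
      d * Y + d′ * (ε * (n ∸ Y))  ∎)
      where
      open ≤-Reasoning
      lemma₁ : ∀ d y → d * y + suc d * y ≡ suc (2 * d) * y
      lemma₁ = solve-∀
      lemma₂ : ∀ e d n → e * d * n ≡ d * (e * n)
      lemma₂ = solve-∀
    cnt′ : ∀ q → Prime q → q ≤ V → V * V + 2 * d′ ≤ count (indivisible q) rest₁
    cnt′ q qp q≤V = ≤-trans (+-monoʳ-≤ (V * V) 2d′≤d) (+-cancelˡ-≤ d _ _ (≤-trans (≤-trans (≤-reflexive (lemma d (V * V))) (cnt q qp q≤V))
      (≤-trans (count-rest (indivisible q) bs e₁) (≤-reflexive (cong (_+ count (indivisible q) rest₁) bs-len)))))
      where
      lemma : ∀ d v → d + (v + d) ≡ v + 2 * d
      lemma = solve-∀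
    c-bound : c + d + 2 * d′ ≤ c + 2 * d
    c-bound = ≤-trans (+-monoʳ-≤ (c + d) 2d′≤d) (≤-reflexive (lemma c d))
      where
      lemma : ∀ c d → c + d + d ≡ c + 2 * d
      lemma = solve-∀
    rearrange : zs ++ rest ↭ (bs ++ zs) ++ rest₁
    rearrange = ↭-trans (PermP.++⁺ˡ zs e₁) (↭-trans (PermP.shifts zs bs {rest₁}) (↭-sym (PermP.++-assoc bs zs rest₁)))

-- The budget c counts the elements consumed; since each is at most Y, it controls the base of the
-- progression as well.
record Progress (Y : ℕ) (xs : List ℕ) (d n c : ℕ) : Set where
  constructor progress
  field
    zs rest : List ℕ
    base    : ℕ
    split   : xs ↭ zs ++ rest
    ap      : AP zs base d n
    len     : length zs ≤ c
    base≤   : base ≤ c * Y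

module _ (Y g : ℕ) (xs : List ℕ) (bounded : All (_≤ Y) xs) (mult : Mult Y g xs) where

  equal-differences : ∀ δ F ps ys → 1 ≤ δ → length ps ≡ F → All (λ p → proj₁ p ≤ Y × proj₂ p ≡ δ) ps → xs ↭ flatten ps ++ ys →
    ∃[ n ] (F ≤ n × Progress Y xs δ n (2 * F))
  equal-differences δ F ps ys 1≤δ refl good e = from (AP-pairs Y δ δ {[]} {0} {0} ps
      (All.map (λ { (v≤Y , refl) → v≤Y , ≤-refl , ≤-reflexive (sym (*-identityʳ δ)) , ∣-refl }) good) start′)
    where
    instance
      δ≢0 : NonZero δ
      δ≢0 = >-nonZero 1≤δ
    start′ : AP [] 0 δ 0
    start′ zero _ = subst (Sub []) (sym (*-zeroʳ δ)) []
    from : ∃[ u ] ∃[ n ] (AP (flatten ps ++ []) u δ n × u ≤ 0 + length ps * Y × δ * 0 + length ps * δ ≤ δ * n) →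
      ∃[ n ] (F ≤ n × Progress Y xs δ n (2 * F))
    from (u , n , ap , u≤ , n≥) = n , *-cancelˡ-≤ δ (≤-trans (≤-reflexive (*-comm δ F)) (≤-trans (m≤n+m (F * δ) (δ * 0)) n≥)) ,
      progress (flatten ps) ys u e (subst (λ zs → AP zs u δ n) (++-identityʳ (flatten ps)) ap)
        (≤-reflexive (length-flatten ps)) (≤-trans u≤ (*-monoˡ-≤ Y (m≤n*m F 2)))

  -- Pairs are extracted with lo = 1, which forbids difference 0, hi = V and modulus 1, which is no
  -- condition. Among V F + 1 of them some difference occurs more than F times.
  common-difference : ∀ V F {{_ : NonZero V}} → 1 ≤ F → suc (Y / V) * suc (suc (2 * g)) + 2 * suc (V * F) ≤ length xs →
    ∃[ δ ] ∃[ n ] (1 ≤ δ × δ < V × F ≤ n × Progress Y xs δ n (2 * F))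
  common-difference V F 1≤F many = from (Extract.extract-many Y g 1 V 1 (suc (V * F)) xs bounded mult
      (≤-trans (≤-reflexive (cong (λ z → suc (Y / V) * z + 2 * suc (V * F)) (*-identityˡ (suc (suc (2 * g)))))) many))
    where
    Pair = Extract.GoodPair Y g 1 V 1
    Goal = ∃[ δ ] ∃[ n ] (1 ≤ δ × δ < V × F ≤ n × Progress Y xs δ n (2 * F))
    choose : ∀ δ ps ps₁ ps₂ ys → δ < V → All Pair ps → length ps₁ ≡ F → All (λ p → T (proj₂ p ≡ᵇ δ)) ps₁ → ps ↭ ps₁ ++ ps₂ → xs ↭ flatten ps ++ ys → Goal
    choose δ ps ps₁ ps₂ ys δ<V good len diffs eₚ e = wrap (equal-differences δ F ps₁ (flatten ps₂ ++ ys) 1≤δ len (All.map (λ {((v≤Y , _) , t) → v≤Y , ≡ᵇ⇒≡ _ δ t}) both) e′)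
      where
      both : All (λ p → Pair p × T (proj₂ p ≡ᵇ δ)) ps₁
      both = All.zipWith id (AllP.++⁻ˡ ps₁ (PermP.All-resp-↭ eₚ good) , diffs)
      positive : ∀ ps → length ps ≡ F → All (λ p → Pair p × T (proj₂ p ≡ᵇ δ)) ps → 1 ≤ δ
      positive []            len _ = ⊥-elim (n≮n 0 (≤-trans 1≤F (≤-reflexive (sym len))))
      positive ((_ , d) ∷ _) _ (((_ , 1≤d , _) , t) ∷ _) = subst (1 ≤_) (≡ᵇ⇒≡ d δ t) 1≤d
      1≤δ : 1 ≤ δ
      1≤δ = positive ps₁ len both
      e′ : xs ↭ flatten ps₁ ++ (flatten ps₂ ++ ys)
      e′ = ↭-trans e (↭-trans (PermP.++⁺ʳ ys (flatten-↭ eₚ)) (Perm.↭-reflexive (trans (cong (_++ ys) (flatten-++ ps₁ ps₂)) (++-assoc (flatten ps₁) (flatten ps₂) ys))))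
      wrap : ∃[ n ] (F ≤ n × Progress Y xs δ n (2 * F)) → Goal
      wrap (n , F≤n , pr) = δ , n , 1≤δ , δ<V , F≤n , pr
    from : ∃[ ps ] ∃[ ys ] (length ps ≡ suc (V * F) × All Pair ps × xs ↭ flatten ps ++ ys) → Goal
    from (ps , ys , len , good , e) = pigeon (pigeonhole (λ _ → true) proj₂ V F ps (All.map (λ { (_ , _ , d<V , _) _ → d<V }) good) (≤-reflexive (sym (trans (count-true ps) len))))
      where
      pigeon : ∃[ δ ] (δ < V × F < count (λ p → proj₂ p ≡ᵇ δ) ps) → Goal
      pigeon (δ , δ<V , lt) = many-equal (pick-many (λ p → proj₂ p ≡ᵇ δ) F ps (<⇒≤ lt))
        where
        many-equal : ∃[ ps₁ ] ∃[ ps₂ ] (length ps₁ ≡ F × All (λ p → T (proj₂ p ≡ᵇ δ)) ps₁ × ps ↭ ps₁ ++ ps₂) → Goal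
        many-equal (ps₁ , ps₂ , len₁ , diffs , eₚ) = choose δ ps ps₁ ps₂ ys δ<V good len₁ diffs eₚ e

  -- Differences below `hi` ≤ n are short enough to attach without a gap, and each adds at least
  -- `lo` to the span.
  lengthen : ∀ δ lo hi τ {n c} {{_ : NonZero δ}} {{_ : NonZero hi}} → hi ≤ n → suc (Y / hi) * (δ * suc (suc (2 * lo * g))) + 2 * τ + c ≤ length xs →
    Progress Y xs δ n c → ∃[ n′ ] (τ * lo ≤ δ * n′ × Progress Y xs δ n′ (c + 2 * τ))
  lengthen δ lo hi τ {n} {c} hi≤n many (progress zs rest u e ap len u≤) = from (Extract.extract-many Y g lo hi δ τ rest (Bounded-rest Y g zs e bounded) (Mult-rest Y g zs e mult)
      (+-cancelˡ-≤ c _ _ (≤-trans (≤-reflexive (+-comm c _)) (≤-trans many (≤-trans (≤-reflexive (trans (PermP.↭-length e) (length-++ zs))) (+-monoˡ-≤ (length rest) len))))))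
    where
    Pair = Extract.GoodPair Y g lo hi δ
    Goal = ∃[ n′ ] (τ * lo ≤ δ * n′ × Progress Y xs δ n′ (c + 2 * τ))
    from : ∃[ qs ] ∃[ ys ] (length qs ≡ τ × All Pair qs × rest ↭ flatten qs ++ ys) → Goal
    from (qs , ys , refl , good , e₂) = wrap (AP-pairs Y δ lo {zs} {u} {n} qs
        (All.map (λ { (v≤Y , lo≤d , d<hi , δ∣d) → v≤Y , lo≤d , ≤-trans (<⇒≤ d<hi) (≤-trans hi≤n (≤-trans (n≤1+n n) (m≤n*m (suc n) δ))) , δ∣d }) good) ap)
      where
      wrap : ∃[ u′ ] ∃[ n′ ] (AP (flatten qs ++ zs) u′ δ n′ × u′ ≤ u + length qs * Y × δ * n + length qs * lo ≤ δ * n′) → Goal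
      wrap (u′ , n′ , ap′ , u′≤ , n′≥) = n′ , ≤-trans (m≤n+m _ (δ * n)) n′≥ ,
        progress (flatten qs ++ zs) ys u′ e′ ap′
          (≤-trans (≤-reflexive (trans (length-++ (flatten qs)) (trans (cong (_+ length zs) (length-flatten qs)) (+-comm _ (length zs))))) (+-monoˡ-≤ (2 * length qs) len))
          (≤-trans u′≤ (≤-trans (+-mono-≤ u≤ (*-monoˡ-≤ Y (m≤n*m (length qs) 2))) (≤-reflexive (sym (*-distribʳ-+ Y c (2 * length qs))))))
        where
        e′ : xs ↭ (flatten qs ++ zs) ++ ys
        e′ = ↭-trans e (↭-trans (PermP.++⁺ˡ zs e₂) (↭-trans (PermP.shifts zs (flatten qs) {ys}) (Perm.↭-reflexive (sym (++-assoc (flatten qs) zs ys)))))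

  unit-step : ∀ V δ {n c} → 1 ≤ δ → δ ≤ V → suc (2 * δ) * Y ≤ δ * n → (∀ q → Prime q → q ≤ V → V * V + 2 * δ + c ≤ count (indivisible q) xs) →
    Progress Y xs δ n c → ∃[ n′ ] (Y ≤ n′ × Progress Y xs 1 n′ (c + 2 * δ))
  unit-step V δ {n} {c} 1≤δ δ≤V span units (progress zs rest u e ap len u≤) =
    from (descend Y V δ 1≤δ δ≤V zs rest u n c ap len u≤ span (Bounded-rest Y g zs e bounded) counts)
    where
    counts : ∀ q → Prime q → q ≤ V → V * V + 2 * δ ≤ count (indivisible q) rest
    counts q qp q≤V = +-cancelʳ-≤ c _ _ (≤-trans (units q qp q≤V) (≤-trans (count-rest (indivisible q) zs e) (≤-trans (+-monoˡ-≤ _ len) (≤-reflexive (+-comm c _)))))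
    from : ∃[ zs′ ] ∃[ rest′ ] ∃[ u′ ] ∃[ n′ ] (zs ++ rest ↭ zs′ ++ rest′ × AP zs′ u′ 1 n′ × length zs′ ≤ c + 2 * δ × u′ ≤ (c + 2 * δ) * Y × Y ≤ n′) →
      ∃[ n′ ] (Y ≤ n′ × Progress Y xs 1 n′ (c + 2 * δ))
    from (zs′ , rest′ , u′ , n′ , e′ , ap′ , len′ , u′≤ , Y≤) = n′ , Y≤ , progress zs′ rest′ u′ (↭-trans e e′) ap′ len′ u′≤

  -- A block of more than Y consecutive sums absorbs every remaining element, each being at most Y,
  -- without a gap.
  all-sums : ∀ {n c} → Y ≤ n → Progress Y xs 1 n c →
    ∃[ zs ] ∃[ rest ] (xs ↭ zs ++ rest × length zs ≤ c × (∀ t → c * Y ≤ t → t ≤ total rest → Sub xs t))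
  all-sums {n} {c} Y≤n (progress zs rest u e ap len u≤) = zs , rest , e , len , every
    where
    every : ∀ t → c * Y ≤ t → t ≤ total rest → Sub xs t
    every t cY≤t t≤ = Sub-↭ (↭-trans (PermP.++-comm rest zs) (↭-sym e))
      (subst (Sub (rest ++ zs)) (trans (cong (_+_ u) (*-identityˡ (t ∸ u))) (m+[n∸m]≡n (≤-trans u≤ cY≤t)))
        (AP-singles {zs} {u} {n} Y Y≤n ap rest (Bounded-rest Y g zs e bounded) (t ∸ u) (≤-trans (m∸n≤m t u) (≤-trans t≤ (m≤m+n _ n)))))

  -- First many equal differences δ, then differences divisible by δ until the progression is
  -- long, then elements outside every proper subgroup to bring the step down to 1, and finally
  -- everything else.
  complete-sums : ∀ V F lo hi τ c {{_ : NonZero V}} {{_ : NonZero hi}} → hi ≤ F →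
    suc (Y / V) * suc (suc (2 * g)) + 2 * suc (V * F) ≤ length xs →
    suc (Y / hi) * (V * suc (suc (2 * lo * g))) + 2 * τ + 2 * F ≤ length xs →
    suc (2 * V) * Y ≤ τ * lo →
    (∀ q → Prime q → q ≤ V → V * V + 2 * V + (2 * F + 2 * τ) ≤ count (indivisible q) xs) →
    2 * F + 2 * τ + 2 * V ≤ c →
    ∃[ zs ] ∃[ rest ] (xs ↭ zs ++ rest × length zs ≤ c × (∀ t → c * Y ≤ t → t ≤ total rest → Sub xs t))
  complete-sums V F lo hi τ c hi≤F many₁ many₂ long units used = first (common-difference V F (≤-trans (>-nonZero⁻¹ hi) hi≤F) many₁)
    where
    Goal = ∃[ zs ] ∃[ rest ] (xs ↭ zs ++ rest × length zs ≤ c × (∀ t → c * Y ≤ t → t ≤ total rest → Sub xs t))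
    first : ∃[ δ ] ∃[ n ] (1 ≤ δ × δ < V × F ≤ n × Progress Y xs δ n (2 * F)) → Goal
    first (δ , n , 1≤δ , δ<V , F≤n , pr) = second (lengthen δ lo hi τ {{>-nonZero 1≤δ}} (≤-trans hi≤F F≤n)
        (≤-trans (+-monoˡ-≤ (2 * F) (+-monoˡ-≤ (2 * τ) (*-monoʳ-≤ (suc (Y / hi)) (*-monoˡ-≤ (suc (suc (2 * lo * g))) (<⇒≤ δ<V))))) many₂) pr)
      where
      third : ∃[ n′ ] (Y ≤ n′ × Progress Y xs 1 n′ (2 * F + 2 * τ + 2 * δ)) → Goal
      third (n′ , Y≤n′ , pr) = weaken (all-sums Y≤n′ pr)
        where
        c′≤c : 2 * F + 2 * τ + 2 * δ ≤ c
        c′≤c = ≤-trans (+-monoʳ-≤ (2 * F + 2 * τ) (*-monoʳ-≤ 2 (<⇒≤ δ<V))) used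
        weaken : ∃[ zs ] ∃[ rest ] (xs ↭ zs ++ rest × length zs ≤ 2 * F + 2 * τ + 2 * δ × (∀ t → (2 * F + 2 * τ + 2 * δ) * Y ≤ t → t ≤ total rest → Sub xs t)) → Goal
        weaken (zs , rest , e , len , every) = zs , rest , e , ≤-trans len c′≤c , λ t lo t≤ → every t (≤-trans (*-monoˡ-≤ Y c′≤c) lo) t≤
      second : ∃[ n′ ] (τ * lo ≤ δ * n′ × Progress Y xs δ n′ (2 * F + 2 * τ)) → Goal
      second (n′ , n′≥ , pr) = third (unit-step V δ 1≤δ (<⇒≤ δ<V) (≤-trans (*-monoˡ-≤ Y (s≤s (*-monoʳ-≤ 2 (<⇒≤ δ<V)))) (≤-trans long n′≥))
        (λ q qp q≤V → ≤-trans (+-monoˡ-≤ (2 * F + 2 * τ) (+-monoʳ-≤ (V * V) (*-monoʳ-≤ 2 (<⇒≤ δ<V)))) (units q qp q≤V)) pr)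

-- Windows of consecutive primes

∑-window : ∀ a n m {g : ℕ → ℕ} → a + n ≤ m → ∑ n (λ u → g (a + u)) ≤ ∑ m g
∑-window a n m {g} le = begin
  ∑ n (λ u → g (a + u))  ≤⟨ m≤n+m _ (∑ a g) ⟩
  ∑ a g + ∑ n (λ u → g (a + u))  ≡⟨ sym (∑-split a n) ⟩
  ∑ (a + n) g  ≤⟨ m≤m+n _ _ ⟩
  ∑ (a + n) g + ∑ (m ∸ (a + n)) (λ u → g (a + n + u))  ≡⟨ sym (∑-split (a + n) (m ∸ (a + n))) ⟩
  ∑ (a + n + (m ∸ (a + n))) g  ≡⟨ cong (λ x → ∑ x g) (m+[n∸m]≡n le) ⟩
  ∑ m g  ∎
  where open ≤-Reasoning

module PrimeWindow {P : ℕ → ℕ} (isEnum : IsPrimeEnumeration P) where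

  open PrimeIndex isEnum

  primeSum-step : ∀ f i → 1 ≤ i → primeSum f (P (suc i)) ≡ primeSum f (P i) ℤ.+ f (P (suc i))
  primeSum-step f i 1≤i = begin
    primeSum f (P (suc i))  ≡⟨ cong (primeSum f) (sym P≡) ⟩
    ∑ᶻ (P i + γ) h ℤ.+ h (P i + γ)  ≡⟨ cong₂ ℤ._+_ (trans (∑ᶻ-split (P i) γ) (trans (cong (λ x → primeSum f (P i) ℤ.+ x) (∑ᶻ-0 γ gap-zero)) (ℤP.+-identityʳ (primeSum f (P i))))) last ⟩
    primeSum f (P i) ℤ.+ f (P (suc i))  ∎
    where
    open ≡-Reasoning
    h : ℕ → ℤ
    h j = f (suc j) when isPrime (suc j)
    γ = P (suc i) ∸ suc (P i)
    P≡ : suc (P i + γ) ≡ P (suc i)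
    P≡ = m+[n∸m]≡n (strict i 1≤i)
    last : h (P i + γ) ≡ f (P (suc i))
    last rewrite P≡ | dec-true (prime? (P (suc i))) (prime (suc i) (s≤s z≤n)) = refl
    gap-zero : ∀ j → j < γ → h (P i + j) ≡ 0ℤ
    gap-zero j j<γ = cong (f (suc (P i + j)) when_) (dec-false (prime? (suc (P i + j))) between)
      where
      between : ¬ Prime (suc (P i + j))
      between pp with complete (suc (P i + j)) pp
      ... | m , 1≤m , Pm≡ = <⇒≱ (P-cancel-< {m} (s≤s z≤n) (≤-trans (≤-reflexive (cong suc Pm≡)) (≤-trans (s≤s (≤-trans (≤-reflexive (sym (+-suc (P i) j))) (+-monoʳ-≤ (P i) j<γ))) (≤-reflexive P≡))))
                                  (P-cancel-< {i} 1≤m (≤-trans (s≤s (m≤m+n (P i) j)) (≤-reflexive (sym Pm≡))))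

  primeSum-window : ∀ f n d → 1 ≤ n → primeSum f (P (n + d)) ≡ primeSum f (P n) ℤ.+ ∑ᶻ d (λ i → f (P (n + suc i)))
  primeSum-window f n zero    1≤n = trans (cong (primeSum f ∘ P) (+-identityʳ n)) (sym (ℤP.+-identityʳ _))
  primeSum-window f n (suc d) 1≤n = begin
    primeSum f (P (n + suc d))  ≡⟨ cong (primeSum f ∘ P) (+-suc n d) ⟩
    primeSum f (P (suc (n + d)))  ≡⟨ primeSum-step f (n + d) (≤-trans 1≤n (m≤m+n n d)) ⟩
    primeSum f (P (n + d)) ℤ.+ f (P (suc (n + d)))  ≡⟨ cong₂ ℤ._+_ (primeSum-window f n d 1≤n) (cong (f ∘ P) (sym (+-suc n d))) ⟩
    primeSum f (P n) ℤ.+ ∑ᶻ d (λ i → f (P (n + suc i))) ℤ.+ f (P (n + suc d))  ≡⟨ ℤP.+-assoc (primeSum f (P n)) _ _ ⟩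
    primeSum f (P n) ℤ.+ ∑ᶻ (suc d) (λ i → f (P (n + suc i)))  ∎
    where open ≡-Reasoning

  -- If q divides ⌊p^(1/k)⌋ then the phase of p lies in one q-th of the circle, so for a
  -- 1/(2q) fraction of the shifts t the wave takes the value -1 at p.
  module Avoid {k : ℕ} (1≤k : 1 ≤ k) (q w : ℕ) (2≤q : 2 ≤ q) {{w≢0 : NonZero w}} where

    instance
      b≢0 : NonZero (2 * q)
      b≢0 = m*n≢0 2 q {{_}} {{>-nonZero (<⇒≤ 2≤q)}}
      N≢0 : NonZero (2 * w)
      N≢0 = m*n≢0 2 w

    open Shifts k (2 * q) w (2 * w) public

    4w≤M : 4 * w ≤ M
    4w≤M = *-monoˡ-≤ w (*-monoʳ-≤ 2 2≤q)

    -- If q divides the root a, then N a is a multiple of M, so `A p` lies in [0, 2w) modulo M.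
    -- Adding w + u moves it into [w, 4w), which lies in [w, M) because q ≥ 2.
    avoided : ∀ p u → u < w → q ∣ iroot k p → f (w + u) p ≡ ℤ.- 1ℤ
    avoided p u u<w (divides a′ a≡) = φ-out (A p + (w + u)) (subst (w ≤_) (sym residue) (≤-trans (m≤m+n w u) (m≤n+m (w + u) r)))
      where
      N = 2 * w
      a = iroot k p
      Na≤A : N * a ≤ A p
      Na≤A = iroot-greatest k _ (N * a) 1≤k (≤-trans (≤-reflexive (^-distribʳ-* k N a)) (*-monoʳ-≤ (N ^ k) (iroot-lower k p 1≤k)))
      A<N+Na : A p < N + N * a
      A<N+Na = pow-cancel-< k (≤-<-trans (iroot-lower k (N ^ k * p) 1≤k) (<-≤-trans (*-monoʳ-< (N ^ k) {{m^n≢0 N k}} (iroot-upper k p 1≤k))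
                 (≤-reflexive (trans (sym (^-distribʳ-* k N (suc a))) (cong (_^ k) (*-suc N a))))))
      r = A p ∸ N * a
      r<N : r < N
      r<N = m<n+o⇒m∸n<o (A p) (N * a) (≤-trans A<N+Na (≤-reflexive (+-comm N (N * a))))
      residue : (A p + (w + u)) % M ≡ r + (w + u)
      residue = begin
        (A p + (w + u)) % M  ≡⟨ cong (λ x → (x + (w + u)) % M) (sym (m∸n+n≡m Na≤A)) ⟩
        (r + N * a + (w + u)) % M  ≡⟨ cong (_% M) (trans (cong (λ a → r + N * a + (w + u)) a≡) (lemma r w a′ q u)) ⟩
        (r + (w + u) + a′ * M) % M  ≡⟨ [m+kn]%n≡m%n (r + (w + u)) a′ M ⟩
        (r + (w + u)) % M  ≡⟨ m<n⇒m%n≡m (<-≤-trans (+-mono-≤-< (<⇒≤ r<N) (+-monoʳ-< w u<w)) (≤-trans (≤-reflexive (lemma₂ w)) 4w≤M)) ⟩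
        r + (w + u)  ∎
        where
        open ≡-Reasoning
        lemma : ∀ r w a q u → r + 2 * w * (a * q) + (w + u) ≡ r + (w + u) + a * (2 * q * w)
        lemma = solve-∀
        lemma₂ : ∀ w → 2 * w + (w + w) ≡ 4 * w
        lemma₂ = solve-∀

    f+1≤ : ∀ p u → u < w → ℤ.∣ f (w + u) p ℤ.+ 1ℤ ∣ ≤ 2 * q * indicator (indivisible q (iroot k p))
    f+1≤ p u u<w with q ∣? iroot k p
    ... | yes q∣a rewrite avoided p u u<w q∣a = z≤n
    ... | no _    = ≤-trans (≤-reflexive (trans (cong ℤ.∣_∣ (lemma (+ (2 * q) ℤ.* + χ a))) (ℤP.abs-* (+ (2 * q)) (+ χ a)))) (*-monoʳ-≤ (2 * q) (χ≤1 a))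
      where
      a = A p + (w + u)
      lemma : ∀ x → x ℤ.- 1ℤ ℤ.+ 1ℤ ≡ x
      lemma = solve-∀ᶻ
      χ≤1 : ∀ a → χ a ≤ 1
      χ≤1 a with (a % M) <ᵇ w
      ... | true  = ≤-refl
      ... | false = z≤n

    exceptions : ℕ → ℕ → ℕ
    exceptions n d = ∑ d (λ i → indicator (indivisible q (iroot k (P (n + suc i)))))

    -- Write 1 = (f + 1) - f: the first part vanishes at multiples of q and is at most 2q elsewhere,
    -- the second is a difference of two prime sums.
    shift-bound : ∀ n d u → 1 ≤ n → u < w →
      d ≤ ℤ.∣ primeSum (f (w + u)) (P (n + d)) ∣ + ℤ.∣ primeSum (f (w + u)) (P n) ∣ + 2 * q * exceptions n d
    shift-bound n d u 1≤n u<w = begin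
      d  ≡⟨ cong ℤ.∣_∣ (trans (sym (ℤP.*-identityʳ (+ d))) (sym (∑ᶻ-const d 1ℤ))) ⟩
      ℤ.∣ ∑ᶻ d (λ _ → 1ℤ) ∣  ≡⟨ cong ℤ.∣_∣ count-as-sum ⟩
      ℤ.∣ ∑ᶻ d (λ i → g i ℤ.+ 1ℤ) ℤ.- (S₂ ℤ.- S₁) ∣  ≤⟨ ℤP.∣i-j∣≤∣i∣+∣j∣ (∑ᶻ d (λ i → g i ℤ.+ 1ℤ)) (S₂ ℤ.- S₁) ⟩
      ℤ.∣ ∑ᶻ d (λ i → g i ℤ.+ 1ℤ) ∣ + ℤ.∣ S₂ ℤ.- S₁ ∣  ≤⟨ +-mono-≤ deviation (ℤP.∣i-j∣≤∣i∣+∣j∣ S₂ S₁) ⟩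
      2 * q * exceptions n d + (ℤ.∣ S₂ ∣ + ℤ.∣ S₁ ∣)  ≡⟨ +-comm (2 * q * exceptions n d) _ ⟩
      ℤ.∣ S₂ ∣ + ℤ.∣ S₁ ∣ + 2 * q * exceptions n d  ∎
      where
      open ≤-Reasoning
      g : ℕ → ℤ
      g i = f (w + u) (P (n + suc i))
      S₂ = primeSum (f (w + u)) (P (n + d))
      S₁ = primeSum (f (w + u)) (P n)
      lemma : ∀ G o → o ≡ (G ℤ.+ o) ℤ.- G
      lemma = solve-∀ᶻ
      lemma₂ : ∀ G S → G ≡ (S ℤ.+ G) ℤ.- S
      lemma₂ = solve-∀ᶻ
      count-as-sum : ∑ᶻ d (λ _ → 1ℤ) ≡ ∑ᶻ d (λ i → g i ℤ.+ 1ℤ) ℤ.- (S₂ ℤ.- S₁)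
      count-as-sum = trans (lemma (∑ᶻ d g) _) (cong₂ ℤ._-_ (sym (∑ᶻ-+ d)) (trans (lemma₂ (∑ᶻ d g) S₁) (cong (ℤ._- S₁) (sym (primeSum-window (f (w + u)) n d 1≤n)))))
      deviation : ℤ.∣ ∑ᶻ d (λ i → g i ℤ.+ 1ℤ) ∣ ≤ 2 * q * exceptions n d
      deviation = ≤-trans (∣∑ᶻ∣≤∑∣∣ d) (≤-trans (∑-mono d (λ i _ → f+1≤ (P (n + suc i)) u u<w)) (≤-reflexive (∑-*ˡ d (2 * q))))

    -- Summed over the w shifts, `shift-bound` loses 8 M X / W = 16 q w X / W to the prime sums,
    -- that is 16 q X / W ≤ d / 2 per shift, so the exceptions account for the other half of d.
    many-exceptions : ∀ W n d → 1 ≤ n →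
      W * ∑ M (λ t → ℤ.∣ primeSum (f t) (P (n + d)) ∣) ≤ 4 * M * P (n + d) →
      W * ∑ M (λ t → ℤ.∣ primeSum (f t) (P n) ∣) ≤ 4 * M * P n →
      32 * q * P (n + d) ≤ W * d → 1 ≤ W → d ≤ 4 * q * exceptions n d
    many-exceptions W n d 1≤n equi₂ equi₁ X≤ 1≤W = *-cancelˡ-≤ W {{>-nonZero 1≤W}} (+-cancelˡ-≤ (W * d) _ _ (begin
      W * d + W * d  ≤⟨ +-mono-≤ Wd≤ Wd≤ ⟩
      2 * q * (8 * X₂ + W * e) + 2 * q * (8 * X₂ + W * e)  ≡⟨ lemma₃ q X₂ W e ⟩
      32 * q * X₂ + W * (4 * q * e)  ≤⟨ +-monoˡ-≤ (W * (4 * q * e)) X≤ ⟩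
      W * d + W * (4 * q * e)  ∎))
      where
      open ≤-Reasoning
      X₂ = P (n + d)
      X₁ = P n
      e = exceptions n d
      σ₂ : ℕ → ℕ
      σ₂ t = ℤ.∣ primeSum (f t) X₂ ∣
      σ₁ : ℕ → ℕ
      σ₁ t = ℤ.∣ primeSum (f t) X₁ ∣
      X₁≤X₂ : X₁ ≤ X₂
      X₁≤X₂ = P-≤⇒ 1≤n (m≤m+n n d)
      2w≤M : w + w ≤ M
      2w≤M = ≤-trans (≤-trans (m≤m+n (w + w) (w + w)) (≤-reflexive (lemma w))) 4w≤M
        where
        lemma : ∀ w → w + w + (w + w) ≡ 4 * w
        lemma = solve-∀
      wd≤ : w * d ≤ ∑ M σ₂ + ∑ M σ₁ + w * (2 * q * e)
      wd≤ = begin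
        w * d  ≡⟨ sym (∑-const w d) ⟩
        ∑ w (λ _ → d)  ≤⟨ ∑-mono w (λ u u<w → shift-bound n d u 1≤n u<w) ⟩
        ∑ w (λ u → σ₂ (w + u) + σ₁ (w + u) + 2 * q * e)  ≡⟨ trans (∑-+ w) (cong₂ _+_ (∑-+ w) (∑-const w (2 * q * e))) ⟩
        ∑ w (λ u → σ₂ (w + u)) + ∑ w (λ u → σ₁ (w + u)) + w * (2 * q * e)  ≤⟨ +-monoˡ-≤ _ (+-mono-≤ (∑-window w w M 2w≤M) (∑-window w w M 2w≤M)) ⟩
        ∑ M σ₂ + ∑ M σ₁ + w * (2 * q * e)  ∎
      Wd≤ : W * d ≤ 2 * q * (8 * X₂ + W * e)
      Wd≤ = *-cancelˡ-≤ w (begin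
        w * (W * d)  ≡⟨ lemma₁ w W d ⟩
        W * (w * d)  ≤⟨ *-monoʳ-≤ W wd≤ ⟩
        W * (∑ M σ₂ + ∑ M σ₁ + w * (2 * q * e))  ≡⟨ lemma₂ W (∑ M σ₂) (∑ M σ₁) (w * (2 * q * e)) ⟩
        W * ∑ M σ₂ + W * ∑ M σ₁ + W * (w * (2 * q * e))  ≤⟨ +-monoˡ-≤ _ (+-mono-≤ equi₂ (≤-trans equi₁ (*-monoʳ-≤ (4 * M) X₁≤X₂))) ⟩
        4 * M * X₂ + 4 * M * X₂ + W * (w * (2 * q * e))  ≡⟨ lemma₄ q w X₂ W e ⟩
        w * (2 * q * (8 * X₂ + W * e))  ∎)
        where
        lemma₁ : ∀ w W d → w * (W * d) ≡ W * (w * d)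
        lemma₁ = solve-∀
        lemma₂ : ∀ W a c x → W * (a + c + x) ≡ W * a + W * c + W * x
        lemma₂ = solve-∀
        lemma₄ : ∀ q w x W e → 4 * (2 * q * w) * x + 4 * (2 * q * w) * x + W * (w * (2 * q * e)) ≡ w * (2 * q * (8 * x + W * e))
        lemma₄ = solve-∀
      lemma₃ : ∀ q x W e → 2 * q * (8 * x + W * e) + 2 * q * (8 * x + W * e) ≡ 32 * q * x + W * (4 * q * e)
      lemma₃ = solve-∀

-- Λ will be comparable with the logarithm of the primes considered, so that _≼_ tracks polylogarithmic factors.
module PowersOf (Λ : ℕ) (100≤Λ : 100 ≤ Λ) where

  instance
    Λ≢0 : NonZero Λ
    Λ≢0 = >-nonZero (≤-trans (s≤s z≤n) 100≤Λ)

  infix 4 _≼_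

  -- Both indices stay visible in the type, so the exponent of a composite bound is read off from
  -- `⊗` and `⊕`.
  data _≼_ (x a : ℕ) : Set where
    pow : x ≤ Λ ^ a → x ≼ a

  bound : ∀ {x a} → x ≼ a → x ≤ Λ ^ a
  bound (pow le) = le

  power : ∀ a → Λ ^ a ≼ a
  power a = pow ≤-refl

  infixl 7 _⊗_
  infixl 6 _⊕_

  _⊗_ : ∀ {x y a c} → x ≼ a → y ≼ c → x * y ≼ a + c
  _⊗_ {a = a} {c} (pow p) (pow q) = pow (≤-trans (*-mono-≤ p q) (≤-reflexive (sym (^-distribˡ-+-* Λ a c))))

  _⊕_ : ∀ {x y a} → x ≼ a → y ≼ a → x + y ≼ suc a
  _⊕_ {a = a} (pow p) (pow q) = pow (≤-trans (+-mono-≤ p q) (≤-trans (≤-reflexive (cong (_+_ (Λ ^ a)) (sym (+-identityʳ (Λ ^ a))))) (*-monoˡ-≤ (Λ ^ a) (≤-trans (s≤s (s≤s z≤n)) 100≤Λ))))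

  raise : ∀ {x a} c → a ≤ c → x ≼ a → x ≼ c
  raise c a≤c (pow p) = pow (≤-trans p (^-monoʳ-≤ Λ a≤c))

  lift : ∀ {x a} c {_ : T (a ≤ᵇ c)} → x ≼ a → x ≼ c
  lift {a = a} c {t} p = raise c (≤ᵇ⇒≤ a c t) p

  const : ∀ n {_ : T (n ≤ᵇ 100)} → n ≼ 1
  const n {t} = pow (≤-trans (≤-trans (≤ᵇ⇒≤ n 100 t) 100≤Λ) (≤-reflexive (sym (*-identityʳ Λ))))

  powᵏ : ∀ {x a} k → x ≼ a → x ^ k ≤ (Λ ^ a) ^ k
  powᵏ k (pow p) = ^-monoˡ-≤ k p

  Λ^-mono : ∀ a c → a ≤ c → Λ ^ a ≤ Λ ^ c
  Λ^-mono a c a≤c = ^-monoʳ-≤ Λ a≤c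

  Λ^≢0 : ∀ a → NonZero (Λ ^ a)
  Λ^≢0 a = m^n≢0 Λ a

-- Choice of the parameters

module PrimesAvoiding {P : ℕ → ℕ} (isEnum : IsPrimeEnumeration P) {k : ℕ} (2≤k : 2 ≤ k) (ℓ : ℕ) (1≤ℓ : 1 ≤ ℓ)
  (100≤Λ : 100 ≤ 2 ^ ℓ) (c≤Λ : k * 2 ^ k ≤ 2 ^ ℓ) where

  Λ : ℕ
  Λ = 2 ^ ℓ

  open PowersOf Λ 100≤Λ
  open PrimeIndex isEnum

  private
    c = k * 2 ^ k
    -- 2 ^ r = Λ ^ 303 absorbs the discarded terms of Legendre's recursion; G below exceeds the (z₀ + 1) ^ r others.
    r = 303 * ℓ
    -- Constants and sums cost one power of Λ each; q ≤ Λ^5 makes 2q at most Λ^6. The exponent 9 of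
    -- W covers 32 q Λ², 11 covers 6 Λ W, 29 covers 9 s² · 2q, 108 = 35 + 35 + 6 + 32 covers M² · 2q
    -- · (4c + 40N) with M at most Λ^35, and 143 = 108 + 35 covers K M. Finally 303 = 9 + 6 + 144 +
    -- 144 covers W · 2q · (z₀ + 1)(z₀ + 2).
    s = Λ ^ 11
    w = Λ ^ 29
    N = 2 * w
    K = Λ ^ 108
    z₀ = Λ ^ 143
    W = Λ ^ 9
    1≤k : 1 ≤ k
    1≤k = <⇒≤ 2≤k
    instance
      w≢0 : NonZero w
      w≢0 = Λ^≢0 29
      K≢0 : NonZero K
      K≢0 = Λ^≢0 108

  G : ℕ
  G = Λ ^ (144 * r + 300)

  module _ (q : ℕ) (2≤q : 2 ≤ q) (q≤ : q ≤ Λ ^ 5) where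

    open PrimeWindow.Avoid isEnum 1≤k q w 2≤q

    private
      c≼ : c ≼ 1
      c≼ = pow (≤-trans c≤Λ (≤-reflexive (sym (*-identityʳ Λ))))
      b≼ : 2 * q ≼ 6
      b≼ = const 2 ⊗ pow q≤
      M≼ : M ≼ 35
      M≼ = b≼ ⊗ power 29
      N≼ : N ≼ 30
      N≼ = const 2 ⊗ power 29
      suc-z₀≼ : suc z₀ ≼ 144
      suc-z₀≼ = lift 143 (const 1) ⊕ power 143
      suc-suc-z₀≼ : suc (suc z₀) ≼ 144
      suc-suc-z₀≼ = lift 143 (const 2) ⊕ power 143
      2≤r : 2 ≤ r
      2≤r = ≤-trans (s≤s (s≤s z≤n)) (*-monoʳ-≤ 303 1≤ℓ)
      e₀ = 144 * r
      588≤ : 588 ≤ e₀ + 300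
      588≤ = +-monoˡ-≤ 300 (*-monoʳ-≤ 144 2≤r)

    module _ (X : ℕ) (G^k≤X : G ^ k ≤ X) (X<4^Λ : X < 2 ^ Λ * 2 ^ Λ) where

      private
        instance
          G≢0 : NonZero G
          G≢0 = Λ^≢0 (e₀ + 300)
        square≤X : ∀ {x a} → a ≤ e₀ + 300 → x ≼ a → x * x ≤ X
        square≤X {x} a≤ p = ≤-trans (*-mono-≤ (bound (raise _ a≤ p)) (bound (raise _ a≤ p))) (≤-trans (≤-trans (≤-reflexive (cong (G *_) (sym (*-identityʳ G)))) (^-monoʳ-≤ G 2≤k)) G^k≤X)
        small : ∀ {a} {_ : T (a ≤ᵇ 588)} → a ≤ e₀ + 300
        small {a} {t} = ≤-trans (≤ᵇ⇒≤ a 588 t) 588≤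
        1≤X : 1 ≤ X
        1≤X = ≤-trans (>-nonZero⁻¹ (G ^ k) {{m^n≢0 G k}}) G^k≤X
        I = 2 * (8 * K * M * c) * K
        I≼ : I ≼ 254
        I≼ = const 2 ⊗ (const 8 ⊗ power 108 ⊗ M≼ ⊗ c≼) ⊗ power 108
        H≤ : 2 * I ^ k ≤ (Λ ^ 255) ^ k
        H≤ = begin
          2 * I ^ k  ≤⟨ *-monoˡ-≤ (I ^ k) (n≤n^k k 2 1≤k) ⟩
          2 ^ k * I ^ k  ≡⟨ sym (^-distribʳ-* k 2 I) ⟩
          (2 * I) ^ k  ≤⟨ powᵏ k (const 2 ⊗ I≼) ⟩
          (Λ ^ 255) ^ k  ∎
          where open ≤-Reasoning
        H²≤X : 2 * I ^ k * (2 * I ^ k) ≤ X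
        H²≤X = begin
          2 * I ^ k * (2 * I ^ k)  ≤⟨ *-mono-≤ H≤ H≤ ⟩
          (Λ ^ 255) ^ k * (Λ ^ 255) ^ k  ≡⟨ sym (^-distribʳ-* k (Λ ^ 255) (Λ ^ 255)) ⟩
          (Λ ^ 255 * Λ ^ 255) ^ k  ≤⟨ powᵏ k (raise (e₀ + 300) small (power 255 ⊗ power 255)) ⟩
          G ^ k  ≤⟨ G^k≤X ⟩
          X  ∎
          where open ≤-Reasoning
        M-large : 9 * (s * s) * (2 * q * (2 * q)) ≤ M
        M-large = ≤-trans (≤-reflexive (lemma (9 * (s * s)) (2 * q))) (*-monoʳ-≤ (2 * q) (bound (const 9 ⊗ (power 11 ⊗ power 11) ⊗ b≼)))
          where
          lemma : ∀ a b → a * (b * b) ≡ b * (a * b)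
          lemma = solve-∀
        K-large : M * (M * (2 * q)) * (4 * c + 40 * N) ≤ K
        K-large = bound (M≼ ⊗ (M≼ ⊗ b≼) ⊗ (lift 31 (const 4 ⊗ c≼) ⊕ (const 40 ⊗ N≼)))
        tail-small : W * (2 * q) * (suc z₀ * suc (suc z₀)) ≤ 2 ^ r * 2
        tail-small = begin
          W * (2 * q) * (suc z₀ * suc (suc z₀))  ≤⟨ bound (power 9 ⊗ b≼ ⊗ (suc-z₀≼ ⊗ suc-suc-z₀≼)) ⟩
          Λ ^ 303  ≡⟨ trans (^-*-assoc 2 ℓ 303) (cong (2 ^_) (*-comm ℓ 303)) ⟩
          2 ^ r  ≤⟨ m≤m*n (2 ^ r) 2 ⟩
          2 ^ r * 2  ∎
          where open ≤-Reasoning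
        -- The coefficient of Y in `main-small`: 9 from W, e₀ from (z₀ + 1)^r and 42 from M · 2q + 2
        -- · 2q.
        Big = Λ ^ (e₀ + 51)
        instance
          Big≢0 : NonZero Big
          Big≢0 = Λ^≢0 (e₀ + 51)
        Y = X / Big
        J = A X
        shift≤ : ∀ {a} d {_ : T (a + d ≤ᵇ 300)} → a + (e₀ + d) ≤ e₀ + 300
        shift≤ {a} d {t} = ≤-trans (≤-reflexive (lemma a e₀ d)) (+-monoʳ-≤ e₀ (≤ᵇ⇒≤ (a + d) 300 t))
          where
          lemma : ∀ a e d → a + (e + d) ≡ e + (a + d)
          lemma = solve-∀
        16cBig≤J : 16 * c * Big ≤ J
        16cBig≤J = iroot-greatest k _ (16 * c * Big) 1≤k (≤-trans (powᵏ k (raise (e₀ + 300) (shift≤ {2} 51) (const 16 ⊗ c≼ ⊗ power (e₀ + 51)))) (≤-trans G^k≤X (m≤n*m X (N ^ k) {{m^n≢0 N k}})))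
        10JBig≤X : 10 * J * Big ≤ X
        10JBig≤X = square-cancel-≤ (begin
          10 * J * Big * (10 * J * Big)  ≡⟨ lemma J Big ⟩
          J * J * (10 * Big * (10 * Big))  ≤⟨ *-monoˡ-≤ (10 * Big * (10 * Big)) (square-from-power k J N X 2≤k (>-nonZero⁻¹ N) 1≤X (iroot-lower k (N ^ k * X) 1≤k)) ⟩
          N * N * X * (10 * Big * (10 * Big))  ≡⟨ lemma₂ N X Big ⟩
          10 * N * Big * (10 * N * Big) * X  ≤⟨ *-monoˡ-≤ X (square≤X (shift≤ {31} 51) (const 10 ⊗ N≼ ⊗ power (e₀ + 51))) ⟩
          X * X  ∎)
          where
          open ≤-Reasoning
          lemma : ∀ j b → 10 * j * b * (10 * j * b) ≡ j * j * (10 * b * (10 * b))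
          lemma = solve-∀
          lemma₂ : ∀ n x b → n * n * x * (10 * b * (10 * b)) ≡ 10 * n * b * (10 * n * b) * x
          lemma₂ = solve-∀
        10J≤Y : 10 * J ≤ Y
        10J≤Y = *≤⇒≤/ (10 * J) Big X 10JBig≤X
        1≤J : 1 ≤ J
        1≤J = iroot-pos k _ 1≤k (≤-trans 1≤X (m≤n*m X (N ^ k) {{m^n≢0 N k}}))
        1≤Y : 1 ≤ Y
        1≤Y = ≤-trans (*-mono-≤ {1} {10} {1} {J} (s≤s z≤n) 1≤J) 10J≤Y
        X≤2BigY : X ≤ 2 * Big * Y
        X≤2BigY = begin
          X  ≤⟨ <⇒≤ (<suc/* X Big) ⟩
          Big + Y * Big  ≤⟨ +-monoˡ-≤ (Y * Big) (≤-trans (≤-reflexive (sym (*-identityˡ Big))) (*-monoˡ-≤ Big 1≤Y)) ⟩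
          Y * Big + Y * Big  ≡⟨ lemma Y Big ⟩
          2 * Big * Y  ∎
          where
          open ≤-Reasoning
          lemma : ∀ y b → y * b + y * b ≡ 2 * b * y
          lemma = solve-∀
        -- Half of J Y pays for each term. The first needs J ≥ 16 c `Big`, true because X ≥ G^k; the
        -- second needs 10 J ≤ Y, true because J is at most N √X by k ≥ 2.
        JY : 4 * c * X + 5 * (J * J) ≤ J * Y
        JY = *-cancelˡ-≤ 2 (begin
          2 * (4 * c * X + 5 * (J * J))  ≡⟨ lemma c X J ⟩
          8 * c * X + J * (10 * J)  ≤⟨ +-mono-≤ (*-monoʳ-≤ (8 * c) X≤2BigY) (*-monoʳ-≤ J 10J≤Y) ⟩
          8 * c * (2 * Big * Y) + J * Y  ≡⟨ cong (_+ J * Y) (lemma₂ c Big Y) ⟩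
          16 * c * Big * Y + J * Y  ≤⟨ +-monoˡ-≤ (J * Y) (*-monoˡ-≤ Y 16cBig≤J) ⟩
          J * Y + J * Y  ≡⟨ cong (_+_ (J * Y)) (sym (+-identityʳ (J * Y))) ⟩
          2 * (J * Y)  ∎)
          where
          open ≤-Reasoning
          lemma : ∀ c x j → 2 * (4 * c * x + 5 * (j * j)) ≡ 8 * c * x + j * (10 * j)
          lemma = solve-∀
          lemma₂ : ∀ c b y → 8 * c * (2 * b * y) ≡ 16 * c * b * y
          lemma₂ = solve-∀
        main-small : W * (suc z₀ ^ r * (M * (2 * q) * Y + 2 * (2 * q))) ≤ X
        main-small = begin
          W * (suc z₀ ^ r * (M * (2 * q) * Y + 2 * (2 * q)))  ≤⟨ *-monoʳ-≤ W (*-mono-≤ (≤-trans (powᵏ r suc-z₀≼) (≤-reflexive (^-*-assoc Λ 144 r))) inner) ⟩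
          Λ ^ 9 * (Λ ^ e₀ * (Λ ^ 42 * Y))  ≡⟨ lemma (Λ ^ 9) (Λ ^ e₀) (Λ ^ 42) Y ⟩
          Y * (Λ ^ e₀ * (Λ ^ 9 * Λ ^ 42))  ≡⟨ cong (Y *_) (trans (cong (Λ ^ e₀ *_) (sym (^-distribˡ-+-* Λ 9 42))) (sym (^-distribˡ-+-* Λ e₀ 51))) ⟩
          Y * Big  ≤⟨ m/n*n≤m X Big ⟩
          X  ∎
          where
          open ≤-Reasoning
          lemma : ∀ a b c y → a * (b * (c * y)) ≡ y * (b * (a * c))
          lemma = solve-∀
          inner : M * (2 * q) * Y + 2 * (2 * q) ≤ Λ ^ 42 * Y
          inner = begin
            M * (2 * q) * Y + 2 * (2 * q)  ≤⟨ +-monoʳ-≤ (M * (2 * q) * Y) (≤-trans (≤-reflexive (sym (*-identityʳ (2 * (2 * q))))) (*-monoʳ-≤ (2 * (2 * q)) 1≤Y)) ⟩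
            M * (2 * q) * Y + 2 * (2 * q) * Y  ≡⟨ sym (*-distribʳ-+ Y (M * (2 * q)) (2 * (2 * q))) ⟩
            (M * (2 * q) + 2 * (2 * q)) * Y  ≤⟨ *-monoˡ-≤ Y (bound ((M≼ ⊗ b≼) ⊕ lift 41 (const 2 ⊗ b≼))) ⟩
            Λ ^ 42 * Y  ∎

      equidistributed : W * ∑ M (λ t → ℤ.∣ primeSum (f t) X ∣) ≤ 4 * M * X
      equidistributed = Equidistribution.equidistribution 2≤k (2 * q) w N K z₀ s Λ W r X
        (≤-trans (≤-trans (s≤s (s≤s z≤n)) 100≤Λ) (m≤m*n Λ (Λ ^ 142) {{Λ^≢0 142}})) (square≤X small (power 143))
        (bound (power 108 ⊗ M≼)) M-large (bound (lift 108 (power 11 ⊗ b≼))) K-large H²≤X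
        Y 1≤X JY tail-small main-small X<4^Λ
        (bound (const 6 ⊗ raise 1 ≤-refl (pow (≤-reflexive (sym (*-identityʳ Λ)))) ⊗ power 9))
        (square≤X small (const 2 ⊗ b≼ ⊗ power 9))

    few-divisible : ∀ n d → 1 ≤ n → G ^ k ≤ P n → P (n + d) < 2 ^ Λ * 2 ^ Λ → 32 * q * P (n + d) ≤ W * d → d ≤ 4 * q * exceptions n d
    few-divisible n d 1≤n G^k≤ P<4^Λ 32qP≤ = many-exceptions W n d 1≤n
      (equidistributed (P (n + d)) (≤-trans G^k≤ P≤P) P<4^Λ) (equidistributed (P n) G^k≤ (≤-<-trans P≤P P<4^Λ)) 32qP≤ (>-nonZero⁻¹ W {{Λ^≢0 9}})
      where
      P≤P : P n ≤ P (n + d)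
      P≤P = P-≤⇒ 1≤n (m≤m+n n d)

-- The upper end of the window

floor-≥ : ∀ z (p : ℚ) → ℚᵘ.mkℚᵘ (+ z) 0 ℚᵘ.≤ ℚ.toℚᵘ p → z ≤ ℤ.∣ ℚ.floor p ∣
floor-≥ z p@(mkℚ i d _) (ℚᵘ.*≤* le) = nonneg (ℚ.floor p) (subst (+ z ℤ.≤_) (sym (ℤD.div-pos-is-/ℕ i (suc d))) z≤)
  where
  nonneg : ∀ j → + z ℤ.≤ j → z ≤ ℤ.∣ j ∣
  nonneg (ℤ.+ m) z≤m = ℤP.drop‿+≤+ z≤m
  z≤ : + z ℤ.≤ i ℤD./ℕ suc d
  z≤ = ℤP.≮⇒≥ (λ lt → ℤP.<⇒≱ (ℤD.n<s[n/ℕd]*d i (suc d)) (ℤP.≤-trans (ℤP.*-monoʳ-≤-nonNeg (+ suc d) (ℤP.i<j⇒suc[i]≤j lt)) (ℤP.≤-trans le (ℤP.≤-reflexive (ℤP.*-identityʳ i)))))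

-- A positive ε is at least 1/D for its denominator D, so integers up to n + n / D lie below the
-- floor. Nothing else about ε is retained.
floorScale-≥ : ∀ ε → Positive ε → ∃[ D ] (1 ≤ D × (∀ n z → z * D ≤ n * D + n → z ≤ floorScale ε n))
floorScale-≥ ε@(mkℚ (ℤ.+ suc a) d′ _) _ = D , s≤s z≤n , bound
  where
  D = suc d′
  bound : ∀ n z → z * D ≤ n * D + n → z ≤ floorScale ε n
  bound n z le = floor-≥ z _ (ℚᵘP.≤-trans raw (ℚᵘP.≤-reflexive (ℚᵘP.≃-sym homo)))
    where
    R : ℚᵘ.ℚᵘ
    R = (ℚ.toℚᵘ ℚ.1ℚ ℚᵘ.+ ℚ.toℚᵘ ε) ℚᵘ.* (ℚᵘ.mkℚᵘ (+ n) 0)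
    homo : ℚ.toℚᵘ ((ℚ.1ℚ ℚ.+ ε) ℚ.* (+ n ℚ./ 1)) ℚᵘ.≃ R
    homo = ℚᵘP.≃-trans (ℚP.toℚᵘ-homo-* (ℚ.1ℚ ℚ.+ ε) (+ n ℚ./ 1)) (ℚᵘP.*-cong (ℚP.toℚᵘ-homo-+ ℚ.1ℚ ε) (ℚP.toℚᵘ-fromℚᵘ (ℚᵘ.mkℚᵘ (+ n) 0)))
    raw : ℚᵘ.mkℚᵘ (+ z) 0 ℚᵘ.≤ R
    raw = ℚᵘ.*≤* (subst₂ ℤ._≤_ (ℤP.pos-* z (1 * D * 1)) rhs (ℤ.+≤+ nat))
      where
      lemma₁ : ∀ z d → z * (1 * d * 1) ≡ z * d
      lemma₁ = solve-∀
      lemma₂ : ∀ n d a → n * d + n + a * n ≡ (1 * d + suc a * 1) * n * 1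
      lemma₂ = solve-∀
      nat : z * (1 * D * 1) ≤ (1 * D + suc a * 1) * n * 1
      nat = ≤-trans (≤-reflexive (lemma₁ z D)) (≤-trans le (≤-trans (m≤m+n (n * D + n) (a * n)) (≤-reflexive (lemma₂ n D a))))
      rhs : + ((1 * D + suc a * 1) * n * 1) ≡ ℚᵘ.↥ R ℤ.* ℚᵘ.↧ ℚᵘ.mkℚᵘ (+ z) 0
      rhs = trans (ℤP.pos-* ((1 * D + suc a * 1) * n) 1) (cong (ℤ._* + 1) (ℤP.pos-* (1 * D + suc a * 1) n))

-- Windows of indices as lists

val-window : (ℕ → ℕ) → ℕ → ℕ → List ℕ
val-window v s zero    = []
val-window v s (suc m) = v s ∷ val-window v (suc s) m

sumFrom-cong : ∀ s m {f g} → (∀ j → s ≤ j → f j ≡ g j) → sumFrom s m f ≡ sumFrom s m g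
sumFrom-cong s zero    eq = refl
sumFrom-cong s (suc m) eq = cong₂ _+_ (eq s ≤-refl) (sumFrom-cong (suc s) m (λ j s<j → eq j (<⇒≤ s<j)))

sumFrom-snoc : ∀ s m f → sumFrom s (suc m) f ≡ sumFrom s m f + f (s + m)
sumFrom-snoc s zero    f = trans (+-identityʳ (f s)) (cong f (sym (+-identityʳ s)))
sumFrom-snoc s (suc m) f = trans (cong (_+_ (f s)) (sumFrom-snoc (suc s) m f)) (trans (sym (+-assoc (f s) _ _)) (cong (λ j → f s + sumFrom (suc s) m f + f j) (sym (+-suc s m))))

module _ (v : ℕ → ℕ) where

  private
    window = val-window v

  length-window : ∀ s m → length (window s m) ≡ m
  length-window s zero    = refl
  length-window s (suc m) = cong suc (length-window (suc s) m)

  All-window : ∀ {Q : ℕ → Set} s m → (∀ j → s ≤ j → j < s + m → Q (v j)) → All Q (window s m)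
  All-window s zero    h = []
  All-window s (suc m) h = h s ≤-refl (m<m+n s (s≤s z≤n)) ∷ All-window (suc s) m (λ j s<j j< → h j (<⇒≤ s<j) (<-≤-trans j< (≤-reflexive (sym (+-suc s m)))))

  count-window : ∀ p s m → count p (window s m) ≡ ∑ m (λ i → indicator (p (v (s + i))))
  count-window p s zero    = refl
  count-window p s (suc m) = begin
    indicator (p (v s)) + count p (window (suc s) m)  ≡⟨ cong₂ _+_ (cong (indicator ∘ p ∘ v) (sym (+-identityʳ s))) (trans (count-window p (suc s) m) (∑-cong m (λ i _ → cong (indicator ∘ p ∘ v) (sym (+-suc s i))))) ⟩
    indicator (p (v (s + 0))) + ∑ m (λ i → indicator (p (v (s + suc i))))  ≡⟨ sym (∑-split 1 m) ⟩
    ∑ (suc m) (λ i → indicator (p (v (s + i))))  ∎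
    where open ≡-Reasoning

  Sub-extend : ∀ s d m {t} → d ≤ m → Sub (window s d) t → Sub (window s m) t
  Sub-extend s zero    m       _         []       = Sub-none (window s m)
  Sub-extend s (suc d) (suc m) (s≤s d≤m) (skip p) = skip (Sub-extend (suc s) d m d≤m p)
  Sub-extend s (suc d) (suc m) (s≤s d≤m) (take p) = take (Sub-extend (suc s) d m d≤m p)

  chosen : (ℕ → Bool) → ℕ → ℕ
  chosen J j = if J j then v j else 0

  override : ℕ → Bool → (ℕ → Bool) → ℕ → Bool
  override s c J j = if j ≡ᵇ s then c else J j

  override-≡ : ∀ s c J → override s c J s ≡ c
  override-≡ s c J with s ≡ᵇ s | ≡⇒≡ᵇ s s refl
  ... | true | _ = refl

  override-> : ∀ s c J j → s < j → override s c J j ≡ J j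
  override-> s c J j s<j with j ≡ᵇ s in eq
  ... | false = refl
  ... | true  = ⊥-elim (<⇒≢ s<j (sym (≡ᵇ⇒≡ j s (subst T (sym eq) _))))

  Sub⇒chosen : ∀ s m {t} → Sub (window s m) t → ∃[ J ] t ≡ sumFrom s m (chosen J)
  Sub⇒chosen s zero    []       = (λ _ → false) , refl
  Sub⇒chosen s (suc m) (skip p) = extend (Sub⇒chosen (suc s) m p)
    where
    extend : ∀ {t} → ∃[ J ] t ≡ sumFrom (suc s) m (chosen J) → ∃[ J ] t ≡ sumFrom s (suc m) (chosen J)
    extend (J , refl) = override s false J , sym (cong₂ _+_ (cong (λ c → if c then v s else 0) (override-≡ s false J))
      (sumFrom-cong (suc s) m (λ j s<j → cong (λ c → if c then v j else 0) (override-> s false J j s<j))))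
  Sub⇒chosen s (suc m) (take p) = extend (Sub⇒chosen (suc s) m p)
    where
    extend : ∀ {t} → ∃[ J ] t ≡ sumFrom (suc s) m (chosen J) → ∃[ J ] v s + t ≡ sumFrom s (suc m) (chosen J)
    extend (J , refl) = override s true J , sym (cong₂ _+_ (cong (λ c → if c then v s else 0) (override-≡ s true J))
      (sumFrom-cong (suc s) m (λ j s<j → cong (λ c → if c then v j else 0) (override-> s true J j s<j))))

length*≤total : ∀ a xs → All (a ≤_) xs → length xs * a ≤ total xs
length*≤total a []       []       = z≤n
length*≤total a (x ∷ xs) (le ∷ h) = +-mono-≤ le (length*≤total a xs h)

-- Complete subset sums in a window of roots

module RootWindow {P : ℕ → ℕ} (isEnum : IsPrimeEnumeration P) {k : ℕ} (1≤k : 1 ≤ k) where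

  open PrimeIndex isEnum

  a : ℕ → ℕ
  a i = iroot k (P i)

  a-mono : ∀ {i j} → 1 ≤ i → i ≤ j → a i ≤ a j
  a-mono 1≤i i≤j = iroot-mono k 1≤k (P-≤⇒ 1≤i i≤j)

  1≤a : ∀ i → 1 ≤ i → 1 ≤ a i
  1≤a i 1≤i = iroot-pos k (P i) 1≤k (<⇒≤ (P≥2 i 1≤i))

  window : ℕ → ℕ → List ℕ
  window = val-window a

  count-below : ∀ r s m → 1 ≤ s → count (_≡ᵇ r) (window s m) ≤ suc r ^ k ∸ P s
  count-below r s zero    1≤s = z≤n
  count-below r s (suc m) 1≤s with a s ≡ᵇ r in eq
  ... | false = ≤-trans (count-below r (suc s) m (s≤s z≤n)) (∸-monoʳ-≤ (suc r ^ k) (<⇒≤ (P-strict s 1≤s)))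
  ... | true  = ≤-trans (s≤s (≤-trans (count-below r (suc s) m (s≤s z≤n)) (∸-monoʳ-≤ (suc r ^ k) (P-strict s 1≤s))))
                  (≤-reflexive (sym (+-∸-assoc 1 P<)))
    where
    P< : P s < suc r ^ k
    P< = subst (λ r → P s < suc r ^ k) (≡ᵇ⇒≡ (a s) r (subst T (sym eq) _)) (iroot-upper k (P s) 1≤k)

  -- Indices with root r belong to distinct primes in [r^k, (r + 1)^k), an interval of length
  -- `Δ k r`.
  count-root≤Δ : ∀ r s m → 1 ≤ s → count (_≡ᵇ r) (window s m) ≤ Δ k r
  count-root≤Δ r s zero    1≤s = z≤n
  count-root≤Δ r s (suc m) 1≤s with a s ≡ᵇ r in eq
  ... | false = count-root≤Δ r (suc s) m (s≤s z≤n)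
  ... | true  = begin
    suc (count (_≡ᵇ r) (window (suc s) m))  ≤⟨ s≤s (≤-trans (count-below r (suc s) m (s≤s z≤n)) (∸-monoʳ-≤ (suc r ^ k) (P-strict s 1≤s))) ⟩
    suc (suc r ^ k ∸ suc (P s))  ≡⟨ sym (+-∸-assoc 1 P<) ⟩
    suc r ^ k ∸ P s  ≤⟨ ∸-monoʳ-≤ (suc r ^ k) r^k≤ ⟩
    suc r ^ k ∸ r ^ k  ≡⟨ trans (cong (_∸ r ^ k) (Δ-step k r)) (m+n∸m≡n (r ^ k) (Δ k r)) ⟩
    Δ k r  ∎
    where
    open ≤-Reasoning
    a≡r : a s ≡ r
    a≡r = ≡ᵇ⇒≡ (a s) r (subst T (sym eq) _)
    P< : P s < suc r ^ k
    P< = subst (λ r → P s < suc r ^ k) a≡r (iroot-upper k (P s) 1≤k)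
    r^k≤ : r ^ k ≤ P s
    r^k≤ = subst (λ r → r ^ k ≤ P s) a≡r (iroot-lower k (P s) 1≤k)

  count-large : ∀ Y r xs → All (_≤ Y) xs → Y < r → count (_≡ᵇ r) xs ≡ 0
  count-large Y r []       []       Y<r = refl
  count-large Y r (x ∷ xs) (le ∷ h) Y<r with x ≡ᵇ r in eq
  ... | false = count-large Y r xs h Y<r
  ... | true  = ⊥-elim (<⇒≱ Y<r (subst (_≤ Y) (≡ᵇ⇒≡ x r (subst T (sym eq) _)) le))

  module _ (Λ : ℕ) (100≤Λ : 100 ≤ Λ) (c≤Λ : k * 2 ^ k ≤ Λ) (n d : ℕ) (1≤n : 1 ≤ n) (Λ^100≤d : Λ ^ 100 ≤ d) (d≤n : d ≤ n)
    (P≤Λ²d : P (n + d) ≤ Λ ^ 2 * d) (P≤Λ²P : P (n + d) ≤ Λ ^ 2 * P n) (Λ^100≤a : Λ ^ 100 ≤ a n)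
    (units : ∀ q → Prime q → q ≤ Λ ^ 5 → d ≤ 4 * q * ∑ d (λ i → indicator (indivisible q (a (n + suc i))))) where

    open PowersOf Λ 100≤Λ

    private
      xs = window (suc n) d
      Y = a (n + d)
      g = Δ k Y
      -- Everything rests on Y g ≤ Λ^3 d. The 5 makes 16 Y g / V at most d. Non-multiples of q ≤ V
      -- number at least d / Λ^6, so τ, about 2 V Y / lo, must be below d / (100 Λ^6), which gives
      -- 18 = 11 + 7. Then 28 = 27 + 1 makes the classes of `lengthen`, about 8 V lo Y g / hi, fit
      -- into d / 4.
      V = Λ ^ 5
      F = Λ ^ 28
      lo = Λ ^ 18
      hi = Λ ^ 28
      instance
        V≢0 : NonZero V
        V≢0 = Λ^≢0 5
        hi≢0 : NonZero hi
        hi≢0 = Λ^≢0 28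
        lo≢0 : NonZero lo
        lo≢0 = Λ^≢0 18
      τ = suc (suc (2 * V) * Y / lo)
      c = 2 * F + 2 * τ + 2 * V

    bounded : All (_≤ Y) xs
    bounded = All-window a (suc n) d (λ j n<j j< → a-mono (≤-trans (s≤s z≤n) n<j) (≤-pred j<))

    mult : Mult Y g xs
    mult r with r ≤? Y
    ... | yes r≤Y = ≤-trans (count-root≤Δ r (suc n) d (s≤s z≤n)) (Δ-mono k r≤Y)
    ... | no r≰Y  = ≤-trans (≤-reflexive (count-large Y r xs bounded (≰⇒> r≰Y))) z≤n

    private
      length-xs : length xs ≡ d
      length-xs = length-window a (suc n) d
      Λ^≤Y : ∀ {e} {_ : T (e ≤ᵇ 100)} → Λ ^ e ≤ Y
      Λ^≤Y {e} {t} = ≤-trans (^-monoʳ-≤ Λ (≤ᵇ⇒≤ e 100 t)) (≤-trans Λ^100≤a (a-mono 1≤n (m≤m+n n d)))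
      small : ∀ {x e} {_ : T (e ≤ᵇ 100)} → x ≼ e → x ≤ d
      small {e = e} {t} p = ≤-trans (bound p) (≤-trans (^-monoʳ-≤ Λ (≤ᵇ⇒≤ e 100 t)) Λ^100≤d)
      1≤Y : 1 ≤ Y
      1≤Y = 1≤a (n + d) (≤-trans 1≤n (m≤m+n n d))
      Δ≥1 : ∀ k → 1 ≤ k → 1 ≤ Δ k Y
      Δ≥1 (suc k) _ = ≤-trans (>-nonZero⁻¹ (Y ^ k) {{m^n≢0 Y k {{>-nonZero 1≤Y}}}}) (m≤n+m (Y ^ k) (suc Y * Δ k Y))
      1≤g : 1 ≤ g
      1≤g = Δ≥1 k 1≤k
      Λ¹ : Λ ≡ Λ ^ 1
      Λ¹ = sym (*-identityʳ Λ)
      Yg≤ : Y * g ≤ Λ ^ 3 * d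
      Yg≤ = begin
        Y * g  ≤⟨ *Δ≤ k Y 1≤Y ⟩
        k * 2 ^ k * Y ^ k  ≤⟨ *-mono-≤ c≤Λ (≤-trans (iroot-lower k (P (n + d)) 1≤k) P≤Λ²d) ⟩
        Λ * (Λ ^ 2 * d)  ≡⟨ sym (*-assoc Λ (Λ ^ 2) d) ⟩
        Λ ^ 3 * d  ∎
        where open ≤-Reasoning
      Y≤ : Y ≤ Λ ^ 3 * d
      Y≤ = ≤-trans (≤-trans (≤-reflexive (sym (*-identityʳ Y))) (*-monoʳ-≤ Y 1≤g)) Yg≤
      Y≤a : Y ≤ Λ ^ 3 * a n
      Y≤a = begin
        Y  ≤⟨ pow-cancel-≤ k 1≤k powers ⟩
        Λ ^ 2 * suc (a n)  ≤⟨ *-monoʳ-≤ (Λ ^ 2) (≤-trans (+-monoˡ-≤ (a n) (1≤a n 1≤n)) (≤-reflexive (cong (_+_ (a n)) (sym (+-identityʳ (a n)))))) ⟩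
        Λ ^ 2 * (2 * a n)  ≡⟨ sym (*-assoc (Λ ^ 2) 2 (a n)) ⟩
        Λ ^ 2 * 2 * a n  ≤⟨ *-monoˡ-≤ (a n) (bound (power 2 ⊗ const 2)) ⟩
        Λ ^ 3 * a n  ∎
        where
        open ≤-Reasoning
        powers : Y ^ k ≤ (Λ ^ 2 * suc (a n)) ^ k
        powers = begin
          Y ^ k  ≤⟨ iroot-lower k (P (n + d)) 1≤k ⟩
          P (n + d)  ≤⟨ P≤Λ²P ⟩
          Λ ^ 2 * P n  ≤⟨ *-mono-≤ (n≤n^k k (Λ ^ 2) 1≤k) (<⇒≤ (iroot-upper k (P n) 1≤k)) ⟩
          (Λ ^ 2) ^ k * suc (a n) ^ k  ≡⟨ sym (^-distribʳ-* k (Λ ^ 2) (suc (a n))) ⟩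
          (Λ ^ 2 * suc (a n)) ^ k  ∎
      Λ^1*≤⇒ : ∀ e e′ m x → m * Λ ^ e ≤ Λ ^ e′ → Λ ^ e′ * x ≤ Λ ^ e * d → m * x ≤ d
      Λ^1*≤⇒ e e′ m x m≤ le = *-cancelˡ-≤ (Λ ^ e) {{Λ^≢0 e}} (≤-trans (≤-reflexive (lemma (Λ ^ e) m x)) (≤-trans (*-monoˡ-≤ x m≤) le))
        where
        lemma : ∀ e m x → e * (m * x) ≡ m * e * x
        lemma = solve-∀
      suc/≤ : ∀ e {_ : T (e ≤ᵇ 100)} → Λ ^ e * suc ((Y / Λ ^ e) {{Λ^≢0 e}}) ≤ 2 * Y
      suc/≤ e {t} = begin
        Λ ^ e * suc ((Y / Λ ^ e) {{Λ^≢0 e}})  ≡⟨ *-suc (Λ ^ e) _ ⟩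
        Λ ^ e + Λ ^ e * (Y / Λ ^ e) {{Λ^≢0 e}}  ≤⟨ +-mono-≤ (Λ^≤Y {e} {t}) (≤-trans (≤-reflexive (*-comm (Λ ^ e) _)) (m/n*n≤m Y (Λ ^ e) {{Λ^≢0 e}})) ⟩
        Y + Y  ≡⟨ cong (_+_ Y) (sym (+-identityʳ Y)) ⟩
        2 * Y  ∎
        where open ≤-Reasoning
      x₁ = suc (Y / V) * suc (suc (2 * g))
      x₁-small : 2 * x₁ ≤ d
      x₁-small = Λ^1*≤⇒ 4 5 2 x₁ (bound (const 2 ⊗ power 4)) (begin
        V * (suc (Y / V) * suc (suc (2 * g)))  ≡⟨ sym (*-assoc V _ _) ⟩
        V * suc (Y / V) * suc (suc (2 * g))  ≤⟨ *-mono-≤ (suc/≤ 5) (≤-trans (+-monoˡ-≤ (2 * g) (*-monoʳ-≤ 2 1≤g)) (≤-reflexive (lemma g))) ⟩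
        2 * Y * (4 * g)  ≡⟨ lemma₂ Y g ⟩
        8 * (Y * g)  ≤⟨ *-monoʳ-≤ 8 Yg≤ ⟩
        8 * (Λ ^ 3 * d)  ≡⟨ sym (*-assoc 8 (Λ ^ 3) d) ⟩
        8 * Λ ^ 3 * d  ≤⟨ *-monoˡ-≤ d (bound (const 8 ⊗ power 3)) ⟩
        Λ ^ 4 * d  ∎)
        where
        open ≤-Reasoning
        lemma : ∀ g → 2 * g + 2 * g ≡ 4 * g
        lemma = solve-∀
        lemma₂ : ∀ y g → 2 * y * (4 * g) ≡ 8 * (y * g)
        lemma₂ = solve-∀
      x₂ = suc (Y / hi) * (V * suc (suc (2 * lo * g)))
      x₂-small : 4 * x₂ ≤ d
      x₂-small = Λ^1*≤⇒ 27 28 4 x₂ (bound (const 4 ⊗ power 27)) (begin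
        hi * (suc (Y / hi) * (V * suc (suc (2 * lo * g))))  ≡⟨ sym (*-assoc hi _ _) ⟩
        hi * suc (Y / hi) * (V * suc (suc (2 * lo * g)))  ≤⟨ *-mono-≤ (suc/≤ 28) (*-monoʳ-≤ V (≤-trans (+-monoˡ-≤ (2 * lo * g) (*-mono-≤ {2} {2 * lo} {1} {g} (≤-trans (≤-reflexive (sym (*-identityʳ 2))) (*-monoʳ-≤ 2 (>-nonZero⁻¹ lo))) 1≤g)) (≤-reflexive (lemma lo g)))) ⟩
        2 * Y * (V * (4 * lo * g))  ≡⟨ lemma₂ Y V lo g ⟩
        8 * (V * lo) * (Y * g)  ≤⟨ *-mono-≤ (bound (const 8 ⊗ (power 5 ⊗ power 18))) Yg≤ ⟩
        Λ ^ 24 * (Λ ^ 3 * d)  ≡⟨ trans (sym (*-assoc (Λ ^ 24) (Λ ^ 3) d)) (cong (_* d) (sym (^-distribˡ-+-* Λ 24 3))) ⟩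
        Λ ^ 27 * d  ∎)
        where
        open ≤-Reasoning
        lemma : ∀ l g → 2 * l * g + 2 * l * g ≡ 4 * l * g
        lemma = solve-∀
        lemma₂ : ∀ y v l g → 2 * y * (v * (4 * l * g)) ≡ 8 * (v * l) * (y * g)
        lemma₂ = solve-∀
      loτ≤ : lo * τ ≤ Λ ^ 11 * d
      loτ≤ = begin
        lo * τ  ≡⟨ trans (*-suc lo _) (cong (_+_ lo) (*-comm lo _)) ⟩
        lo + suc (2 * V) * Y / lo * lo  ≤⟨ +-mono-≤ (small (power 18)) (m/n*n≤m (suc (2 * V) * Y) lo) ⟩
        d + suc (2 * V) * Y  ≤⟨ +-monoʳ-≤ d (*-mono-≤ (bound (lift 6 (const 1) ⊕ (const 2 ⊗ power 5))) Y≤) ⟩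
        d + Λ ^ 7 * (Λ ^ 3 * d)  ≡⟨ cong (_+_ d) (trans (sym (*-assoc (Λ ^ 7) (Λ ^ 3) d)) (cong (_* d) (sym (^-distribˡ-+-* Λ 7 3)))) ⟩
        (1 + Λ ^ 10) * d  ≤⟨ *-monoˡ-≤ d (bound (lift 10 (const 1) ⊕ power 10)) ⟩
        Λ ^ 11 * d  ∎
        where open ≤-Reasoning
      Λ⁶τ≤ : 100 * Λ ^ 6 * τ ≤ d
      Λ⁶τ≤ = Λ^1*≤⇒ 11 18 (100 * Λ ^ 6) τ (bound (const 100 ⊗ power 6 ⊗ power 11)) loτ≤
      τ≤ : ∀ m → m ≤ 100 * Λ ^ 6 → m * τ ≤ d
      τ≤ m le = ≤-trans (*-monoˡ-≤ τ le) Λ⁶τ≤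
      ≤100Λ⁶ : ∀ m {_ : T (m ≤ᵇ 100)} → m ≤ 100 * Λ ^ 6
      ≤100Λ⁶ m {t} = ≤-trans (≤ᵇ⇒≤ m 100 t) (m≤m*n 100 (Λ ^ 6) {{Λ^≢0 6}})
      double : ∀ {x y} → 2 * x ≤ d → 2 * y ≤ d → x + y ≤ d
      double {x} {y} p q = *-cancelˡ-≤ 2 (≤-trans (≤-reflexive (*-distribˡ-+ 2 x y)) (≤-trans (+-mono-≤ p q) (≤-reflexive (cong (_+_ d) (sym (+-identityʳ d))))))

      many₁ : x₁ + 2 * suc (V * F) ≤ length xs
      many₁ = ≤-trans (double {x₁} x₁-small (small (const 2 ⊗ (const 2 ⊗ (lift 33 (const 1) ⊕ (power 5 ⊗ power 28)))))) (≤-reflexive (sym length-xs))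

      many₂ : x₂ + 2 * τ + 2 * F ≤ length xs
      many₂ = ≤-trans (double {x₂ + 2 * τ} (≤-trans (≤-reflexive (*-distribˡ-+ 2 x₂ (2 * τ))) (double {2 * x₂} (≤-trans (≤-reflexive (sym (*-assoc 2 2 x₂))) x₂-small) (≤-trans (≤-reflexive (lemma τ)) (τ≤ 8 (≤100Λ⁶ 8)))))
                        (small (const 2 ⊗ (const 2 ⊗ power 28)))) (≤-reflexive (sym length-xs))
        where
        lemma : ∀ t → 2 * (2 * (2 * t)) ≡ 8 * t
        lemma = solve-∀

      long : suc (2 * V) * Y ≤ τ * lo
      long = <⇒≤ (<suc/* (suc (2 * V) * Y) lo)

      enough-units : ∀ q → Prime q → q ≤ V → V * V + 2 * V + (2 * F + 2 * τ) ≤ count (indivisible q) xs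
      enough-units q qp q≤V = *-cancelˡ-≤ (Λ ^ 6) {{Λ^≢0 6}} (≤-trans left right)
        where
        open ≤-Reasoning
        e = count (indivisible q) xs
        x = V * V + 2 * V + 2 * F
        lemma : ∀ l v f t → l * (v + (f + t)) ≡ l * (v + f) + l * t
        lemma = solve-∀
        lemma₂ : ∀ l t → 2 * (l * (2 * t)) ≡ 4 * l * t
        lemma₂ = solve-∀
        left : Λ ^ 6 * (V * V + 2 * V + (2 * F + 2 * τ)) ≤ d
        left = ≤-trans (≤-reflexive (lemma (Λ ^ 6) (V * V + 2 * V) (2 * F) (2 * τ)))
          (double {Λ ^ 6 * (V * V + 2 * V + 2 * F)} {Λ ^ 6 * (2 * τ)} (small (const 2 ⊗ (power 6 ⊗ (lift 29 ((power 5 ⊗ power 5) ⊕ lift 10 (const 2 ⊗ power 5)) ⊕ (const 2 ⊗ power 28)))))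
                  (≤-trans (≤-reflexive (lemma₂ (Λ ^ 6) τ)) (τ≤ (4 * Λ ^ 6) (*-monoˡ-≤ (Λ ^ 6) (≤ᵇ⇒≤ 4 100 _)))))
        right : d ≤ Λ ^ 6 * e
        right = begin
          d  ≤⟨ units q qp q≤V ⟩
          4 * q * ∑ d (λ i → indicator (indivisible q (a (n + suc i))))  ≡⟨ cong (4 * q *_) (sym (trans (count-window a (indivisible q) (suc n) d) (∑-cong d (λ i _ → cong (indicator ∘ indivisible q ∘ a) (sym (+-suc n i)))))) ⟩
          4 * q * e  ≤⟨ *-monoˡ-≤ e (bound (const 4 ⊗ pow {a = 5} q≤V)) ⟩
          Λ ^ 6 * e  ∎

      split-c : ∀ m l t v → m * (2 * l + 2 * t + 2 * v) ≡ m * (2 * l + 2 * v) + 2 * m * t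
      split-c = solve-∀

      Λ⁴c≤d : Λ ^ 4 * c ≤ d
      Λ⁴c≤d = ≤-trans (≤-reflexive (split-c (Λ ^ 4) F τ V))
        (double {Λ ^ 4 * (2 * F + 2 * V)} {2 * Λ ^ 4 * τ} (small (const 2 ⊗ (power 4 ⊗ ((const 2 ⊗ power 28) ⊕ lift 29 (const 2 ⊗ power 5)))))
                (≤-trans (≤-reflexive (lemma (Λ ^ 4) τ)) (τ≤ (4 * Λ ^ 4) (*-mono-≤ (≤ᵇ⇒≤ 4 100 _) (^-monoʳ-≤ Λ (≤ᵇ⇒≤ 4 6 _))))))
        where
        lemma : ∀ l t → 2 * (2 * l * t) ≡ 4 * l * t
        lemma = solve-∀

      2c≤d : 2 * c ≤ d
      2c≤d = ≤-trans (*-monoˡ-≤ c (≤-trans (≤-trans (≤ᵇ⇒≤ 2 100 _) 100≤Λ) (m≤m*n Λ (Λ ^ 3) {{Λ^≢0 3}}))) Λ⁴c≤d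

    -- Only c elements are spent on the construction. As Λ^4 c ≤ d ≤ n and Y ≤ Λ^3 a(n), the bottom
    -- c Y of the interval is at most n a(n) / Q; as 2 c ≤ d, at least half of the window is left
    -- over and its total reaches t.
    subset-sums : ∀ Q → Q ≤ Λ → 1 ≤ Q → ∀ t → n * a n ≤ Q * t → 2 * t ≤ d * a (suc n) → Sub xs t
    subset-sums Q Q≤Λ 1≤Q t lower upper = finish (complete-sums Y g xs bounded mult V F lo hi τ c ≤-refl many₁ many₂ long enough-units ≤-refl)
      where
      finish : ∃[ zs ] ∃[ rest ] (xs ↭ zs ++ rest × length zs ≤ c × (∀ t → c * Y ≤ t → t ≤ total rest → Sub xs t)) → Sub xs t
      finish (zs , rest , e , len , every) = every t cY≤t t≤total
        where
        open ≤-Reasoning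
        cY≤t : c * Y ≤ t
        cY≤t = *-cancelˡ-≤ Q {{>-nonZero 1≤Q}} (begin
          Q * (c * Y)  ≤⟨ *-mono-≤ Q≤Λ (*-monoʳ-≤ c Y≤a) ⟩
          Λ * (c * (Λ ^ 3 * a n))  ≡⟨ lemma Λ c (Λ ^ 3) (a n) ⟩
          Λ ^ 4 * c * a n  ≤⟨ *-monoˡ-≤ (a n) (≤-trans Λ⁴c≤d d≤n) ⟩
          n * a n  ≤⟨ lower ⟩
          Q * t  ∎)
          where
          lemma : ∀ l c e x → l * (c * (e * x)) ≡ l * e * c * x
          lemma = solve-∀
        rest≥ : All (a (suc n) ≤_) rest
        rest≥ = AllP.++⁻ʳ zs (PermP.All-resp-↭ e (All-window a (suc n) d (λ j n<j _ → a-mono (s≤s z≤n) n<j)))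
        d≤ : d ≤ c + length rest
        d≤ = ≤-trans (≤-reflexive (trans (sym length-xs) (trans (PermP.↭-length e) (length-++ zs)))) (+-monoˡ-≤ (length rest) len)
        d≤2rest : d ≤ 2 * length rest
        d≤2rest = +-cancelˡ-≤ d _ _ (begin
          d + d  ≡⟨ cong (_+_ d) (sym (+-identityʳ d)) ⟩
          2 * d  ≤⟨ *-monoʳ-≤ 2 d≤ ⟩
          2 * (c + length rest)  ≡⟨ *-distribˡ-+ 2 c (length rest) ⟩
          2 * c + 2 * length rest  ≤⟨ +-monoˡ-≤ (2 * length rest) 2c≤d ⟩
          d + 2 * length rest  ∎)
        t≤total : t ≤ total rest
        t≤total = *-cancelˡ-≤ 2 (begin
          2 * t  ≤⟨ upper ⟩
          d * a (suc n)  ≤⟨ *-monoˡ-≤ (a (suc n)) d≤2rest ⟩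
          2 * length rest * a (suc n)  ≡⟨ *-assoc 2 (length rest) (a (suc n)) ⟩
          2 * (length rest * a (suc n))  ≤⟨ *-monoʳ-≤ 2 (length*≤total (a (suc n)) rest rest≥) ⟩
          2 * total rest  ∎)

-- Growth and double logarithms

2^-cancel-< : ∀ {a b} → 2 ^ a < 2 ^ b → a < b
2^-cancel-< {a} {b} lt with a <? b
... | yes a<b = a<b
... | no a≮b  = ⊥-elim (<⇒≱ lt (^-monoʳ-≤ 2 (≮⇒≥ a≮b)))

n<2^n : ∀ n → suc n ≤ 2 ^ n
n<2^n zero    = ≤-refl
n<2^n (suc n) = ≤-trans (+-mono-≤ (m^n>0 2 n) (n<2^n n)) (≤-reflexive (cong (_+_ (2 ^ n)) (sym (+-identityʳ (2 ^ n)))))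

exponential-growth : ∀ c → ∃[ ℓ₀ ] (∀ ℓ → ℓ₀ ≤ ℓ → c * (suc ℓ * suc ℓ) ≤ 2 ^ ℓ)
exponential-growth c = ℓ₀ , λ ℓ le → subst (λ ℓ → c * (suc ℓ * suc ℓ) ≤ 2 ^ ℓ) (m∸n+n≡m le) (from (ℓ ∸ ℓ₀))
  where
  open ≤-Reasoning
  -- In 2^(3u) one factor 2^u dominates the constant 16 c and the other two dominate the two factors
  -- u + 1.
  u = suc (16 * c)
  ℓ₀ = u + (u + u)
  base : c * (suc ℓ₀ * suc ℓ₀) ≤ 2 ^ ℓ₀
  base = begin
    c * (suc ℓ₀ * suc ℓ₀)  ≤⟨ *-monoʳ-≤ c (*-mono-≤ ℓ₀≤ ℓ₀≤) ⟩
    c * (4 * suc u * (4 * suc u))  ≡⟨ lemma c (suc u) ⟩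
    16 * c * (suc u * suc u)  ≤⟨ *-mono-≤ (≤-trans (n≤1+n (16 * c)) (≤-trans (n≤1+n u) (n<2^n u))) (*-mono-≤ (n<2^n u) (n<2^n u)) ⟩
    2 ^ u * (2 ^ u * 2 ^ u)  ≡⟨ sym (trans (^-distribˡ-+-* 2 u (u + u)) (cong (2 ^ u *_) (^-distribˡ-+-* 2 u u))) ⟩
    2 ^ ℓ₀  ∎
    where
    lemma : ∀ c v → c * (4 * v * (4 * v)) ≡ 16 * c * (v * v)
    lemma = solve-∀
    lemma₂ : ∀ u → suc (u + (u + u)) + (3 + u) ≡ 4 * suc u
    lemma₂ = solve-∀
    ℓ₀≤ : suc ℓ₀ ≤ 4 * suc u
    ℓ₀≤ = ≤-trans (m≤m+n (suc ℓ₀) (3 + u)) (≤-reflexive (lemma₂ u))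
  from : ∀ j → c * (suc (j + ℓ₀) * suc (j + ℓ₀)) ≤ 2 ^ (j + ℓ₀)
  from zero    = base
  from (suc j) = begin
    c * (suc (suc ℓ) * suc (suc ℓ))  ≤⟨ *-monoʳ-≤ c (step ℓ 2≤ℓ) ⟩
    c * (2 * (suc ℓ * suc ℓ))  ≡⟨ lemma c (suc ℓ * suc ℓ) ⟩
    2 * (c * (suc ℓ * suc ℓ))  ≤⟨ *-monoʳ-≤ 2 (from j) ⟩
    2 * 2 ^ ℓ  ∎
    where
    ℓ = j + ℓ₀
    2≤ℓ : 2 ≤ ℓ
    2≤ℓ = ≤-trans (+-mono-≤ {1} {u} {1} {u + u} (s≤s z≤n) (s≤s z≤n)) (m≤n+m ℓ₀ j)
    lemma : ∀ c x → c * (2 * x) ≡ 2 * (c * x)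
    lemma = solve-∀
    step : ∀ ℓ → 2 ≤ ℓ → suc (suc ℓ) * suc (suc ℓ) ≤ 2 * (suc ℓ * suc ℓ)
    step (suc zero) (s≤s ())
    step (suc (suc x)) _ = ≤-trans (m≤m+n _ (2 + 4 * x + x * x)) (≤-reflexive (lemma₃ x))
      where
      lemma₃ : ∀ x → suc (suc (suc (suc x))) * suc (suc (suc (suc x))) + (2 + 4 * x + x * x) ≡ 2 * (suc (suc (suc x)) * suc (suc (suc x)))
      lemma₃ = solve-∀

-- Λ = 2^ℓ then satisfies Λ ≤ log₂ X < 2Λ. Taking Λ to be a power of two makes its powers powers of
-- two as well, as needed for 2^r = Λ^303.
double-log : ∀ X → 2 ≤ X → ∃[ ℓ ] (2 ^ (2 ^ ℓ) ≤ X × X < 2 ^ (2 ^ ℓ) * 2 ^ (2 ^ ℓ))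
double-log X 2≤X = outer (largest-exponent 2 X ≤-refl (<⇒≤ 2≤X))
  where
  outer : ∃[ e ] (2 ^ e ≤ X × X < 2 ^ suc e) → ∃[ ℓ ] (2 ^ (2 ^ ℓ) ≤ X × X < 2 ^ (2 ^ ℓ) * 2 ^ (2 ^ ℓ))
  outer (zero  , lo , hi) = ⊥-elim (<⇒≱ hi 2≤X)
  outer (suc e , lo , hi) = inner (largest-exponent 2 (suc e) ≤-refl (s≤s z≤n))
    where
    inner : ∃[ ℓ ] (2 ^ ℓ ≤ suc e × suc e < 2 ^ suc ℓ) → ∃[ ℓ ] (2 ^ (2 ^ ℓ) ≤ X × X < 2 ^ (2 ^ ℓ) * 2 ^ (2 ^ ℓ))
    inner (ℓ , lo′ , hi′) = ℓ , ≤-trans (^-monoʳ-≤ 2 lo′) lo ,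
      <-≤-trans hi (≤-trans (^-monoʳ-≤ 2 hi′) (≤-reflexive (trans (cong (λ e → 2 ^ (2 ^ ℓ + e)) (+-identityʳ (2 ^ ℓ))) (^-distribˡ-+-* 2 (2 ^ ℓ) (2 ^ ℓ)))))

between-steps : ∀ (F : ℕ → ℕ) y j n → F n ≤ y → y < F (n + j) → ∃[ m ] (n ≤ m × F m ≤ y × y < F (suc m))
between-steps F y zero    n lo hi = ⊥-elim (<⇒≱ hi (≤-trans (≤-reflexive (cong F (+-identityʳ n))) lo))
between-steps F y (suc j) n lo hi with F (suc n) ≤? y
... | no gt  = n , ≤-refl , lo , ≰⇒> gt
... | yes le = shift (between-steps F y j (suc n) le (subst (λ m → y < F m) (+-suc n j) hi))
  where
  shift : ∃[ m ] (suc n ≤ m × F m ≤ y × y < F (suc m)) → ∃[ m ] (n ≤ m × F m ≤ y × y < F (suc m))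
  shift (m , n<m , rest) = m , <⇒≤ n<m , rest

-- Representation of all large integers

AvoidsMultiples : (ℕ → ℕ) → ℕ → ℕ → ℕ → ℕ → Set
AvoidsMultiples P k A B C = 2 ≤ k → ∀ {Λ} ℓ → Λ ≡ 2 ^ ℓ → 1 ≤ ℓ → 100 ≤ Λ → k * 2 ^ k ≤ Λ → ∀ q → 2 ≤ q → q ≤ Λ ^ 5 → ∀ n d → 1 ≤ n →
  (Λ ^ (A * (B * ℓ) + C)) ^ k ≤ P n → P (n + d) < 2 ^ Λ * 2 ^ Λ → 32 * q * P (n + d) ≤ Λ ^ 9 * d →
  d ≤ 4 * q * ∑ d (λ i → indicator (indivisible q (iroot k (P (n + suc i)))))

avoids-multiples : ∀ {P} → IsPrimeEnumeration P → ∀ {k} → AvoidsMultiples P k 144 303 300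
avoids-multiples isEnum 2≤k ℓ refl 1≤ℓ 100≤Λ c≤Λ = PrimesAvoiding.few-divisible isEnum 2≤k ℓ 1≤ℓ 100≤Λ c≤Λ

-- A, B, C are 144, 303, 300 in the end; they stay abstract because the numerals would be unfolded in unary.
module Representation {P : ℕ → ℕ} (isEnum : IsPrimeEnumeration P) {k : ℕ} (1≤k : 1 ≤ k) (D : ℕ) (1≤D : 1 ≤ D)
  (A B C : ℕ) (100≤C : 100 ≤ C) (few-divisible : AvoidsMultiples P k A B C) where

  open PrimeIndex isEnum
  open RootWindow isEnum 1≤k

  private
    instance
      D≢0 : NonZero D
      D≢0 = >-nonZero 1≤D

  -- Written as a power of two, Λ^4 G^k has an exponent quadratic in ℓ, whereas P (n + d) ≥ 2^Λ has
  -- exponent 2^ℓ. Hence the price G of Legendre's sieve is affordable for large ℓ.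
  exponent-bound : ∀ ℓ → ℓ * 4 + ℓ * (A * (B * ℓ) + C) * k ≤ (A * B * k + C * k + 4) * (suc ℓ * suc ℓ)
  exponent-bound ℓ = ≤-trans (m≤m+n _ (A * B * k * (2 * ℓ + 1) + C * k * (ℓ * ℓ + ℓ + 1) + 4 * (ℓ * ℓ + ℓ + 1))) (≤-reflexive (lemma A B C k ℓ))
    where
    lemma : ∀ A B C k ℓ → ℓ * 4 + ℓ * (A * (B * ℓ) + C) * k + (A * B * k * (2 * ℓ + 1) + C * k * (ℓ * ℓ + ℓ + 1) + 4 * (ℓ * ℓ + ℓ + 1))
      ≡ (A * B * k + C * k + 4) * (suc ℓ * suc ℓ)
    lemma = solve-∀

  c₀ : ℕ
  c₀ = A * B * k + C * k + 4

  c : ℕ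
  c = c₀ + (100 + (k * 2 ^ k + 10 * D))

  power-of-two : ∀ {Λ} ℓ E → Λ ≡ 2 ^ ℓ → Λ ^ 4 * (Λ ^ E) ^ k ≡ 2 ^ (ℓ * 4 + ℓ * E * k)
  power-of-two ℓ E refl = trans (cong₂ _*_ (^-*-assoc 2 ℓ 4) (trans (cong (_^ k) (^-*-assoc 2 ℓ E)) (^-*-assoc 2 (ℓ * E) k)))
    (sym (^-distribˡ-+-* 2 (ℓ * 4) (ℓ * E * k)))

  cancel-powers : ∀ Λ {{_ : NonZero Λ}} x d y → Λ ^ 4 * x ≤ y → y ≤ Λ ^ 2 * d → x ≤ d
  cancel-powers Λ x d y lower upper = *-cancelˡ-≤ (Λ ^ 2) {{m^n≢0 Λ 2}}
    (≤-trans (*-monoˡ-≤ x (^-monoʳ-≤ Λ {2} {4} (s≤s (s≤s z≤n)))) (≤-trans lower upper))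

  module Scale (Λ ℓ : ℕ) (Λ≡ : Λ ≡ 2 ^ ℓ) (growth : c * (suc ℓ * suc ℓ) ≤ Λ) (n : ℕ) (5D≤n : 5 * D ≤ n)
    (P-lower : 2 ^ Λ ≤ P (n + n / D)) (P-upper : P (n + n / D) < 2 ^ Λ * 2 ^ Λ) where

    private
      d = n / D
      c≤Λ : c ≤ Λ
      c≤Λ = ≤-trans (m≤m*n c (suc ℓ * suc ℓ)) growth
      tail≤Λ : 100 + (k * 2 ^ k + 10 * D) ≤ Λ
      tail≤Λ = ≤-trans (m≤n+m _ c₀) c≤Λ
      100≤Λ : 100 ≤ Λ
      100≤Λ = ≤-trans (m≤m+n 100 _) tail≤Λ
      k2^k≤Λ : k * 2 ^ k ≤ Λ
      k2^k≤Λ = ≤-trans (m≤m+n (k * 2 ^ k) (10 * D)) (≤-trans (m≤n+m _ 100) tail≤Λ)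
      10D≤Λ : 10 * D ≤ Λ
      10D≤Λ = ≤-trans (m≤n+m (10 * D) (k * 2 ^ k)) (≤-trans (m≤n+m _ 100) tail≤Λ)

    open PowersOf Λ 100≤Λ

    private
      E = A * (B * ℓ) + C
      G = Λ ^ E
      D≤n : D ≤ n
      D≤n = ≤-trans (m≤n*m D 5) 5D≤n
      1≤n : 1 ≤ n
      1≤n = ≤-trans 1≤D D≤n
      d≤n : d ≤ n
      d≤n = m/n≤m n D
      n≤2Dd : n ≤ 2 * D * d
      n≤2Dd = begin
        n  ≤⟨ <⇒≤ (<suc/* n D) ⟩
        D + d * D  ≤⟨ +-monoˡ-≤ (d * D) (≤-trans (≤-reflexive (sym (*-identityˡ D))) (*-monoˡ-≤ D (*≤⇒≤/ 1 D n (≤-trans (≤-reflexive (*-identityˡ D)) D≤n)))) ⟩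
        d * D + d * D  ≡⟨ lemma d D ⟩
        2 * D * d  ∎
        where
        open ≤-Reasoning
        lemma : ∀ q k → q * k + q * k ≡ 2 * k * q
        lemma = solve-∀
      1≤m : 1 ≤ n + d
      1≤m = ≤-trans 1≤n (m≤m+n n d)
      P≤5Λn : P (n + d) ≤ 5 * Λ * n
      P≤5Λn = begin
        P (n + d)  ≤⟨ P≤ (n + d) (Λ + Λ) 1≤m (≤-trans (<⇒≤ P-upper) (≤-reflexive (sym (^-distribˡ-+-* 2 Λ Λ)))) ⟩
        1 + (Λ + Λ) * (n + d)  ≤⟨ +-mono-≤ (*-mono-≤ {1} {Λ} {1} {n} (≤-trans (≤ᵇ⇒≤ 1 100 _) 100≤Λ) 1≤n) (*-monoʳ-≤ (Λ + Λ) (+-monoʳ-≤ n d≤n)) ⟩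
        Λ * n + (Λ + Λ) * (n + n)  ≡⟨ lemma Λ n ⟩
        5 * Λ * n  ∎
        where
        open ≤-Reasoning
        lemma : ∀ l n → l * n + (l + l) * (n + n) ≡ 5 * l * n
        lemma = solve-∀
      P≤Λ²d : P (n + d) ≤ Λ ^ 2 * d
      P≤Λ²d = begin
        P (n + d)  ≤⟨ P≤5Λn ⟩
        5 * Λ * n  ≤⟨ *-monoʳ-≤ (5 * Λ) n≤2Dd ⟩
        5 * Λ * (2 * D * d)  ≡⟨ lemma Λ D d ⟩
        Λ * (10 * D * 1) * d  ≤⟨ *-monoˡ-≤ d (*-monoʳ-≤ Λ (*-monoˡ-≤ 1 10D≤Λ)) ⟩
        Λ ^ 2 * d  ∎
        where
        open ≤-Reasoning
        lemma : ∀ l D d → 5 * l * (2 * D * d) ≡ l * (10 * D * 1) * d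
        lemma = solve-∀
      P≤Λ²P : P (n + d) ≤ Λ ^ 2 * P n
      P≤Λ²P = ≤-trans P≤5Λn (*-mono-≤ (≤-trans (*-monoˡ-≤ Λ (≤-trans (≤ᵇ⇒≤ 5 100 _) 100≤Λ)) (≤-reflexive (cong (Λ *_) (sym (*-identityʳ Λ))))) (<⇒≤ (P-≥ n 1≤n)))
      Λ⁴G^k≤ : Λ ^ 4 * G ^ k ≤ 2 ^ Λ
      Λ⁴G^k≤ = begin
        Λ ^ 4 * G ^ k  ≡⟨ power-of-two ℓ E Λ≡ ⟩
        2 ^ (ℓ * 4 + ℓ * E * k)  ≤⟨ ^-monoʳ-≤ 2 (≤-trans (exponent-bound ℓ) (≤-trans (*-monoˡ-≤ (suc ℓ * suc ℓ) (m≤m+n c₀ _)) growth)) ⟩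
        2 ^ Λ  ∎
        where open ≤-Reasoning
      G^k≤d : G ^ k ≤ d
      G^k≤d = cancel-powers Λ {{Λ≢0}} (G ^ k) d (2 ^ Λ) Λ⁴G^k≤ (≤-trans P-lower P≤Λ²d)
      Λ^100≤G : Λ ^ 100 ≤ G
      Λ^100≤G = Λ^-mono 100 E (≤-trans 100≤C (m≤n+m C (A * (B * ℓ))))
      Λ^100≤d : Λ ^ 100 ≤ d
      Λ^100≤d = ≤-trans Λ^100≤G (≤-trans (n≤n^k k G 1≤k) G^k≤d)
      G^k≤P : G ^ k ≤ P n
      G^k≤P = ≤-trans G^k≤d (≤-trans d≤n (<⇒≤ (P-≥ n 1≤n)))
      Λ^100≤a : Λ ^ 100 ≤ a n
      Λ^100≤a = iroot-greatest k (P n) (Λ ^ 100) 1≤k (≤-trans (^-monoˡ-≤ k Λ^100≤G) G^k≤P)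
      1≤ℓ : 1 ≤ ℓ
      1≤ℓ = 2^-cancel-< {0} (≤-trans (≤-trans (≤ᵇ⇒≤ 2 100 _) 100≤Λ) (≤-reflexive Λ≡))

      units : ∀ q → Prime q → q ≤ Λ ^ 5 → d ≤ 4 * q * ∑ d (λ i → indicator (indivisible q (a (n + suc i))))
      units q qp q≤ with m≤n⇒m<n∨m≡n 1≤k
      ... | inj₁ 2≤k = few-divisible 2≤k ℓ Λ≡ 1≤ℓ 100≤Λ k2^k≤Λ q (nonTrivial⇒n>1 q {{prime⇒nonTrivial qp}}) q≤ n d 1≤n G^k≤P P-upper (begin
          32 * q * P (n + d)  ≤⟨ *-monoʳ-≤ (32 * q) P≤Λ²d ⟩
          32 * q * (Λ ^ 2 * d)  ≡⟨ sym (*-assoc (32 * q) (Λ ^ 2) d) ⟩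
          32 * q * Λ ^ 2 * d  ≤⟨ *-monoˡ-≤ d (bound (lift 9 (const 32 ⊗ pow {a = 5} q≤ ⊗ power 2))) ⟩
          Λ ^ 9 * d  ∎)
        where open ≤-Reasoning
      -- For k = 1 the roots are the primes themselves, all larger than Λ^5 ≥ q.
      ... | inj₂ refl = begin
          d  ≡⟨ sym (trans (∑-const d 1) (*-identityʳ d)) ⟩
          ∑ d (λ _ → 1)  ≡⟨ ∑-cong d (λ i _ → cong indicator (sym (coprime i))) ⟩
          ∑ d (λ i → indicator (indivisible q (a (n + suc i))))  ≤⟨ m≤n*m _ (4 * q) {{m*n≢0 4 q {{_}} {{prime⇒nonZero qp}}}} ⟩
          4 * q * ∑ d (λ i → indicator (indivisible q (a (n + suc i))))  ∎
        where
        open ≤-Reasoning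
        q<P : ∀ j → n ≤ j → q < P j
        q<P j n≤j = ≤-<-trans (≤-trans q≤ (≤-trans (Λ^-mono 5 100 (≤ᵇ⇒≤ 5 100 _)) (≤-trans Λ^100≤d d≤n))) (≤-trans (s≤s n≤j) (P-≥ j (≤-trans 1≤n n≤j)))
        coprime : ∀ i → indivisible q (a (n + suc i)) ≡ true
        coprime i = cong not (dec-false (q ∣? a (n + suc i)) λ q∣a →
          <⇒≢ (q<P (n + suc i) (m≤m+n n (suc i)))
            (prime∣prime⇒≡′ (subst (q ∣_) (iroot-1 (P (n + suc i))) q∣a)))
          where
          prime∣prime⇒≡′ : q ∣ P (n + suc i) → q ≡ P (n + suc i)
          prime∣prime⇒≡′ = prime∣prime⇒≡ qp (IsPrimeEnumeration.prime isEnum (n + suc i) (≤-trans 1≤n (m≤m+n n (suc i))))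

    window-sums : ∀ t → n * a n ≤ 8 * D * t → 2 * t ≤ d * a (suc n) → Sub (window (suc n) d) t
    window-sums = subset-sums Λ 100≤Λ k2^k≤Λ n d 1≤n Λ^100≤d d≤n P≤Λ²d P≤Λ²P Λ^100≤a units
      (8 * D) (≤-trans (*-monoˡ-≤ D (≤ᵇ⇒≤ 8 10 _)) 10D≤Λ) (*-mono-≤ {1} {8} (s≤s z≤n) 1≤D)

  eventually-window-sums : ∃[ n₀ ] (5 * D ≤ n₀ × (∀ n → n₀ ≤ n → ∀ t → n * a n ≤ 8 * D * t → 2 * t ≤ n / D * a (suc n) → Sub (window (suc n) (n / D)) t))
  eventually-window-sums = from (exponential-growth c)
    where
    from : ∃[ ℓ₀ ] (∀ ℓ → ℓ₀ ≤ ℓ → c * (suc ℓ * suc ℓ) ≤ 2 ^ ℓ) →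
      ∃[ n₀ ] (5 * D ≤ n₀ × (∀ n → n₀ ≤ n → ∀ t → n * a n ≤ 8 * D * t → 2 * t ≤ n / D * a (suc n) → Sub (window (suc n) (n / D)) t))
    from (ℓ₀ , growth) = n₀ , m≤m+n (5 * D) (2 ^ (2 ^ ℓ₀)) , large
      where
      n₀ = 5 * D + 2 ^ (2 ^ ℓ₀)
      large : ∀ n → n₀ ≤ n → ∀ t → n * a n ≤ 8 * D * t → 2 * t ≤ n / D * a (suc n) → Sub (window (suc n) (n / D)) t
      large n n₀≤n = at (double-log (P m) (P≥2 m 1≤m))
        where
        m = n + n / D
        5D≤n : 5 * D ≤ n
        5D≤n = ≤-trans (m≤m+n (5 * D) (2 ^ (2 ^ ℓ₀))) n₀≤n
        1≤m : 1 ≤ m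
        1≤m = ≤-trans (≤-trans (*-mono-≤ {1} {5} (s≤s z≤n) 1≤D) 5D≤n) (m≤m+n n (n / D))
        at : ∃[ ℓ ] (2 ^ (2 ^ ℓ) ≤ P m × P m < 2 ^ (2 ^ ℓ) * 2 ^ (2 ^ ℓ)) → ∀ t → n * a n ≤ 8 * D * t → 2 * t ≤ n / D * a (suc n) → Sub (window (suc n) (n / D)) t
        at (ℓ , lower , upper) = Scale.window-sums (2 ^ ℓ) ℓ refl (growth ℓ ℓ₀≤ℓ) n 5D≤n lower upper
          where
          ℓ₀≤ℓ : ℓ₀ ≤ ℓ
          ℓ₀≤ℓ = ≤-pred (2^-cancel-< (2^-cancel-< {2 ^ ℓ₀} {2 ^ suc ℓ} (begin-strict
            2 ^ (2 ^ ℓ₀)  ≤⟨ ≤-trans (m≤n+m (2 ^ (2 ^ ℓ₀)) (5 * D)) n₀≤n ⟩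
            n  ≤⟨ ≤-trans (m≤m+n n (n / D)) (<⇒≤ (P-≥ m 1≤m)) ⟩
            P m  <⟨ upper ⟩
            2 ^ (2 ^ ℓ) * 2 ^ (2 ^ ℓ)  ≡⟨ sym (trans (cong (λ e → 2 ^ (2 ^ ℓ + e)) (+-identityʳ (2 ^ ℓ))) (^-distribˡ-+-* 2 (2 ^ ℓ) (2 ^ ℓ))) ⟩
            2 ^ (2 ^ suc ℓ)  ∎)))
            where open ≤-Reasoning

  initial : ℕ → ℕ
  initial n = sumFrom 1 n a

  -- 8D times the smallest h for which n is used: t = h - `initial n` has to be at least n a(n) /
  -- (8D). Choosing n by F n ≤ 8 D h < F (n + 1) makes the ranges of consecutive n adjoin.
  F : ℕ → ℕ
  F n = 8 * D * initial n + n * a n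

  n≤F : ∀ n → n ≤ F n
  n≤F zero    = z≤n
  n≤F (suc n) = ≤-trans (m≤m*n (suc n) (a (suc n)) {{>-nonZero (1≤a (suc n) (s≤s z≤n))}}) (m≤n+m _ (8 * D * initial (suc n)))

  represent : ∃[ H ] (∀ h → H ≤ h → ∃[ n ] (1 ≤ n × ∃[ t ] (h ≡ initial n + t × Sub (window (suc n) (n / D)) t)))
  represent = from eventually-window-sums
    where
    from : ∃[ n₀ ] (5 * D ≤ n₀ × (∀ n → n₀ ≤ n → ∀ t → n * a n ≤ 8 * D * t → 2 * t ≤ n / D * a (suc n) → Sub (window (suc n) (n / D)) t)) →
      ∃[ H ] (∀ h → H ≤ h → ∃[ n ] (1 ≤ n × ∃[ t ] (h ≡ initial n + t × Sub (window (suc n) (n / D)) t)))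
    from (n₀ , 5D≤n₀ , sums) = F n₀ , large
      where
      large : ∀ h → F n₀ ≤ h → ∃[ n ] (1 ≤ n × ∃[ t ] (h ≡ initial n + t × Sub (window (suc n) (n / D)) t))
      -- Since m ≤ F m, the value y has been exceeded by index n₀ + y + 1.
      large h F≤h = at (between-steps F y (suc y) n₀ (≤-trans F≤h (m≤n*m h (8 * D) {{m*n≢0 8 D}})) (<-≤-trans (m≤n+m (suc y) n₀) (n≤F (n₀ + suc y))))
        where
        y = 8 * D * h
        at : ∃[ n ] (n₀ ≤ n × F n ≤ y × y < F (suc n)) → ∃[ n ] (1 ≤ n × ∃[ t ] (h ≡ initial n + t × Sub (window (suc n) (n / D)) t))
        at (n , n₀≤n , F≤y , y<F) = n , 1≤n , t , sym S+t , sums n n₀≤n t lower upper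
          where
          open ≤-Reasoning
          S = initial n
          5D≤n : 5 * D ≤ n
          5D≤n = ≤-trans 5D≤n₀ n₀≤n
          1≤n : 1 ≤ n
          1≤n = ≤-trans (*-mono-≤ {1} {5} (s≤s z≤n) 1≤D) 5D≤n
          S≤h : S ≤ h
          S≤h = *-cancelˡ-≤ (8 * D) {{m*n≢0 8 D}} (≤-trans (m≤m+n (8 * D * S) (n * a n)) F≤y)
          t = h ∸ S
          S+t : S + t ≡ h
          S+t = m+[n∸m]≡n S≤h
          y≡ : y ≡ 8 * D * S + 8 * D * t
          y≡ = trans (cong (8 * D *_) (sym S+t)) (*-distribˡ-+ (8 * D) S t)
          lower : n * a n ≤ 8 * D * t
          lower = +-cancelˡ-≤ (8 * D * S) _ _ (≤-trans F≤y (≤-reflexive y≡))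
          8Dt≤ : 8 * D * t ≤ (8 * D + suc n) * a (suc n)
          8Dt≤ = +-cancelˡ-≤ (8 * D * S) _ _ (begin
            8 * D * S + 8 * D * t  ≡⟨ sym y≡ ⟩
            y  ≤⟨ <⇒≤ y<F ⟩
            8 * D * initial (suc n) + suc n * a (suc n)  ≡⟨ cong (λ s → 8 * D * s + suc n * a (suc n)) (sumFrom-snoc 1 n a) ⟩
            8 * D * (S + a (suc n)) + suc n * a (suc n)  ≡⟨ lemma (8 * D) S (a (suc n)) (suc n) ⟩
            8 * D * S + (8 * D + suc n) * a (suc n)  ∎)
            where
            lemma : ∀ q s a m → q * (s + a) + m * a ≡ q * s + (q + m) * a
            lemma = solve-∀
          -- Up to lower-order terms t stays below n a(n + 1) / (8D), a quarter of the permitted n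
          -- a(n + 1) / (2D). The slack absorbs the roundings as soon as 24 D + 2 ≤ 6 n, for which 5
          -- D ≤ n suffices.
          count-bound : 2 * (8 * D + suc n) ≤ 8 * D * (n / D)
          count-bound = +-cancelʳ-≤ (8 * D) _ _ (begin
            2 * (8 * D + suc n) + 8 * D  ≡⟨ lemma₁ D n ⟩
            24 * D + 2 * 1 + 2 * n  ≤⟨ +-monoˡ-≤ (2 * n) (≤-trans (+-monoʳ-≤ (24 * D) (≤-trans (*-monoʳ-≤ 2 1≤D) (m≤m+n (2 * D) (4 * D)))) (≤-trans (≤-reflexive (lemma₂ D)) (*-monoʳ-≤ 6 5D≤n))) ⟩
            6 * n + 2 * n  ≡⟨ lemma₃ n ⟩
            8 * n  ≤⟨ *-monoʳ-≤ 8 (<⇒≤ (<suc/* n D)) ⟩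
            8 * (D + n / D * D)  ≡⟨ lemma₄ D (n / D) ⟩
            8 * D * (n / D) + 8 * D  ∎)
            where
            lemma₁ : ∀ D n → 2 * (8 * D + suc n) + 8 * D ≡ 24 * D + 2 * 1 + 2 * n
            lemma₁ = solve-∀
            lemma₂ : ∀ D → 24 * D + (2 * D + 4 * D) ≡ 6 * (5 * D)
            lemma₂ = solve-∀
            lemma₃ : ∀ n → 6 * n + 2 * n ≡ 8 * n
            lemma₃ = solve-∀
            lemma₄ : ∀ D d → 8 * (D + d * D) ≡ 8 * D * d + 8 * D
            lemma₄ = solve-∀
          upper : 2 * t ≤ n / D * a (suc n)
          upper = *-cancelˡ-≤ (8 * D) {{m*n≢0 8 D}} (begin
            8 * D * (2 * t)  ≡⟨ lemma₁ (8 * D) t ⟩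
            2 * (8 * D * t)  ≤⟨ *-monoʳ-≤ 2 8Dt≤ ⟩
            2 * ((8 * D + suc n) * a (suc n))  ≡⟨ sym (*-assoc 2 (8 * D + suc n) (a (suc n))) ⟩
            2 * (8 * D + suc n) * a (suc n)  ≤⟨ *-monoˡ-≤ (a (suc n)) count-bound ⟩
            8 * D * (n / D) * a (suc n)  ≡⟨ *-assoc (8 * D) (n / D) (a (suc n)) ⟩
            8 * D * (n / D * a (suc n))  ∎)
            where
            lemma₁ : ∀ q t → q * (2 * t) ≡ 2 * (q * t)
            lemma₁ = solve-∀

theorem4p3 : (P : ℕ → ℕ) → IsPrimeEnumeration P → (k : ℕ) → 1 ≤ k → (ε : ℚ) → Positive ε →
    Σ[ H ∈ ℕ ] ∀ (h : ℕ) → h ≥ H →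
    Σ[ n ∈ ℕ ] Σ[ J ∈ (ℕ → Bool) ] (1 ≤ n × (h ≡ sumRange 1 n (λ i → iroot k (P i)) + sumRange (n + 1) (floorScale ε n) (λ j → if J j then iroot k (P j) else 0)))
theorem4p3 P isEnum k 1≤k ε ε>0 = from (floorScale-≥ ε ε>0)
  where
  a : ℕ → ℕ
  a i = iroot k (P i)
  Goal : ℕ → Set
  Goal h = Σ[ n ∈ ℕ ] Σ[ J ∈ (ℕ → Bool) ] (1 ≤ n × (h ≡ sumRange 1 n a + sumRange (n + 1) (floorScale ε n) (chosen a J)))
  from : ∃[ D ] (1 ≤ D × (∀ n z → z * D ≤ n * D + n → z ≤ floorScale ε n)) → Σ[ H ∈ ℕ ] ∀ h → h ≥ H → Goal h
  from (D , 1≤D , scale) = choose (Representation.represent isEnum 1≤k D 1≤D 144 303 300 (≤ᵇ⇒≤ 100 300 _) (avoids-multiples isEnum))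
    where
    instance
      D≢0 : NonZero D
      D≢0 = >-nonZero 1≤D
    choose : ∃[ H ] (∀ h → H ≤ h → ∃[ n ] (1 ≤ n × ∃[ t ] (h ≡ sumFrom 1 n a + t × Sub (val-window a (suc n) (n / D)) t))) → Σ[ H ∈ ℕ ] ∀ h → h ≥ H → Goal h
    choose (H , rep) = H , λ h H≤h → finish h (rep h H≤h)
      where
      finish : ∀ h → ∃[ n ] (1 ≤ n × ∃[ t ] (h ≡ sumFrom 1 n a + t × Sub (val-window a (suc n) (n / D)) t)) → Goal h
      finish h (n , 1≤n , t , h≡ , sub) = last (Sub⇒chosen a (n + 1) (suc (floorScale ε n) ∸ (n + 1)) (subst (λ s → Sub (val-window a s (suc (floorScale ε n) ∸ s)) t) (+-comm 1 n) (Sub-extend a (suc n) (n / D) (floorScale ε n ∸ n) d≤ sub)))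
        where
        d≤ : n / D ≤ floorScale ε n ∸ n
        -- The window of n / D indices used for the sums fits between n and ⌊(1+ε)n⌋; indices beyond
        -- it are simply not chosen.
        d≤ = m+n≤o⇒m≤o∸n (n / D) (scale n (n / D + n) (≤-trans (≤-reflexive (trans (*-distribʳ-+ D (n / D) n) (+-comm (n / D * D) (n * D)))) (+-monoʳ-≤ (n * D) (m/n*n≤m n D))))
        last : ∃[ J ] t ≡ sumFrom (n + 1) (suc (floorScale ε n) ∸ (n + 1)) (chosen a J) → Goal h
        last (J , t≡) = n , J , 1≤n , trans h≡ (cong (_+_ (sumFrom 1 n a)) t≡)
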